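{- Let $k\ge2$, $s\ge 3$, fix $\lambda>0$, and consider for a tuple $\mathbf a$ the statement: $(*)$ If $a_1x_1^k+\dots+a_sx_s^k=0$ has a solution $(x_{1},\dots,x_{s})$ with every $x_{j}$ prime and $x_{j}> |\mathbf a|^{\lambda}$ for all $j$, then $\mathbf a\in\mathcal{C}'(k,s)$. Then for $k\ge 2$, $s\ge 3$, $\lambda\ge 1$ and $|\mathbf a|$ sufficiently large in terms of $k$, $(*)$ always holds. For $k\ge 2$, $s\ge 4$ and all $\lambda>0$, \[\#\{|\mathbf a|\le A: (*)\text{ does not hold}\}\ll_{\lambda} A^{s-\lambda(s-3)}=o(A^{s}).\]
   Context: $\mathbf a$ denotes a tuple of nonzero integers, $|\mathbf a|=\max_j|a_j|$. $\mathcal{C}'(k,s)$ is the set of $\mathbf a$ such that $a_1x_1^k+\dots+a_sx_s^k=0$ has a solution with all $x_j\in\mathbb R^+=\{x>0\}$ and, for each prime $p$, a solution with all $x_j\in\mathbb Z_p^\times=\{x\in\mathbb Q_p:|x|_p=1\}$. Implied constants may depend on $s,k$.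
   Formalization: When s−λ(s−3)<0 the displayed bound is proved only for tuples with |a| sufficiently large in terms of k; without this it fails, e.g. k=2, s=6, a=(1,1,1,1,1,−1), λ>2, where 4·2²+3²=5² but there is no solution in 2-adic units. -}

module Defs where

open import Algebra.Bundles using (RawRing; CommutativeRing)
import Algebra.Definitions.RawSemiring as RawSemiringDefs
import Algebra.Properties.Semiring.Exp as SemiringExp
open import Data.Fin.Base using (Fin)
open import Data.Integer.Base as ℤ using (ℤ; +_; -[1+_])
import Data.Integer.Divisibility.Signed as ℤd
import Data.Integer.Properties as ℤₚ
open import Data.List.Base using (List; length)
import Data.List.Relation.Unary.All as ListAll
open import Data.List.Relation.Unary.Unique.Propositional using (Unique)
open import Data.Nat.Base as ℕ using (ℕ; zero; suc)
import Data.Nat.Divisibility as ℕd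
open import Data.Nat.Induction using (<-rec)
open import Data.Nat.Primality using (Prime; euclidsLemma; prime⇒nonZero; prime⇒nonTrivial)
import Data.Nat.Properties as ℕₚ
open import Data.Product.Base using (∃; ∃-syntax; _×_; _,_; proj₁; proj₂)
open import Data.Rational.Base as ℚ using (ℚ; mkℚ; 0ℚ; 1ℚ; _/_; ↥_; ↧_; ↧ₙ_)
import Data.Rational.Properties as ℚₚ
import Data.Rational.Unnormalised.Base as ℚᵘ
import Data.Rational.Unnormalised.Properties as ℚᵘₚ
open import Data.Rational.Solver using (module +-*-Solver)
open import Data.Sum.Base using (_⊎_; inj₁; inj₂)
open import Data.Vec.Base using (Vec; foldr′; lookup)
open import Data.Vec.Functional using (Vector)
import Data.Vec.Relation.Unary.All as VecAll
open import Function.Base using (id)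
open import Level using (0ℓ)
open import Relation.Binary.PropositionalEquality
open import Relation.Nullary using (¬_; yes; no; contradiction)

open +-*-Solver using (solve; _:=_; _:*_; _:+_; _:-_; :-_)

------------------------------------------------------------------------
-- Absolute values on ℚ

-- ∣-p∣≡∣p∣ is redundant: it follows from multiplicativity, positivity and
-- definiteness.
record AbsoluteValue : Set where
  field
    ∣_∣         : ℚ → ℚ
    0≤∣p∣       : ∀ p → 0ℚ ℚ.≤ ∣ p ∣
    ∣0∣≡0       : ∣ 0ℚ ∣ ≡ 0ℚ
    ∣p∣≡0⇒p≡0   : ∀ p → ∣ p ∣ ≡ 0ℚ → p ≡ 0ℚ
    ∣-p∣≡∣p∣    : ∀ p → ∣ ℚ.- p ∣ ≡ ∣ p ∣
    ∣p*q∣≡∣p∣*∣q∣ : ∀ p q → ∣ p ℚ.* q ∣ ≡ ∣ p ∣ ℚ.* ∣ q ∣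
    ∣p+q∣≤∣p∣+∣q∣ : ∀ p q → ∣ p ℚ.+ q ∣ ℚ.≤ ∣ p ∣ ℚ.+ ∣ q ∣

module AbsoluteValueProperties (V : AbsoluteValue) where
  open AbsoluteValue V

  private
    ∣a∣-∣b∣≤∣a-b∣ : ∀ a b → ∣ a ∣ ℚ.- ∣ b ∣ ℚ.≤ ∣ a ℚ.- b ∣
    ∣a∣-∣b∣≤∣a-b∣ a b = begin
      ∣ a ∣ ℚ.- ∣ b ∣                        ≡⟨ cong (λ c → ∣ c ∣ ℚ.- ∣ b ∣) (solve 2 (λ a b → a := (a :- b) :+ b) refl a b) ⟩
      ∣ (a ℚ.- b) ℚ.+ b ∣ ℚ.- ∣ b ∣          ≤⟨ ℚₚ.+-monoˡ-≤ (ℚ.- ∣ b ∣) (∣p+q∣≤∣p∣+∣q∣ (a ℚ.- b) b) ⟩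
      (∣ a ℚ.- b ∣ ℚ.+ ∣ b ∣) ℚ.- ∣ b ∣      ≡⟨ solve 2 (λ x y → (x :+ y) :- y := x) refl ∣ a ℚ.- b ∣ ∣ b ∣ ⟩
      ∣ a ℚ.- b ∣                            ∎
      where open ℚₚ.≤-Reasoning

  reverse-triangle : ∀ a b → ℚ.∣ ∣ a ∣ ℚ.- ∣ b ∣ ∣ ℚ.≤ ∣ a ℚ.- b ∣
  reverse-triangle a b with ℚₚ.∣p∣≡p∨∣p∣≡-p (∣ a ∣ ℚ.- ∣ b ∣)
  ... | inj₁ eq = subst (ℚ._≤ ∣ a ℚ.- b ∣) (sym eq) (∣a∣-∣b∣≤∣a-b∣ a b)
  ... | inj₂ eq = begin
    ℚ.∣ ∣ a ∣ ℚ.- ∣ b ∣ ∣   ≡⟨ eq ⟩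
    ℚ.- (∣ a ∣ ℚ.- ∣ b ∣)   ≡⟨ solve 2 (λ x y → :- (x :- y) := y :- x) refl ∣ a ∣ ∣ b ∣ ⟩
    ∣ b ∣ ℚ.- ∣ a ∣         ≤⟨ ∣a∣-∣b∣≤∣a-b∣ b a ⟩
    ∣ b ℚ.- a ∣             ≡⟨ cong ∣_∣ (solve 2 (λ a b → b :- a := :- (a :- b)) refl a b) ⟩
    ∣ ℚ.- (a ℚ.- b) ∣       ≡⟨ ∣-p∣≡∣p∣ (a ℚ.- b) ⟩
    ∣ a ℚ.- b ∣             ∎
    where open ℚₚ.≤-Reasoning

usual : AbsoluteValue
usual = record
  { ∣_∣           = ℚ.∣_∣
  ; 0≤∣p∣         = ℚₚ.0≤∣p∣
  ; ∣0∣≡0         = refl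
  ; ∣p∣≡0⇒p≡0     = ℚₚ.∣p∣≡0⇒p≡0
  ; ∣-p∣≡∣p∣      = ℚₚ.∣-p∣≡∣p∣
  ; ∣p*q∣≡∣p∣*∣q∣ = ℚₚ.∣p*q∣≡∣p∣*∣q∣
  ; ∣p+q∣≤∣p∣+∣q∣ = ℚₚ.∣p+q∣≤∣p∣+∣q∣
  }

module PAdicAbsoluteValue (p : ℕ) (p-prime : Prime p) where

  open SemiringExp (CommutativeRing.semiring ℚₚ.+-*-commutativeRing) using ()
    renaming (_^_ to _^ℚ_; ^-homo-* to ^ℚ-homo-*)

  private instance
    p-nonZero : ℕ.NonZero p
    p-nonZero = prime⇒nonZero p-prime

    p-nonTrivial : ℕ.NonTrivial p
    p-nonTrivial = prime⇒nonTrivial p-prime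

  -- n = pᵛm with p ∤ m.
  HasValuation : ℕ → ℕ → Set
  HasValuation n v = ∃[ m ] n ≡ p ℕ.^ v ℕ.* m × ¬ (p ℕd.∣ m)

  factor : ∀ n → ℕ.NonZero n → ∃ (HasValuation n)
  factor = <-rec (λ n → ℕ.NonZero n → ∃ (HasValuation n)) step
    where
    step : ∀ n → (∀ {m} → m ℕ.< n → ℕ.NonZero m → ∃ (HasValuation m)) →
           ℕ.NonZero n → ∃ (HasValuation n)
    step n rec n≢0 with p ℕd.∣? n
    ... | no p∤n = 0 , n , sym (ℕₚ.*-identityˡ n) , p∤n
    ... | yes p∣n
      with v , m , q≡pᵛm , p∤m ← rec (ℕd.quotient-< p∣n {{p-nonTrivial}} {{n≢0}}) (ℕd.quotient≢0 p∣n {{n≢0}})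
      = suc v , m , n≡ , p∤m
      where
      open ≡-Reasoning
      n≡ : n ≡ p ℕ.^ suc v ℕ.* m
      n≡ = begin
        n                         ≡⟨ ℕd.m∣n⇒n≡m*quotient p∣n ⟩
        p ℕ.* ℕd.quotient p∣n     ≡⟨ cong (p ℕ.*_) q≡pᵛm ⟩
        p ℕ.* (p ℕ.^ v ℕ.* m)     ≡⟨ sym (ℕₚ.*-assoc p (p ℕ.^ v) m) ⟩
        p ℕ.^ suc v ℕ.* m         ∎

  -- The exponent of p in n; the value at 0 is never used.
  ν : ℕ → ℕ
  ν zero        = 0
  ν n@(suc _)   = proj₁ (factor n _)

  ν-hasValuation : ∀ n .{{_ : ℕ.NonZero n}} → HasValuation n (ν n)
  ν-hasValuation n@(suc _) = proj₂ (factor n _)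

  pᵛ∣n⇒v≤w : ∀ {n v w} → HasValuation n w → p ℕ.^ v ℕd.∣ n → v ℕ.≤ w
  pᵛ∣n⇒v≤w {n} {v} {w} (m , n≡ , p∤m) pᵛ∣n with v ℕₚ.≤? w
  ... | yes v≤w = v≤w
  ... | no  v≰w = contradiction p∣m p∤m
    where
    pw≢0 : ℕ.NonZero (p ℕ.^ w)
    pw≢0 = ℕₚ.m^n≢0 p w
    p^[1+w]∣n : p ℕ.^ w ℕ.* p ℕd.∣ p ℕ.^ w ℕ.* m
    p^[1+w]∣n = subst₂ ℕd._∣_ (ℕₚ.*-comm p (p ℕ.^ w)) n≡
      (ℕd.∣-trans (ℕd.divides (p ℕ.^ (v ℕ.∸ suc w))
        (trans (cong (p ℕ.^_) (sym (ℕₚ.m∸n+n≡m (ℕₚ.≰⇒> v≰w))))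
               (ℕₚ.^-distribˡ-+-* p (v ℕ.∸ suc w) (suc w)))) pᵛ∣n)
    p∣m : p ℕd.∣ m
    p∣m = ℕd.*-cancelˡ-∣ (p ℕ.^ w) {{pw≢0}} p^[1+w]∣n

  pᵛ∣n⇒v≤νn : ∀ n .{{_ : ℕ.NonZero n}} {v} → p ℕ.^ v ℕd.∣ n → v ℕ.≤ ν n
  pᵛ∣n⇒v≤νn n = pᵛ∣n⇒v≤w (ν-hasValuation n)

  p^ν∣n : ∀ n .{{_ : ℕ.NonZero n}} → p ℕ.^ ν n ℕd.∣ n
  p^ν∣n n with m , n≡ , _ ← ν-hasValuation n = ℕd.divides m (trans n≡ (ℕₚ.*-comm _ m))

  ν-unique : ∀ n .{{_ : ℕ.NonZero n}} {v} → HasValuation n v → ν n ≡ v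
  ν-unique n {v} h@(m , n≡ , _) = ℕₚ.≤-antisym
    (pᵛ∣n⇒v≤w h (p^ν∣n n))
    (pᵛ∣n⇒v≤νn n (ℕd.divides m (trans n≡ (ℕₚ.*-comm _ m))))

  ν-* : ∀ m n .{{_ : ℕ.NonZero m}} .{{_ : ℕ.NonZero n}} → ν (m ℕ.* n) ≡ ν m ℕ.+ ν n
  ν-* m n with ν-hasValuation m | ν-hasValuation n
  ... | a , m≡ , p∤a | b , n≡ , p∤b =
    ν-unique (m ℕ.* n) {{ℕₚ.m*n≢0 m n}} (a ℕ.* b , mn≡ , λ p∣ab → contra (euclidsLemma a b p-prime p∣ab))
    where
    contra : p ℕd.∣ a ⊎ p ℕd.∣ b → _
    contra (inj₁ p∣a) = p∤a p∣a
    contra (inj₂ p∣b) = p∤b p∣b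
    open ≡-Reasoning
    mn≡ : m ℕ.* n ≡ p ℕ.^ (ν m ℕ.+ ν n) ℕ.* (a ℕ.* b)
    mn≡ = begin
      m ℕ.* n                                           ≡⟨ cong₂ ℕ._*_ m≡ n≡ ⟩
      (p ℕ.^ ν m ℕ.* a) ℕ.* (p ℕ.^ ν n ℕ.* b)           ≡⟨ ℕₚ.[m*n]*[o*p]≡[m*o]*[n*p] (p ℕ.^ ν m) a (p ℕ.^ ν n) b ⟩
      (p ℕ.^ ν m ℕ.* p ℕ.^ ν n) ℕ.* (a ℕ.* b)           ≡⟨ cong (ℕ._* (a ℕ.* b)) (sym (ℕₚ.^-distribˡ-+-* p (ν m) (ν n))) ⟩
      p ℕ.^ (ν m ℕ.+ ν n) ℕ.* (a ℕ.* b)                 ∎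

  ℤ-≢0 : ∀ i .{{_ : ℤ.NonZero i}} → i ≢ + 0
  ℤ-≢0 (+ suc _) ()
  ℤ-≢0 -[1+ _ ]  ()

  cross-mult : ∀ q {u} → ℚ.toℚᵘ q ℚᵘ.≃ u → ↥ q ℤ.* ℚᵘ.↧ u ≡ ℚᵘ.↥ u ℤ.* ↧ q
  cross-mult (mkℚ _ _ _) (ℚᵘ.*≡* eq) = eq

  P π : ℚ
  P = + p / 1
  π = + 1 / p

  π*P≡1 : π ℚ.* P ≡ 1ℚ
  π*P≡1 = go p
    where
    go : ∀ n .{{_ : ℕ.NonZero n}} → (+ 1 / n) ℚ.* (+ n / 1) ≡ 1ℚ
    go n@(suc d) = ℚₚ.toℚᵘ-injective (begin
      ℚ.toℚᵘ ((+ 1 / n) ℚ.* (+ n / 1))            ≈⟨ ℚₚ.toℚᵘ-homo-* (+ 1 / n) (+ n / 1) ⟩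
      ℚ.toℚᵘ (+ 1 / n) ℚᵘ.* ℚ.toℚᵘ (+ n / 1)      ≈⟨ ℚᵘₚ.*-cong (ℚₚ.toℚᵘ-fromℚᵘ (ℚᵘ.mkℚᵘ (+ 1) d)) (ℚₚ.toℚᵘ-fromℚᵘ (ℚᵘ.mkℚᵘ (+ n) 0)) ⟩
      ℚᵘ.mkℚᵘ (+ 1) d ℚᵘ.* ℚᵘ.mkℚᵘ (+ n) 0        ≈⟨ ℚᵘ.*≡* cross ⟩
      ℚᵘ.1ℚᵘ                                      ∎)
      where
      open ℚᵘₚ.≃-Reasoning
      cross : (+ 1 ℤ.* + n) ℤ.* + 1 ≡ + 1 ℤ.* + (n ℕ.* 1)
      cross = trans (ℤₚ.*-identityʳ (+ 1 ℤ.* + n))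
                    (cong (+ 1 ℤ.*_) (cong +_ (sym (ℕₚ.*-identityʳ n))))

  π>0 : 0ℚ ℚ.< π
  π>0 = ℚₚ.positive⁻¹ π {{ℚₚ.normalize-pos 1 p}}

  P>0 : 0ℚ ℚ.< P
  P>0 = ℚₚ.positive⁻¹ P {{ℚₚ.normalize-pos p 1}}

  *-pos : ∀ {x y} → 0ℚ ℚ.< x → 0ℚ ℚ.< y → 0ℚ ℚ.< x ℚ.* y
  *-pos {x} {y} x>0 y>0 = ℚₚ.positive⁻¹ (x ℚ.* y)
    {{ℚₚ.pos*pos⇒pos x {{ℚ.positive x>0}} y {{ℚ.positive y>0}}}}

  ^-pos : ∀ {x} n → 0ℚ ℚ.< x → 0ℚ ℚ.< x ^ℚ n
  ^-pos zero    x>0 = ℚₚ.positive⁻¹ 1ℚ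
  ^-pos (suc n) x>0 = *-pos x>0 (^-pos n x>0)

  π^n≤1 : ∀ n → π ^ℚ n ℚ.≤ 1ℚ
  π^n≤1 zero    = ℚₚ.≤-refl
  π^n≤1 (suc n) = begin
    π ℚ.* π ^ℚ n  ≤⟨ ℚₚ.*-monoʳ-≤-nonNeg (π ^ℚ n) {{ℚ.nonNegative (ℚₚ.<⇒≤ (^-pos n π>0))}} π≤1 ⟩
    1ℚ ℚ.* π ^ℚ n ≡⟨ ℚₚ.*-identityˡ (π ^ℚ n) ⟩
    π ^ℚ n        ≤⟨ π^n≤1 n ⟩
    1ℚ            ∎
    where
    open ℚₚ.≤-Reasoning
    1≤P : 1ℚ ℚ.≤ P
    1≤P = ℚₚ.toℚᵘ-cancel-≤ (ℚᵘₚ.≤-respʳ-≃ (ℚᵘₚ.≃-sym (ℚₚ.toℚᵘ-fromℚᵘ (ℚᵘ.mkℚᵘ (+ p) 0)))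
            (ℚᵘ.*≤* (subst₂ ℤ._≤_ (sym (ℤₚ.*-identityˡ (+ 1))) (sym (ℤₚ.*-identityʳ (+ p)))
                      (ℤ.+≤+ (ℕ.>-nonZero⁻¹ p)))))
    π≤1 : π ℚ.≤ 1ℚ
    π≤1 = begin
      π         ≡⟨ sym (ℚₚ.*-identityʳ π) ⟩
      π ℚ.* 1ℚ  ≤⟨ ℚₚ.*-monoˡ-≤-nonNeg π {{ℚ.nonNegative (ℚₚ.<⇒≤ π>0)}} 1≤P ⟩
      π ℚ.* P   ≡⟨ π*P≡1 ⟩
      1ℚ        ∎

  π^-antimono : ∀ {m n} → m ℕ.≤ n → π ^ℚ n ℚ.≤ π ^ℚ m
  π^-antimono {m} {n} m≤n = begin
    π ^ℚ n                         ≡⟨ cong (π ^ℚ_) (sym (ℕₚ.m+[n∸m]≡n m≤n)) ⟩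
    π ^ℚ (m ℕ.+ (n ℕ.∸ m))         ≡⟨ ^ℚ-homo-* π m (n ℕ.∸ m) ⟩
    π ^ℚ m ℚ.* π ^ℚ (n ℕ.∸ m)      ≤⟨ ℚₚ.*-monoˡ-≤-nonNeg (π ^ℚ m) {{ℚ.nonNegative (ℚₚ.<⇒≤ (^-pos m π>0))}} (π^n≤1 (n ℕ.∸ m)) ⟩
    π ^ℚ m ℚ.* 1ℚ                  ≡⟨ ℚₚ.*-identityʳ (π ^ℚ m) ⟩
    π ^ℚ m                         ∎
    where open ℚₚ.≤-Reasoning

  π^n*P^n≡1 : ∀ n → π ^ℚ n ℚ.* P ^ℚ n ≡ 1ℚ
  π^n*P^n≡1 zero    = refl
  π^n*P^n≡1 (suc n) = begin
    (π ℚ.* π ^ℚ n) ℚ.* (P ℚ.* P ^ℚ n)   ≡⟨ interchange π (π ^ℚ n) P (P ^ℚ n) ⟩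
    (π ℚ.* P) ℚ.* (π ^ℚ n ℚ.* P ^ℚ n)   ≡⟨ cong₂ ℚ._*_ π*P≡1 (π^n*P^n≡1 n) ⟩
    1ℚ ℚ.* 1ℚ                           ≡⟨⟩
    1ℚ                                  ∎
    where
    open ≡-Reasoning
    interchange : ∀ a b c d → (a ℚ.* b) ℚ.* (c ℚ.* d) ≡ (a ℚ.* c) ℚ.* (b ℚ.* d)
    interchange = solve 4 (λ a b c d → (a :* b) :* (c :* d) := (a :* c) :* (b :* d)) refl

  -- |i/d|ₚ = p^(ν d - ν i).
  ∣_∶_∣ₚ : ℤ → ℕ → ℚ
  ∣ i ∶ d ∣ₚ = π ^ℚ ν ℤ.∣ i ∣ ℚ.* P ^ℚ ν d

  ∣_∣ₚ : ℚ → ℚ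
  ∣ mkℚ (+ 0)       _   _ ∣ₚ = 0ℚ
  ∣ mkℚ i@(+ suc _) d-1 _ ∣ₚ = ∣ i ∶ suc d-1 ∣ₚ
  ∣ mkℚ i@(-[1+ _ ]) d-1 _ ∣ₚ = ∣ i ∶ suc d-1 ∣ₚ

  ∣∣ₚ-nonZero : ∀ q .{{_ : ℚ.NonZero q}} → ∣ q ∣ₚ ≡ ∣ ↥ q ∶ ↧ₙ q ∣ₚ
  ∣∣ₚ-nonZero (mkℚ (+ suc _) _ _) = refl
  ∣∣ₚ-nonZero (mkℚ -[1+ _ ]  _ _) = refl

  ∣∶∣ₚ-pos : ∀ i d → 0ℚ ℚ.< ∣ i ∶ d ∣ₚ
  ∣∶∣ₚ-pos i d = *-pos (^-pos (ν ℤ.∣ i ∣) π>0) (^-pos (ν d) P>0)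

  ∣∶∣ₚ-* : ∀ i j d e .{{_ : ℤ.NonZero i}} .{{_ : ℤ.NonZero j}} .{{_ : ℕ.NonZero d}} .{{_ : ℕ.NonZero e}} →
           ∣ i ℤ.* j ∶ d ℕ.* e ∣ₚ ≡ ∣ i ∶ d ∣ₚ ℚ.* ∣ j ∶ e ∣ₚ
  ∣∶∣ₚ-* i j d e = begin
    π ^ℚ ν ℤ.∣ i ℤ.* j ∣ ℚ.* P ^ℚ ν (d ℕ.* e)
      ≡⟨ cong₂ (λ a b → π ^ℚ a ℚ.* P ^ℚ b)
           (trans (cong ν (ℤₚ.abs-* i j)) (ν-* ℤ.∣ i ∣ ℤ.∣ j ∣)) (ν-* d e) ⟩
    π ^ℚ (νi ℕ.+ νj) ℚ.* P ^ℚ (ν d ℕ.+ ν e)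
      ≡⟨ cong₂ ℚ._*_ (^ℚ-homo-* π νi νj) (^ℚ-homo-* P (ν d) (ν e)) ⟩
    (π ^ℚ νi ℚ.* π ^ℚ νj) ℚ.* (P ^ℚ ν d ℚ.* P ^ℚ ν e)
      ≡⟨ solve 4 (λ a b c d → (a :* b) :* (c :* d) := (a :* c) :* (b :* d)) refl
           (π ^ℚ νi) (π ^ℚ νj) (P ^ℚ ν d) (P ^ℚ ν e) ⟩
    ∣ i ∶ d ∣ₚ ℚ.* ∣ j ∶ e ∣ₚ ∎
    where
    open ≡-Reasoning
    νi = ν ℤ.∣ i ∣
    νj = ν ℤ.∣ j ∣

  ∣∶∣ₚ-cancel : ∀ i d → .{{_ : ℕ.NonZero d}} .{{_ : ℤ.NonZero i}} → ∀ e .{{_ : ℕ.NonZero e}} →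
                ∣ i ℤ.* + e ∶ d ℕ.* e ∣ₚ ≡ ∣ i ∶ d ∣ₚ
  ∣∶∣ₚ-cancel i d e@(suc _) = begin
    ∣ i ℤ.* + e ∶ d ℕ.* e ∣ₚ          ≡⟨ ∣∶∣ₚ-* i (+ e) d e ⟩
    ∣ i ∶ d ∣ₚ ℚ.* ∣ + e ∶ e ∣ₚ       ≡⟨ cong (∣ i ∶ d ∣ₚ ℚ.*_) (π^n*P^n≡1 (ν e)) ⟩
    ∣ i ∶ d ∣ₚ ℚ.* 1ℚ                 ≡⟨ ℚₚ.*-identityʳ ∣ i ∶ d ∣ₚ ⟩
    ∣ i ∶ d ∣ₚ                        ∎
    where open ≡-Reasoning

  -- The value does not depend on the fraction representing q.
  ∣∣ₚ-≃ : ∀ q i d .{{_ : ℤ.NonZero i}} .{{_ : ℕ.NonZero d}} →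
          ↥ q ℤ.* + d ≡ i ℤ.* ↧ q → ∣ q ∣ₚ ≡ ∣ i ∶ d ∣ₚ
  ∣∣ₚ-≃ q@(mkℚ n e-1 _) i d {{i≢0}} eq = begin
    ∣ q ∣ₚ                          ≡⟨ ∣∣ₚ-nonZero q ⟩
    ∣ n ∶ e ∣ₚ                      ≡⟨ sym (∣∶∣ₚ-cancel n e d) ⟩
    ∣ n ℤ.* + d ∶ e ℕ.* d ∣ₚ        ≡⟨ cong₂ ∣_∶_∣ₚ eq (ℕₚ.*-comm e d) ⟩
    ∣ i ℤ.* + e ∶ d ℕ.* e ∣ₚ        ≡⟨ ∣∶∣ₚ-cancel i d e ⟩
    ∣ i ∶ d ∣ₚ                      ∎
    where
    open ≡-Reasoning
    e = suc e-1
    n≢0 : n ≢ + 0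
    n≢0 n≡0 = ℤ-≢0 (i ℤ.* + e) {{ℤₚ.i*j≢0 i (+ e)}}
      (trans (sym eq) (cong (ℤ._* + d) n≡0))
    instance
      n-nonZero : ℤ.NonZero n
      n-nonZero = ℤ.≢-nonZero n≢0

  0≤∣∣ₚ : ∀ q → 0ℚ ℚ.≤ ∣ q ∣ₚ
  0≤∣∣ₚ (mkℚ (+ 0)       _   _) = ℚₚ.≤-refl
  0≤∣∣ₚ (mkℚ i@(+ suc _) d-1 _) = ℚₚ.<⇒≤ (∣∶∣ₚ-pos i (suc d-1))
  0≤∣∣ₚ (mkℚ i@(-[1+ _ ]) d-1 _) = ℚₚ.<⇒≤ (∣∶∣ₚ-pos i (suc d-1))

  ∣∣ₚ≡0 : ∀ q → ∣ q ∣ₚ ≡ 0ℚ → q ≡ 0ℚ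
  ∣∣ₚ≡0 q@(mkℚ (+ 0)       _   _) _  = ℚₚ.↥p≡0⇒p≡0 q refl
  ∣∣ₚ≡0 (mkℚ i@(+ suc _) d-1 _) eq = contradiction (sym eq) (ℚₚ.<⇒≢ (∣∶∣ₚ-pos i (suc d-1)))
  ∣∣ₚ≡0 (mkℚ i@(-[1+ _ ]) d-1 _) eq = contradiction (sym eq) (ℚₚ.<⇒≢ (∣∶∣ₚ-pos i (suc d-1)))

  ∣-∣ₚ : ∀ q → ∣ ℚ.- q ∣ₚ ≡ ∣ q ∣ₚ
  ∣-∣ₚ (mkℚ (+ 0)     _ _) = refl
  ∣-∣ₚ (mkℚ (+ suc _) _ _) = refl
  ∣-∣ₚ (mkℚ -[1+ _ ]  _ _) = refl

  zero⊎nonZero : ∀ q → q ≡ 0ℚ ⊎ ℤ.NonZero (↥ q)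
  zero⊎nonZero q@(mkℚ (+ 0)     _ _) = inj₁ (ℚₚ.↥p≡0⇒p≡0 q refl)
  zero⊎nonZero   (mkℚ (+ suc _) _ _) = inj₂ _
  zero⊎nonZero   (mkℚ -[1+ _ ]  _ _) = inj₂ _

  ∣*∣ₚ : ∀ q r → ∣ q ℚ.* r ∣ₚ ≡ ∣ q ∣ₚ ℚ.* ∣ r ∣ₚ
  ∣*∣ₚ q r with zero⊎nonZero q | zero⊎nonZero r
  ... | inj₁ refl | _ = trans (cong ∣_∣ₚ (ℚₚ.*-zeroˡ r)) (sym (ℚₚ.*-zeroˡ ∣ r ∣ₚ))
  ... | inj₂ _ | inj₁ refl = trans (cong ∣_∣ₚ (ℚₚ.*-zeroʳ q)) (sym (ℚₚ.*-zeroʳ ∣ q ∣ₚ))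
  ∣*∣ₚ q@(mkℚ i d-1 _) r@(mkℚ j e-1 _) | inj₂ q≢0 | inj₂ r≢0 = begin
    ∣ q ℚ.* r ∣ₚ                         ≡⟨ ∣∣ₚ-≃ (q ℚ.* r) (i ℤ.* j) (d ℕ.* e) (cross-mult (q ℚ.* r) (ℚₚ.toℚᵘ-homo-* q r)) ⟩
    ∣ i ℤ.* j ∶ d ℕ.* e ∣ₚ               ≡⟨ ∣∶∣ₚ-* i j d e ⟩
    ∣ i ∶ d ∣ₚ ℚ.* ∣ j ∶ e ∣ₚ            ≡⟨ sym (cong₂ ℚ._*_ (∣∣ₚ-nonZero q) (∣∣ₚ-nonZero r)) ⟩
    ∣ q ∣ₚ ℚ.* ∣ r ∣ₚ                    ∎
    where
    open ≡-Reasoning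
    d = suc d-1
    e = suc e-1
    instance
      _ = q≢0
      _ = r≢0
      ij≢0 : ℤ.NonZero (i ℤ.* j)
      ij≢0 = ℤₚ.i*j≢0 i j

  ∣+∣ₚ : ∀ q r → ∣ q ℚ.+ r ∣ₚ ℚ.≤ ∣ q ∣ₚ ℚ.+ ∣ r ∣ₚ
  ∣+∣ₚ q r with zero⊎nonZero q | zero⊎nonZero r | zero⊎nonZero (q ℚ.+ r)
  ... | inj₁ refl | _ | _ = ℚₚ.≤-reflexive
    (trans (cong ∣_∣ₚ (ℚₚ.+-identityˡ r)) (sym (ℚₚ.+-identityˡ ∣ r ∣ₚ)))
  ... | inj₂ _ | inj₁ refl | _ = ℚₚ.≤-reflexive
    (trans (cong ∣_∣ₚ (ℚₚ.+-identityʳ q)) (sym (ℚₚ.+-identityʳ ∣ q ∣ₚ)))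
  ... | inj₂ _ | inj₂ _ | inj₁ q+r≡0 =
    subst (ℚ._≤ ∣ q ∣ₚ ℚ.+ ∣ r ∣ₚ) (cong ∣_∣ₚ (sym q+r≡0)) (ℚₚ.+-mono-≤ (0≤∣∣ₚ q) (0≤∣∣ₚ r))
  ∣+∣ₚ q@(mkℚ i d-1 _) r@(mkℚ j e-1 _) | inj₂ q≢0 | inj₂ r≢0 | inj₂ q+r≢0 =
    subst₂ ℚ._≤_ (sym (∣∣ₚ-≃ (q ℚ.+ r) (X ℤ.+ Y) (d ℕ.* e) eq))
      (cong₂ ℚ._+_
        (trans (∣∶∣ₚ-cancel i d e) (sym (∣∣ₚ-nonZero q)))
        (trans (trans (cong ∣ Y ∶_∣ₚ (ℕₚ.*-comm d e)) (∣∶∣ₚ-cancel j e d)) (sym (∣∣ₚ-nonZero r))))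
      (max≤sum (ℕₚ.≤-total (ν ℤ.∣ X ∣) (ν ℤ.∣ Y ∣)))
    where
    d = suc d-1
    e = suc e-1
    X = i ℤ.* + e
    Y = j ℤ.* + d
    eq : ↥ (q ℚ.+ r) ℤ.* + (d ℕ.* e) ≡ (X ℤ.+ Y) ℤ.* ↧ (q ℚ.+ r)
    eq = cross-mult (q ℚ.+ r) (ℚₚ.toℚᵘ-homo-+ q r)
    X+Y≢0 : X ℤ.+ Y ≢ + 0
    X+Y≢0 X+Y≡0 = ℤ-≢0 (↥ (q ℚ.+ r) ℤ.* + (d ℕ.* e))
      {{ℤₚ.i*j≢0 (↥ (q ℚ.+ r)) (+ (d ℕ.* e)) {{q+r≢0}}}}
      (trans eq (cong (ℤ._* ↧ (q ℚ.+ r)) X+Y≡0))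
    instance
      _ = q≢0
      _ = r≢0
      X-nonZero : ℤ.NonZero X
      X-nonZero = ℤₚ.i*j≢0 i (+ e)
      Y-nonZero : ℤ.NonZero Y
      Y-nonZero = ℤₚ.i*j≢0 j (+ d)
      X+Y-nonZero : ℤ.NonZero (X ℤ.+ Y)
      X+Y-nonZero = ℤ.≢-nonZero X+Y≢0
    ∣X+Y : ∀ v → p ℕ.^ v ℕd.∣ ℤ.∣ X ∣ → p ℕ.^ v ℕd.∣ ℤ.∣ Y ∣ → v ℕ.≤ ν ℤ.∣ X ℤ.+ Y ∣
    ∣X+Y v v∣X v∣Y = pᵛ∣n⇒v≤νn ℤ.∣ X ℤ.+ Y ∣
      (ℤd.∣⇒∣ᵤ (ℤd.∣m∣n⇒∣m+n {i = + (p ℕ.^ v)} {X} {Y} (ℤd.∣ᵤ⇒∣ v∣X) (ℤd.∣ᵤ⇒∣ v∣Y)))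
    ≤-frac : ∀ {Z} → ν ℤ.∣ Z ∣ ℕ.≤ ν ℤ.∣ X ℤ.+ Y ∣ → ∣ X ℤ.+ Y ∶ d ℕ.* e ∣ₚ ℚ.≤ ∣ Z ∶ d ℕ.* e ∣ₚ
    ≤-frac le = ℚₚ.*-monoʳ-≤-nonNeg (P ^ℚ ν (d ℕ.* e))
      {{ℚ.nonNegative (ℚₚ.<⇒≤ (^-pos (ν (d ℕ.* e)) P>0))}} (π^-antimono le)
    p^-∣ : ∀ {a b} → a ℕ.≤ b → p ℕ.^ a ℕd.∣ p ℕ.^ b
    p^-∣ {a} {b} a≤b = ℕd.divides (p ℕ.^ (b ℕ.∸ a))
      (trans (cong (p ℕ.^_) (sym (ℕₚ.m∸n+n≡m a≤b))) (ℕₚ.^-distribˡ-+-* p (b ℕ.∸ a) a))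
    open ℚₚ.≤-Reasoning
    x = ∣ X ∶ d ℕ.* e ∣ₚ
    y = ∣ Y ∶ d ℕ.* e ∣ₚ
    max≤sum : ν ℤ.∣ X ∣ ℕ.≤ ν ℤ.∣ Y ∣ ⊎ ν ℤ.∣ Y ∣ ℕ.≤ ν ℤ.∣ X ∣ →
              ∣ X ℤ.+ Y ∶ d ℕ.* e ∣ₚ ℚ.≤ x ℚ.+ y
    max≤sum (inj₁ le) = begin
      ∣ X ℤ.+ Y ∶ d ℕ.* e ∣ₚ   ≤⟨ ≤-frac {X} (∣X+Y _ (p^ν∣n ℤ.∣ X ∣) (ℕd.∣-trans (p^-∣ le) (p^ν∣n ℤ.∣ Y ∣))) ⟩
      x                        ≡⟨ sym (ℚₚ.+-identityʳ x) ⟩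
      x ℚ.+ 0ℚ                 ≤⟨ ℚₚ.+-monoʳ-≤ x (ℚₚ.<⇒≤ (∣∶∣ₚ-pos Y (d ℕ.* e))) ⟩
      x ℚ.+ y                  ∎
    max≤sum (inj₂ le) = begin
      ∣ X ℤ.+ Y ∶ d ℕ.* e ∣ₚ   ≤⟨ ≤-frac {Y} (∣X+Y _ (ℕd.∣-trans (p^-∣ le) (p^ν∣n ℤ.∣ X ∣)) (p^ν∣n ℤ.∣ Y ∣)) ⟩
      y                        ≡⟨ sym (ℚₚ.+-identityˡ y) ⟩
      0ℚ ℚ.+ y                 ≤⟨ ℚₚ.+-monoˡ-≤ y (ℚₚ.<⇒≤ (∣∶∣ₚ-pos X (d ℕ.* e))) ⟩
      x ℚ.+ y                  ∎

  padic : AbsoluteValue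
  padic = record
    { ∣_∣           = ∣_∣ₚ
    ; 0≤∣p∣         = 0≤∣∣ₚ
    ; ∣0∣≡0         = refl
    ; ∣p∣≡0⇒p≡0     = ∣∣ₚ≡0
    ; ∣-p∣≡∣p∣      = ∣-∣ₚ
    ; ∣p*q∣≡∣p∣*∣q∣ = ∣*∣ₚ
    ; ∣p+q∣≤∣p∣+∣q∣ = ∣+∣ₚ
    }

------------------------------------------------------------------------
-- The completion of ℚ with respect to an absolute value

module Completion (V : AbsoluteValue) where
  open AbsoluteValue V

  IsCauchy : (ℕ → ℚ) → Set
  IsCauchy x = ∀ ε → 0ℚ ℚ.< ε → ∃[ N ] ∀ m n → N ℕ.≤ m → N ℕ.≤ n → ∣ x m ℚ.- x n ∣ ℚ.< ε

  record Point : Set where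
    constructor mkPoint
    field
      seq    : ℕ → ℚ
      cauchy : IsCauchy seq
  open Point public

  infix 4 _≈_
  _≈_ : Point → Point → Set
  x ≈ y = ∀ ε → 0ℚ ℚ.< ε → ∃[ N ] ∀ n → N ℕ.≤ n → ∣ seq x n ℚ.- seq y n ∣ ℚ.< ε

  ι : ℚ → Point
  ι q = mkPoint (λ _ → q) λ ε ε>0 → 0 , λ _ _ _ _ →
    subst (ℚ._< ε) (sym (trans (cong ∣_∣ (ℚₚ.+-inverseʳ q)) ∣0∣≡0)) ε>0

  private
    ½+½ : ∀ ε → ℚ.½ ℚ.* ε ℚ.+ ℚ.½ ℚ.* ε ≡ ε
    ½+½ ε = trans (sym (ℚₚ.*-distribʳ-+ ε ℚ.½ ℚ.½)) (ℚₚ.*-identityˡ ε)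

    *-pos : ∀ {x y} → 0ℚ ℚ.< x → 0ℚ ℚ.< y → 0ℚ ℚ.< x ℚ.* y
    *-pos {x} {y} x>0 y>0 = ℚₚ.positive⁻¹ (x ℚ.* y)
      {{ℚₚ.pos*pos⇒pos x {{ℚ.positive x>0}} y {{ℚ.positive y>0}}}}

    Bounded : (ℕ → ℚ) → Set
    Bounded x = ∃[ B ] ∃[ N ] 0ℚ ℚ.< B × (∀ n → N ℕ.≤ n → ∣ x n ∣ ℚ.< B)

    bounded : ∀ x → IsCauchy x → Bounded x
    bounded x x-cauchy with N , close ← x-cauchy 1ℚ (ℚₚ.positive⁻¹ 1ℚ) =
      ∣ x N ∣ ℚ.+ 1ℚ , N , ℚₚ.+-mono-≤-< (0≤∣p∣ (x N)) (ℚₚ.positive⁻¹ 1ℚ) , λ n N≤n → begin-strict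
        ∣ x n ∣                          ≡⟨ cong ∣_∣ (solve 2 (λ a b → a := b :+ (a :- b)) refl (x n) (x N)) ⟩
        ∣ x N ℚ.+ (x n ℚ.- x N) ∣        ≤⟨ ∣p+q∣≤∣p∣+∣q∣ (x N) (x n ℚ.- x N) ⟩
        ∣ x N ∣ ℚ.+ ∣ x n ℚ.- x N ∣      <⟨ ℚₚ.+-monoʳ-< ∣ x N ∣ (close n N N≤n ℕₚ.≤-refl) ⟩
        ∣ x N ∣ ℚ.+ 1ℚ                   ∎
      where open ℚₚ.≤-Reasoning

    +-cauchy : ∀ x y → IsCauchy x → IsCauchy y → IsCauchy (λ n → x n ℚ.+ y n)
    +-cauchy x y x-cauchy y-cauchy ε ε>0
      with M , x-close ← x-cauchy (ℚ.½ ℚ.* ε) (*-pos (ℚₚ.positive⁻¹ ℚ.½) ε>0)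
         | N , y-close ← y-cauchy (ℚ.½ ℚ.* ε) (*-pos (ℚₚ.positive⁻¹ ℚ.½) ε>0) =
      M ℕ.⊔ N , λ m n le le′ → begin-strict
        ∣ (x m ℚ.+ y m) ℚ.- (x n ℚ.+ y n) ∣
          ≡⟨ cong ∣_∣ (solve 4 (λ a b c d → (a :+ b) :- (c :+ d) := (a :- c) :+ (b :- d)) refl (x m) (y m) (x n) (y n)) ⟩
        ∣ (x m ℚ.- x n) ℚ.+ (y m ℚ.- y n) ∣
          ≤⟨ ∣p+q∣≤∣p∣+∣q∣ (x m ℚ.- x n) (y m ℚ.- y n) ⟩
        ∣ x m ℚ.- x n ∣ ℚ.+ ∣ y m ℚ.- y n ∣
          <⟨ ℚₚ.+-mono-< (x-close m n (ℕₚ.m⊔n≤o⇒m≤o M N le) (ℕₚ.m⊔n≤o⇒m≤o M N le′))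
                         (y-close m n (ℕₚ.m⊔n≤o⇒n≤o M N le) (ℕₚ.m⊔n≤o⇒n≤o M N le′)) ⟩
        ℚ.½ ℚ.* ε ℚ.+ ℚ.½ ℚ.* ε
          ≡⟨ ½+½ ε ⟩
        ε ∎
      where open ℚₚ.≤-Reasoning

    -‿cauchy : ∀ x → IsCauchy x → IsCauchy (λ n → ℚ.- x n)
    -‿cauchy x x-cauchy ε ε>0 with N , close ← x-cauchy ε ε>0 = N , λ m n le le′ →
      subst (ℚ._< ε)
        (trans (sym (∣-p∣≡∣p∣ (x m ℚ.- x n)))
               (cong ∣_∣ (solve 2 (λ a b → :- (a :- b) := (:- a) :- (:- b)) refl (x m) (x n))))
        (close m n le le′)

    product-difference : ∀ a b c d → a ℚ.* b ℚ.- c ℚ.* d ≡ a ℚ.* (b ℚ.- d) ℚ.+ (a ℚ.- c) ℚ.* d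
    product-difference = solve 4 (λ a b c d → a :* b :- c :* d := a :* (b :- d) :+ (a :- c) :* d) refl

    product-close : ∀ {A B δ} a b c d → 0ℚ ℚ.< A → 0ℚ ℚ.< B →
                    ∣ a ∣ ℚ.< A → ∣ d ∣ ℚ.< B → ∣ b ℚ.- d ∣ ℚ.< δ → ∣ a ℚ.- c ∣ ℚ.< δ →
                    ∣ a ℚ.* b ℚ.- c ℚ.* d ∣ ℚ.< (A ℚ.+ B) ℚ.* δ
    product-close {A} {B} {δ} a b c d A>0 B>0 a<A d<B b-d<δ a-c<δ = begin-strict
      ∣ a ℚ.* b ℚ.- c ℚ.* d ∣                       ≡⟨ cong ∣_∣ (product-difference a b c d) ⟩
      ∣ a ℚ.* (b ℚ.- d) ℚ.+ (a ℚ.- c) ℚ.* d ∣       ≤⟨ ∣p+q∣≤∣p∣+∣q∣ (a ℚ.* (b ℚ.- d)) ((a ℚ.- c) ℚ.* d) ⟩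
      ∣ a ℚ.* (b ℚ.- d) ∣ ℚ.+ ∣ (a ℚ.- c) ℚ.* d ∣   ≡⟨ cong₂ ℚ._+_ (∣p*q∣≡∣p∣*∣q∣ a (b ℚ.- d)) (∣p*q∣≡∣p∣*∣q∣ (a ℚ.- c) d) ⟩
      ∣ a ∣ ℚ.* ∣ b ℚ.- d ∣ ℚ.+ ∣ a ℚ.- c ∣ ℚ.* ∣ d ∣ ≤⟨ ℚₚ.+-mono-≤ fst≤ snd≤ ⟩
      A ℚ.* ∣ b ℚ.- d ∣ ℚ.+ ∣ a ℚ.- c ∣ ℚ.* B       <⟨ ℚₚ.+-mono-< fst< snd< ⟩
      A ℚ.* δ ℚ.+ δ ℚ.* B                           ≡⟨ cong (A ℚ.* δ ℚ.+_) (ℚₚ.*-comm δ B) ⟩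
      A ℚ.* δ ℚ.+ B ℚ.* δ                           ≡⟨ sym (ℚₚ.*-distribʳ-+ δ A B) ⟩
      (A ℚ.+ B) ℚ.* δ                               ∎
      where
      open ℚₚ.≤-Reasoning
      fst≤ : ∣ a ∣ ℚ.* ∣ b ℚ.- d ∣ ℚ.≤ A ℚ.* ∣ b ℚ.- d ∣
      fst≤ = ℚₚ.*-monoʳ-≤-nonNeg ∣ b ℚ.- d ∣ {{ℚ.nonNegative (0≤∣p∣ (b ℚ.- d))}} (ℚₚ.<⇒≤ a<A)
      snd≤ : ∣ a ℚ.- c ∣ ℚ.* ∣ d ∣ ℚ.≤ ∣ a ℚ.- c ∣ ℚ.* B
      snd≤ = ℚₚ.*-monoˡ-≤-nonNeg ∣ a ℚ.- c ∣ {{ℚ.nonNegative (0≤∣p∣ (a ℚ.- c))}} (ℚₚ.<⇒≤ d<B)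
      fst< : A ℚ.* ∣ b ℚ.- d ∣ ℚ.< A ℚ.* δ
      fst< = ℚₚ.*-monoʳ-<-pos A {{ℚ.positive A>0}} b-d<δ
      snd< : ∣ a ℚ.- c ∣ ℚ.* B ℚ.< δ ℚ.* B
      snd< = ℚₚ.*-monoˡ-<-pos B {{ℚ.positive B>0}} a-c<δ

    quotient>0 : ∀ S ε → 0ℚ ℚ.< S → 0ℚ ℚ.< ε → ∃[ δ ] 0ℚ ℚ.< δ × S ℚ.* δ ≡ ε
    quotient>0 S ε S>0 ε>0 = 1/S ℚ.* ε , *-pos 1/S>0 ε>0 ,
      trans (sym (ℚₚ.*-assoc S 1/S ε))
        (trans (cong (ℚ._* ε) (ℚₚ.*-inverseʳ S)) (ℚₚ.*-identityˡ ε))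
      where
      instance
        S-positive : ℚ.Positive S
        S-positive = ℚ.positive S>0
        S-nonZero : ℚ.NonZero S
        S-nonZero = ℚₚ.pos⇒nonZero S
      1/S : ℚ
      1/S = ℚ.1/ S
      1/S>0 : 0ℚ ℚ.< 1/S
      1/S>0 = ℚₚ.positive⁻¹ 1/S {{ℚₚ.1/pos⇒pos S}}

    *-cauchy : ∀ x y → IsCauchy x → IsCauchy y → IsCauchy (λ n → x n ℚ.* y n)
    *-cauchy x y x-cauchy y-cauchy ε ε>0 = go (bounded x x-cauchy) (bounded y y-cauchy)
      where
      go : Bounded x → Bounded y →
           ∃[ N ] ∀ m n → N ℕ.≤ m → N ℕ.≤ n → ∣ x m ℚ.* y m ℚ.- x n ℚ.* y n ∣ ℚ.< ε
      go (A , K , A>0 , x<A) (B , L , B>0 , y<B) = choose (quotient>0 (A ℚ.+ B) ε (ℚₚ.+-mono-< A>0 B>0) ε>0)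
        where
        choose : (∃[ δ ] 0ℚ ℚ.< δ × (A ℚ.+ B) ℚ.* δ ≡ ε) → _
        choose (δ , δ>0 , Sδ≡ε) = KL ℕ.⊔ MN , λ m n le le′ →
          subst (∣ x m ℚ.* y m ℚ.- x n ℚ.* y n ∣ ℚ.<_) Sδ≡ε
            (product-close (x m) (y m) (x n) (y n) A>0 B>0
              (x<A m (ℕₚ.m⊔n≤o⇒m≤o K L (ℕₚ.m⊔n≤o⇒m≤o KL MN le)))
              (y<B n (ℕₚ.m⊔n≤o⇒n≤o K L (ℕₚ.m⊔n≤o⇒m≤o KL MN le′)))
              (proj₂ (y-cauchy δ δ>0) m n (ℕₚ.m⊔n≤o⇒n≤o M N (ℕₚ.m⊔n≤o⇒n≤o KL MN le))
                                          (ℕₚ.m⊔n≤o⇒n≤o M N (ℕₚ.m⊔n≤o⇒n≤o KL MN le′)))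
              (proj₂ (x-cauchy δ δ>0) m n (ℕₚ.m⊔n≤o⇒m≤o M N (ℕₚ.m⊔n≤o⇒n≤o KL MN le))
                                          (ℕₚ.m⊔n≤o⇒m≤o M N (ℕₚ.m⊔n≤o⇒n≤o KL MN le′))))
          where
          M N KL MN : ℕ
          M  = proj₁ (x-cauchy δ δ>0)
          N  = proj₁ (y-cauchy δ δ>0)
          KL = K ℕ.⊔ L
          MN = M ℕ.⊔ N

  rawRing : RawRing 0ℓ 0ℓ
  rawRing = record
    { Carrier = Point
    ; _≈_     = _≈_
    ; _+_     = λ x y → mkPoint (λ n → seq x n ℚ.+ seq y n) (+-cauchy (seq x) (seq y) (cauchy x) (cauchy y))
    ; _*_     = λ x y → mkPoint (λ n → seq x n ℚ.* seq y n) (*-cauchy (seq x) (seq y) (cauchy x) (cauchy y))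
    ; -_      = λ x → mkPoint (λ n → ℚ.- seq x n) (-‿cauchy (seq x) (cauchy x))
    ; 0#      = ι 0ℚ
    ; 1#      = ι 1ℚ
    }

  open RawRing rawRing public using (rawSemiring; _+_; _*_; -_; 0#; 1#)
  open RawSemiringDefs rawSemiring public using (_^_)

------------------------------------------------------------------------
-- Real numbers

module ℝ where
  open Completion usual public hiding (IsCauchy)

  infix 4 _<_ _≤_
  _<_ : Point → Point → Set
  x < y = ∃[ ε ] 0ℚ ℚ.< ε × ∃[ N ] ∀ n → N ℕ.≤ n → seq x n ℚ.+ ε ℚ.< seq y n

  _≤_ : Point → Point → Set
  x ≤ y = ¬ (y < x)

  fromℤ : ℤ → Point
  fromℤ i = ι (i / 1)

  fromℕ : ℕ → Point
  fromℕ n = fromℤ (+ n)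

  -- B^i < z for B > 0, with a negative power cleared.
  _^ℤ_≺_ : Point → ℤ → Point → Set
  B ^ℤ + m      ≺ z = B ^ m < z
  B ^ℤ -[1+ m ] ≺ z = 1# < B ^ suc m * z

  -- B^q < y for B > 0 and y > 0: both sides are raised to the denominator of q.
  _^ℚ_≺_ : Point → ℚ → Point → Set
  B ^ℚ q ≺ y = B ^ℤ ↥ q ≺ (y ^ ↧ₙ q)

  -- B^e < y for B ≥ 1, where B^e = inf { B^q : q ∈ ℚ, q > e }.
  _^ℝ_≺_ : Point → Point → Point → Set
  B ^ℝ e ≺ y = (0# < y) × ∃[ q ] (e < ι q) × (B ^ℚ q ≺ y)

ℝ : Set
ℝ = ℝ.Point

------------------------------------------------------------------------
-- p-adic numbers

module PAdic (p : ℕ) (p-prime : Prime p) where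
  open PAdicAbsoluteValue p p-prime using (padic)
  open AbsoluteValue padic using (∣_∣)
  open AbsoluteValueProperties padic using (reverse-triangle)
  open Completion padic public

  fromℤ : ℤ → Point
  fromℤ i = ι (i / 1)

  ∥_∥ : Point → ℝ
  ∥ x ∥ = ℝ.mkPoint (λ n → ∣ seq x n ∣) λ ε ε>0 →
    proj₁ (cauchy x ε ε>0) , λ m n le le′ →
      ℚₚ.≤-<-trans (reverse-triangle (seq x m) (seq x n)) (proj₂ (cauchy x ε ε>0) m n le le′)

------------------------------------------------------------------------
-- Diagonal equations

module Diagonal (R : RawRing 0ℓ 0ℓ) (fromℤ : ℤ → RawRing.Carrier R) where
  open RawRing R
  open RawSemiringDefs rawSemiring using (sum; _^_)

  Solution : ∀ {s} → ℕ → Vec ℤ s → Vector Carrier s → Set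
  Solution k a x = sum (λ j → fromℤ (lookup a j) * x j ^ k) ≈ 0#

-- |𝐚|
height : ∀ {s} → Vec ℤ s → ℕ
height = foldr′ (λ i h → ℤ.∣ i ∣ ℕ.⊔ h) 0

AllNonZero : ∀ {s} → Vec ℤ s → Set
AllNonZero = VecAll.All (_≢ + 0)

PositiveRealSoluble : ∀ k s → Vec ℤ s → Set
PositiveRealSoluble k s a = ∃ λ (x : Vector ℝ s) →
  (∀ j → 0# < x j) × Diagonal.Solution rawRing fromℤ k a x
  where open ℝ

-- Solubility in ℤₚ^× = { x ∈ ℚₚ : |x|ₚ = 1 }.
UnitSoluble : ∀ p → Prime p → ∀ k s → Vec ℤ s → Set
UnitSoluble p p-prime k s a = ∃ λ (x : Vector Point s) →
  (∀ j → ∥ x j ∥ ℝ.≈ ℝ.1#) × Diagonal.Solution rawRing fromℤ k a x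
  where open PAdic p p-prime

-- 𝒞′(k, s); its elements are meant to be tuples of nonzero integers, which is
-- required separately through AllNonZero.
𝒞′ : ∀ k s → Vec ℤ s → Set
𝒞′ k s a = PositiveRealSoluble k s a × (∀ p (p-prime : Prime p) → UnitSoluble p p-prime k s a)

PrimeSolutionAbove : ∀ k s → ℝ → Vec ℤ s → Set
PrimeSolutionAbove k s ν a = ∃ λ (x : Vector ℕ s) →
  (∀ j → Prime (x j)) ×
  (∀ j → ℝ.fromℕ (height a) ^ℝ ν ≺ ℝ.fromℕ (x j)) ×
  Diagonal.Solution ℤ.+-*-rawRing id k a (λ j → + x j)
  where open ℝ using (_^ℝ_≺_)

-- The statement (∗) with λ = ν.
Star : ∀ k s → ℝ → Vec ℤ s → Set
Star k s ν a = PrimeSolutionAbove k s ν a → 𝒞′ k s a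

------------------------------------------------------------------------
-- Counting

-- #P ≤ B, in terms of finite lists of distinct elements of P; this also says
-- that P is finite.
#_≤_ : ∀ {s} → (Vec ℤ s → Set) → ℝ → Set
# P ≤ B = ∀ as → Unique as → ListAll.All P as → ℝ.fromℕ (length as) ℝ.≤ B

-- #P ≤ C A^e for A ≥ 1, C ≥ 0: C A^e is the infimum of C y over y > A^e.
#_≤_·_^_ : ∀ {s} → (Vec ℤ s → Set) → ℕ → ℝ → ℝ → Set
# P ≤ C · A ^ e = ∀ y → A ^ℝ e ≺ y → # P ≤ (fromℕ C * y)
  where open ℝ using (fromℕ; _*_; _^ℝ_≺_)

-- Tuples with |𝐚| ≤ A for which (∗) does not hold.
Exceptional : ∀ k s → ℝ → ℝ → Vec ℤ s → Set
Exceptional k s ν A a =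
  AllNonZero a × (ℝ.fromℕ (height a) ℝ.≤ A) × ¬ Star k s ν a

-- s - ν(s - 3)
exponent : ℕ → ℝ → ℝ
exponent s ν = fromℕ s + (- (ν * fromℤ (+ s ℤ.- + 3)))
  where open ℝ using (fromℕ; fromℤ; _+_; _*_; -_)

{-# OPTIONS --safe #-}

-- Let x be a solution in primes with all xⱼ > |𝐚|^λ.  It is a positive real
-- solution, and a solution in p-adic units for every prime p that is not one of
-- the xⱼ.  For p = xⱼ, as soon as p > 16k⁴ and at least three coefficients are
-- prime to p, a solution in units modulo p exists by a second moment argument:
-- the numbers S(m, b) of solutions of m xᵏ + b + a yᵏ ≡ 0 have small variance
-- over all (m, b), because two points with distinct xᵏ lie on exactly one line,
-- while S(m, b) depends only on the classes of m and b modulo k-th powers.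
-- Hensel's lemma lifts the solution to ℤₚ.  If λ ≥ 1 then p > |𝐚| divides no
-- coefficient.  In general an exceptional 𝐚 has at least s - 2 coefficients
-- divisible by some p > |𝐚|^λ, and the number of such 𝐚 is bounded by summing
-- B²(B/p)^(s-2) over p, for dyadic ranges of |𝐚| ≤ B.
module Submission where

open import Defs
import Algebra.Definitions.RawSemiring as RawSemiringDefs
import Algebra.Properties.CommutativeSemiring.Exp as CommutativeSemiringExp
import Algebra.Properties.Semiring.Exp as SemiringExp
import Algebra.Properties.Semiring.Sum as SemiringSum
open import Algebra.Bundles using (CommutativeRing; RawRing)
open import Data.Bool.Base using (if_then_else_)
open import Data.Empty using (⊥)
open import Data.Fin.Base as Fin using (Fin; toℕ; fromℕ<)
import Data.Fin.Properties as Finₚ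
open import Data.Integer.Base as ℤ using (ℤ; +_; -[1+_])
import Data.Integer.Divisibility.Signed as ℤd
import Data.Integer.DivMod as ℤm
import Data.Integer.Properties as ℤₚ
import Data.Integer.Solver as ℤSolver
open import Data.List.Base as List using (List; []; _∷_; _++_; length; map; upTo; cartesianProductWith; filter)
open import Data.List.Membership.Propositional using (_∈_)
open import Data.List.Membership.Propositional.Properties
  using (∈-++⁺ˡ; ∈-++⁺ʳ; ∈-++⁻; ∈-map⁺; ∈-upTo⁺; ∈-cartesianProductWith⁺; ∈-∃++; ∈-filter⁻)
import Data.List.Properties as Listₚ
open import Data.List.Relation.Unary.All as ListAll using ([]; _∷_)
open import Data.List.Relation.Unary.AllPairs using ([]; _∷_)
open import Data.List.Relation.Unary.Any using (here; there)
open import Data.List.Relation.Unary.Unique.Propositional using (Unique)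
import Data.List.Relation.Unary.Unique.Propositional.Properties as Uniqueₚ
open import Data.Nat.Base as ℕ using (ℕ; zero; suc; _+_; _*_; _∸_; _^_; _≤_; _<_; z≤n; s≤s)
open import Data.Nat.Coprimality using (coprime-Bézout; prime⇒coprime)
import Data.Nat.DivMod as ℕm
import Data.Nat.Divisibility as ℕd
open import Data.Nat.GCD using (module Bézout)
open import Data.Nat.Induction using (<-rec)
open import Data.Nat.Primality
  using (Prime; euclidsLemma; prime⇒nonZero; prime⇒nonTrivial; prime⇒irreducible; ¬prime[0]; ¬prime[1])
import Data.Nat.Properties as ℕₚ
import Data.Nat.Solver as ℕSolver
open import Data.Product.Base using (∃-syntax; _×_; _,_; proj₁; proj₂)
open import Data.Rational.Base as ℚ using (ℚ; mkℚ; 0ℚ; 1ℚ; _/_; ↥_; ↧ₙ_)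
import Data.Rational.Properties as ℚₚ
import Data.Rational.Solver as ℚSolver
import Data.Rational.Unnormalised.Base as ℚᵘ
import Data.Rational.Unnormalised.Properties as ℚᵘₚ
open import Data.Sum.Base using (_⊎_; inj₁; inj₂)
open import Data.Vec.Base using (Vec; []; _∷_; replicate; lookup)
import Data.Vec.Functional as F
open import Data.Vec.Functional using (Vector)
open import Data.Vec.Relation.Unary.All using ([]; _∷_)
open import Function.Base using (_∘_)
open import Relation.Binary.PropositionalEquality
open import Relation.Nullary using (Dec; does; ¬_; yes; no; contradiction)
open import Relation.Nullary.Decidable using (decidable-stable; ¬?)

-- Two obstacles shape the counting. The exponent λ is real, given by a Cauchy sequence, so there is
-- no number |𝐚|^λ to compute with: every comparison goes through a rational r = n/d below λ and
-- d-th powers of natural numbers. The bound C A^e is an infimum over rational exponents q > e, and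
-- r moves towards λ as q approaches e. Hence C may depend on a fixed positive lower bound δ of r,
-- but not on r itself. Secondly, ≤ on the reals is the negation of <, and a failure of (∗) yields
-- no prime solution to inspect. Each estimate is therefore proved as a contradiction, inside which
-- the alternative "small height or many multiples" is available under double negation, for all the
-- finitely many listed tuples at once. The primes xⱼ ≤ 16k⁴ escape the local argument. They occur
-- only for bounded |𝐚|, as |𝐚|^r < xⱼ. Such tuples are absorbed in C as long as the power of A is
-- nonnegative; for a negative power only |𝐚| ≥ H is counted.

module ℕ-Solver = ℕSolver.+-*-Solver
module ℤ-Solver = ℤSolver.+-*-Solver
module ℚ-Solver = ℚSolver.+-*-Solver

open SemiringSum ℕₚ.+-*-semiring using (sum; sum-cong-≗; ∑-distrib-+; ∑-comm; *-distribˡ-sum; *-distribʳ-sum)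
open RawSemiringDefs (RawRing.rawSemiring ℤ.+-*-rawRing) using () renaming (_^_ to _^ℤ_; sum to sumℤ)
open CommutativeSemiringExp (CommutativeRing.commutativeSemiring ℤₚ.+-*-commutativeRing) using ()
  renaming (^-distrib-* to ^ℤ-distrib-*; ^-homo-* to ^ℤ-homo-*)
open SemiringExp (CommutativeRing.semiring ℚₚ.+-*-commutativeRing) using ()
  renaming (_^_ to _^ℚ_; ^-assocʳ to ^ℚ-assocʳ)
open CommutativeSemiringExp (CommutativeRing.commutativeSemiring ℚₚ.+-*-commutativeRing) using ()
  renaming (^-distrib-* to ^ℚ-distrib-*)

-- Finite sums and congruences modulo a prime

sum-mono : ∀ {n} {f g : Fin n → ℕ} → (∀ i → f i ≤ g i) → sum f ≤ sum g
sum-mono {zero}  f≤g = z≤n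
sum-mono {suc n} f≤g = ℕₚ.+-mono-≤ (f≤g Fin.zero) (sum-mono (f≤g ∘ Fin.suc))

sum-const : ∀ n c → sum {n} (λ _ → c) ≡ n * c
sum-const zero    c = refl
sum-const (suc n) c = cong (c ℕ.+_) (sum-const n c)

term≤sum : ∀ {n} (f : Fin n → ℕ) i → f i ≤ sum f
term≤sum f Fin.zero    = ℕₚ.m≤m+n (f Fin.zero) _
term≤sum f (Fin.suc i) = ℕₚ.≤-trans (term≤sum (f ∘ Fin.suc) i) (ℕₚ.m≤n+m _ (f Fin.zero))

sum≤1 : ∀ {n} (f : Fin n → ℕ) → (∀ i → f i ≤ 1) → (∀ i j → 0 < f i → 0 < f j → i ≡ j) → sum f ≤ 1
sum≤1 {zero}  f f≤1 uniq = z≤n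
sum≤1 {suc n} f f≤1 uniq with f Fin.zero in eq
... | zero  = sum≤1 (f ∘ Fin.suc) (f≤1 ∘ Fin.suc) (λ i j p q → Finₚ.suc-injective (uniq (Fin.suc i) (Fin.suc j) p q))
... | suc m = begin
  suc m + sum (f ∘ Fin.suc)   ≤⟨ ℕₚ.+-mono-≤ (subst (_≤ 1) eq (f≤1 Fin.zero)) (sum-mono rest≤0) ⟩
  1 + sum {n} (λ _ → 0)       ≡⟨ cong suc (trans (sum-const n 0) (ℕₚ.*-zeroʳ n)) ⟩
  1                           ∎
  where
  open ℕₚ.≤-Reasoning
  rest≤0 : ∀ i → f (Fin.suc i) ≤ 0
  rest≤0 i with f (Fin.suc i) in eq′
  ... | zero  = z≤n
  ... | suc _ with () ← uniq Fin.zero (Fin.suc i) (subst (0 <_) (sym eq) (s≤s z≤n)) (subst (0 <_) (sym eq′) (s≤s z≤n))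

product-of-sums : ∀ {m n} (f : Fin m → ℕ) (g : Fin n → ℕ) →
                  sum f * sum g ≡ sum (λ i → sum (λ j → f i * g j))
product-of-sums f g = trans (*-distribʳ-sum (sum g) f) (sum-cong-≗ (λ i → *-distribˡ-sum (f i) g))

sum>0 : ∀ {n} (f : Fin n → ℕ) → 0 < sum f → ∃[ i ] 0 < f i
sum>0 {suc n} f p with f Fin.zero in eq
... | suc _ = Fin.zero , subst (0 <_) (sym eq) (s≤s z≤n)
... | zero with i , q ← sum>0 (f ∘ Fin.suc) p = Fin.suc i , q

indicator : ∀ {P : Set} → Dec P → ℕ
indicator P? = if does P? then 1 else 0

indicator-yes : ∀ {P : Set} (P? : Dec P) → P → indicator P? ≡ 1
indicator-yes (yes _) _ = refl
indicator-yes (no ¬p) p = contradiction p ¬p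

indicator-no : ∀ {P : Set} (P? : Dec P) → ¬ P → indicator P? ≡ 0
indicator-no (yes p) ¬p = contradiction p ¬p
indicator-no (no _)  _  = refl

module ModPrime (p : ℕ) (p-prime : Prime p) where

  private instance
    p-nonZero : ℕ.NonZero p
    p-nonZero = prime⇒nonZero p-prime

  infix 4 p∣_
  p∣_ : ℤ → Set
  p∣ z = + p ℤd.∣ z

  abstract
    p∣?_ : ∀ z → Dec (p∣ z)
    p∣? z = + p ℤd.∣? z

  p∣*⇒ : ∀ a b → p∣ a ℤ.* b → p∣ a ⊎ p∣ b
  p∣*⇒ a b d with euclidsLemma ℤ.∣ a ∣ ℤ.∣ b ∣ p-prime (subst (p ℕd.∣_) (ℤₚ.abs-* a b) (ℤd.∣⇒∣ᵤ d))
  ... | inj₁ q = inj₁ (ℤd.∣ᵤ⇒∣ q)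
  ... | inj₂ q = inj₂ (ℤd.∣ᵤ⇒∣ q)

  p∤* : ∀ {a b} → ¬ p∣ a → ¬ p∣ b → ¬ p∣ a ℤ.* b
  p∤* {a} {b} p∤a p∤b d with p∣*⇒ a b d
  ... | inj₁ q = p∤a q
  ... | inj₂ q = p∤b q

  p∤1 : ¬ p∣ + 1
  p∤1 d = ℕ.nonTrivial⇒≢1 {{prime⇒nonTrivial p-prime}} (ℕd.∣1⇒≡1 (ℤd.∣⇒∣ᵤ d))

  p∤^ : ∀ {a} k → ¬ p∣ a → ¬ p∣ a ^ℤ k
  p∤^ zero    p∤a = p∤1
  p∤^ (suc k) p∤a = p∤* p∤a (p∤^ k p∤a)

  ∣-resp : ∀ {a b} → p∣ a → p∣ b ℤ.- a → p∣ b
  ∣-resp {a} {b} p∣a p∣b-a = subst p∣_ (solve 2 (λ a b → (b :- a) :+ a := b) refl a b) (ℤd.∣m∣n⇒∣m+n p∣b-a p∣a)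
    where open ℤ-Solver

  toℕ-unique : ∀ {i j : Fin p} → p∣ + toℕ i ℤ.- + toℕ j → i ≡ j
  toℕ-unique {i} {j} d = Finₚ.toℕ-injective (ℤₚ.+-injective (ℤₚ.i-j≡0⇒i≡j (+ toℕ i) (+ toℕ j)
     (ℤₚ.∣i∣≡0⇒i≡0 (small-multiple _ (ℤd.∣⇒∣ᵤ d) bound))))
    where
    small-multiple : ∀ n → p ℕd.∣ n → n < p → n ≡ 0
    small-multiple zero      _ _   = refl
    small-multiple n@(suc _) d n<p = contradiction (ℕd.∣⇒≤ d) (ℕₚ.<⇒≱ n<p)
    bound : ℤ.∣ + toℕ i ℤ.- + toℕ j ∣ < p
    bound = subst (_< p) (cong ℤ.∣_∣ (sym (ℤₚ.m-n≡m⊖n (toℕ i) (toℕ j))))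
      (ℕₚ.≤-<-trans (ℤₚ.∣m⊝n∣≤m⊔n (toℕ i) (toℕ j)) (ℕₚ.⊔-lub (Finₚ.toℕ<n i) (Finₚ.toℕ<n j)))

  abstract
    δ : ℤ → ℕ
    δ z = indicator (p∣? z)

    δ-∣ : ∀ {z} → p∣ z → δ z ≡ 1
    δ-∣ {z} = indicator-yes (p∣? z)

    δ-∤ : ∀ {z} → ¬ p∣ z → δ z ≡ 0
    δ-∤ {z} = indicator-no (p∣? z)

  δ≤1 : ∀ z → δ z ≤ 1
  δ≤1 z with p∣? z
  ... | yes d = ℕₚ.≤-reflexive (δ-∣ d)
  ... | no ¬d = ℕₚ.≤-trans (ℕₚ.≤-reflexive (δ-∤ ¬d)) z≤n

  δ>0⇒∣ : ∀ z → 0 < δ z → p∣ z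
  δ>0⇒∣ z q with p∣? z
  ... | yes d = d
  ... | no ¬d = contradiction (δ-∤ ¬d) (ℕₚ.>⇒≢ q)

  δ-mono : ∀ {x y} → (p∣ x → p∣ y) → δ x ≤ δ y
  δ-mono {x} {y} f with p∣? x
  ... | yes d = ℕₚ.≤-trans (δ≤1 x) (ℕₚ.≤-reflexive (sym (δ-∣ (f d))))
  ... | no ¬d = ℕₚ.≤-trans (ℕₚ.≤-reflexive (δ-∤ ¬d)) z≤n

  open ℤ-Solver using (solve; _:=_; _:*_; _:+_; _:-_; :-_; con)

  residue : ∀ z → ∃[ i ] p∣ + toℕ {p} i ℤ.- z
  residue z = fromℕ< (ℤm.n%ℕd<d z p) , ℤd.divides (ℤ.- (z ℤm./ℕ p)) (begin
    + toℕ (fromℕ< (ℤm.n%ℕd<d z p)) ℤ.- z    ≡⟨ cong (λ r → + r ℤ.- z) (Finₚ.toℕ-fromℕ< (ℤm.n%ℕd<d z p)) ⟩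
    + (z ℤm.%ℕ p) ℤ.- z                     ≡⟨ cong (λ w → + (z ℤm.%ℕ p) ℤ.- w) (ℤm.a≡a%ℕn+[a/ℕn]*n z p) ⟩
    r ℤ.- (r ℤ.+ q ℤ.* + p)                 ≡⟨ solve 3 (λ r q p → r :- (r :+ q :* p) := (:- q) :* p) refl r q (+ p) ⟩
    ℤ.- q ℤ.* + p                           ∎)
    where
    open ≡-Reasoning
    r = + (z ℤm.%ℕ p)
    q = z ℤm./ℕ p

  inverse : ∀ {a} → ¬ p∣ a → ∃[ u ] p∣ a ℤ.* u ℤ.- + 1
  inverse {a} p∤a = go (residue a)
    where
    go : (∃[ i ] p∣ + toℕ {p} i ℤ.- a) → ∃[ u ] p∣ a ℤ.* u ℤ.- + 1
    go (i , d) with toℕ i | Finₚ.toℕ<n i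
    ... | zero  | _ = contradiction (subst p∣_ (solve 1 (λ a → :- (con (+ 0) :- a) := a) refl a) (ℤd.∣m⇒∣-m d)) p∤a
    ... | r@(suc _) | r<p = bez (coprime-Bézout (prime⇒coprime p-prime r<p))
      where
      ar : ∀ u → p∣ + r ℤ.* u ℤ.- + 1 → p∣ a ℤ.* u ℤ.- + 1
      ar u e = subst p∣_ (solve 3 (λ r a u → (r :* u :- con (+ 1)) :- (r :- a) :* u := a :* u :- con (+ 1)) refl (+ r) a u)
        (ℤd.∣m∣n⇒∣m-n e (ℤd.∣m⇒∣m*n u d))
      cast : ∀ x y m n → 1 + y * n ≡ x * m → + 1 ℤ.+ + y ℤ.* + n ≡ + x ℤ.* + m
      cast x y m n eq = trans (cong (λ z → + 1 ℤ.+ z) (sym (ℤₚ.pos-* y n))) (trans (cong +_ eq) (ℤₚ.pos-* x m))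
      bez : Bézout.Identity 1 p r → _
      bez (Bézout.+- x y eq) = ℤ.- + y , ar (ℤ.- + y) (ℤd.divides (ℤ.- + x) (begin
        + r ℤ.* ℤ.- + y ℤ.- + 1      ≡⟨ solve 2 (λ r y → r :* (:- y) :- con (+ 1) := :- (con (+ 1) :+ y :* r)) refl (+ r) (+ y) ⟩
        ℤ.- (+ 1 ℤ.+ + y ℤ.* + r)    ≡⟨ cong ℤ.-_ (cast x y p r eq) ⟩
        ℤ.- (+ x ℤ.* + p)            ≡⟨ ℤₚ.neg-distribˡ-* (+ x) (+ p) ⟩
        ℤ.- + x ℤ.* + p              ∎))
        where open ≡-Reasoning
      bez (Bézout.-+ x y eq) = + y , ar (+ y) (ℤd.divides (+ x) (begin
        + r ℤ.* + y ℤ.- + 1                    ≡⟨ cong (λ z → z ℤ.- + 1) (ℤₚ.*-comm (+ r) (+ y)) ⟩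
        + y ℤ.* + r ℤ.- + 1                    ≡⟨ cong (λ z → z ℤ.- + 1) (sym (cast y x r p eq)) ⟩
        (+ 1 ℤ.+ + x ℤ.* + p) ℤ.- + 1          ≡⟨ solve 1 (λ z → (con (+ 1) :+ z) :- con (+ 1) := z) refl (+ x ℤ.* + p) ⟩
        + x ℤ.* + p                            ∎))
        where open ≡-Reasoning

  root-of-linear : ∀ {a} c → ¬ p∣ a → ∃[ i ] p∣ a ℤ.* + toℕ {p} i ℤ.+ c
  root-of-linear {a} c p∤a with u , e ← inverse p∤a with i , d ← residue (ℤ.- (c ℤ.* u)) =
    i , subst p∣_ (solve 4 (λ a m c u → a :* (m :- (:- (c :* u))) :- c :* (a :* u :- con (+ 1)) := a :* m :+ c) refl a (+ toℕ i) c u)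
      (ℤd.∣m∣n⇒∣m-n (ℤd.∣n⇒∣m*n a d) (ℤd.∣n⇒∣m*n c e))

  count-linear : ∀ {a} c → ¬ p∣ a → sum {p} (λ i → δ (a ℤ.* + toℕ i ℤ.+ c)) ≡ 1
  count-linear {a} c p∤a = ℕₚ.≤-antisym (sum≤1 _ (λ i → δ≤1 (f i)) unique) exists
    where
    f : Fin p → ℤ
    f i = a ℤ.* + toℕ i ℤ.+ c
    unique : ∀ i j → 0 < δ (f i) → 0 < δ (f j) → i ≡ j
    unique i j pi pj = cancel (p∣*⇒ a (+ toℕ i ℤ.- + toℕ j)
      (subst p∣_ (solve 4 (λ a i j c → (a :* i :+ c) :- (a :* j :+ c) := a :* (i :- j)) refl a (+ toℕ i) (+ toℕ j) c)
        (ℤd.∣m∣n⇒∣m-n (δ>0⇒∣ (f i) pi) (δ>0⇒∣ (f j) pj))))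
      where
      cancel : p∣ a ⊎ p∣ + toℕ i ℤ.- + toℕ j → i ≡ j
      cancel (inj₁ d) = contradiction d p∤a
      cancel (inj₂ d) = toℕ-unique d
    exists : 1 ≤ sum (λ i → δ (f i))
    exists = let i , d = root-of-linear c p∤a in ℕₚ.≤-trans (ℕₚ.≤-reflexive (sym (δ-∣ d))) (term≤sum (λ i → δ (f i)) i)

  count-shift : ∀ c → sum {p} (λ i → δ (+ toℕ i ℤ.+ c)) ≡ 1
  count-shift c = trans (sum-cong-≗ {p} (λ i → cong (λ z → δ (z ℤ.+ c)) (sym (ℤₚ.*-identityˡ (+ toℕ i))))) (count-linear c p∤1)

-- Roots of polynomials modulo a prime

∑₂ : ∀ {m n} → (Fin m → Fin n → ℕ) → ℕ
∑₂ f = sum (λ i → sum (f i))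

∑₂-mono : ∀ {m n} {f g : Fin m → Fin n → ℕ} → (∀ i j → f i j ≤ g i j) → ∑₂ f ≤ ∑₂ g
∑₂-mono f≤g = sum-mono (λ i → sum-mono (f≤g i))

∑₂-cong : ∀ {m n} {f g : Fin m → Fin n → ℕ} → (∀ i j → f i j ≡ g i j) → ∑₂ f ≡ ∑₂ g
∑₂-cong f≡g = sum-cong-≗ (λ i → sum-cong-≗ (f≡g i))

∑₂-const : ∀ m n c → ∑₂ {m} {n} (λ _ _ → c) ≡ m * n * c
∑₂-const m n c = begin
  sum {m} (λ _ → sum {n} (λ _ → c))   ≡⟨ sum-cong-≗ {m} (λ _ → sum-const n c) ⟩
  sum {m} (λ _ → n * c)               ≡⟨ sum-const m (n * c) ⟩
  m * (n * c)                         ≡⟨ sym (ℕₚ.*-assoc m n c) ⟩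
  m * n * c                           ∎
  where open ≡-Reasoning

∑₂-distrib-+ : ∀ {m n} (f g : Fin m → Fin n → ℕ) → ∑₂ (λ i j → f i j + g i j) ≡ ∑₂ f + ∑₂ g
∑₂-distrib-+ f g = trans (sum-cong-≗ (λ i → ∑-distrib-+ (f i) (g i))) (∑-distrib-+ (λ i → sum (f i)) (λ i → sum (g i)))

*-distribˡ-∑₂ : ∀ {m n} c (f : Fin m → Fin n → ℕ) → c * ∑₂ f ≡ ∑₂ (λ i j → c * f i j)
*-distribˡ-∑₂ c f = trans (*-distribˡ-sum c (λ i → sum (f i))) (sum-cong-≗ (λ i → *-distribˡ-sum c (f i)))

*-distribʳ-∑₂ : ∀ {m n} c (f : Fin m → Fin n → ℕ) → ∑₂ f * c ≡ ∑₂ (λ i j → f i j * c)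
*-distribʳ-∑₂ c f = trans (*-distribʳ-sum c (λ i → sum (f i))) (sum-cong-≗ (λ i → *-distribʳ-sum c (f i)))

∑-∑₂-comm : ∀ {l m n} (f : Fin l → Fin m → Fin n → ℕ) →
            sum (λ h → ∑₂ (f h)) ≡ ∑₂ (λ i j → sum (λ h → f h i j))
∑-∑₂-comm f = trans (∑-comm (λ h i → sum (f h i))) (sum-cong-≗ (λ i → ∑-comm (λ h j → f h i j)))

∑₂-comm : ∀ {k l m n} (f : Fin k → Fin l → Fin m → Fin n → ℕ) →
          ∑₂ (λ g h → ∑₂ (f g h)) ≡ ∑₂ (λ i j → ∑₂ (λ g h → f g h i j))
∑₂-comm f = trans (sum-cong-≗ (λ g → ∑-∑₂-comm (f g))) (∑-∑₂-comm (λ g i j → sum (λ h → f g h i j)))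

product-of-∑₂ : ∀ {k l m n} (f : Fin k → Fin l → ℕ) (g : Fin m → Fin n → ℕ) →
                ∑₂ f * ∑₂ g ≡ ∑₂ (λ i j → ∑₂ (λ i′ j′ → f i j * g i′ j′))
product-of-∑₂ f g = trans (*-distribʳ-∑₂ (∑₂ g) f) (∑₂-cong (λ i j → *-distribˡ-∑₂ (f i j) g))

2uv≤u²+v² : ∀ u v → 2 * (u * v) ≤ u * u + v * v
2uv≤u²+v² u v with ℕₚ.≤-total u v
... | inj₁ u≤v = go u (v ∸ u) v (ℕₚ.m+[n∸m]≡n u≤v)
  where
  go : ∀ u d v → u + d ≡ v → 2 * (u * v) ≤ u * u + v * v
  go u d _ refl = subst (2 * (u * (u + d)) ≤_)
    (solve 2 (λ u d → con 2 :* (u :* (u :+ d)) :+ d :* d := u :* u :+ (u :+ d) :* (u :+ d)) refl u d)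
    (ℕₚ.m≤m+n (2 * (u * (u + d))) (d * d))
    where open ℕ-Solver
... | inj₂ v≤u = go v (u ∸ v) u (ℕₚ.m+[n∸m]≡n v≤u)
  where
  go : ∀ v d u → v + d ≡ u → 2 * (u * v) ≤ u * u + v * v
  go v d _ refl = subst (2 * ((v + d) * v) ≤_)
    (solve 2 (λ v d → con 2 :* ((v :+ d) :* v) :+ d :* d := (v :+ d) :* (v :+ d) :+ v :* v) refl v d)
    (ℕₚ.m≤m+n (2 * ((v + d) * v)) (d * d))
    where open ℕ-Solver

-- The monic polynomial of degree n whose lower coefficients are cs.
evalMonic : ∀ {n} → Vec ℤ n → ℤ → ℤ
evalMonic []       x = + 1
evalMonic (c ∷ cs) x = c ℤ.+ x ℤ.* evalMonic cs x

evalMonic-^ : ∀ n x → evalMonic (replicate n (+ 0)) x ≡ x ^ℤ n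
evalMonic-^ zero    x = refl
evalMonic-^ (suc n) x = trans (ℤₚ.+-identityˡ _) (cong (x ℤ.*_) (evalMonic-^ n x))

-- Synthetic division by x - r: for c + x g(x) the quotient has constant term g(r), and its higher
-- coefficients come from dividing g.
divide : ∀ {n} → ℤ → Vec ℤ (suc n) → Vec ℤ n
divide {zero}  r _        = []
divide {suc n} r (c ∷ cs) = evalMonic cs r ∷ divide r cs

evalMonic-divide : ∀ {n} r x (cs : Vec ℤ (suc n)) →
                   evalMonic cs x ℤ.- evalMonic cs r ≡ (x ℤ.- r) ℤ.* evalMonic (divide r cs) x
evalMonic-divide {zero} r x (c ∷ []) =
  solve 3 (λ c x r → (c :+ x :* con (+ 1)) :- (c :+ r :* con (+ 1)) := (x :- r) :* con (+ 1)) refl c x r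
  where open ℤ-Solver
evalMonic-divide {suc n} r x (c ∷ cs) = begin
  (c ℤ.+ x ℤ.* g) ℤ.- (c ℤ.+ r ℤ.* h)
    ≡⟨ solve 5 (λ c x r g h → (c :+ x :* g) :- (c :+ r :* h) := x :* (g :- h) :+ (x :- r) :* h) refl c x r g h ⟩
  x ℤ.* (g ℤ.- h) ℤ.+ (x ℤ.- r) ℤ.* h
    ≡⟨ cong (λ z → x ℤ.* z ℤ.+ (x ℤ.- r) ℤ.* h) (evalMonic-divide r x cs) ⟩
  x ℤ.* ((x ℤ.- r) ℤ.* q) ℤ.+ (x ℤ.- r) ℤ.* h
    ≡⟨ solve 4 (λ x r q h → x :* ((x :- r) :* q) :+ (x :- r) :* h := (x :- r) :* (h :+ x :* q)) refl x r q h ⟩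
  (x ℤ.- r) ℤ.* (h ℤ.+ x ℤ.* q) ∎
  where
  open ≡-Reasoning
  open ℤ-Solver
  g = evalMonic cs x
  h = evalMonic cs r
  q = evalMonic (divide r cs) x

module RootCount (p : ℕ) (p-prime : Prime p) where
  open ModPrime p p-prime

  count-none : ∀ {n} (f : Fin n → ℤ) → (∀ i → ¬ p∣ f i) → sum (λ i → δ (f i)) ≡ 0
  count-none {n} f p∤f = trans (sum-cong-≗ (λ i → δ-∤ (p∤f i))) (trans (sum-const n 0) (ℕₚ.*-zeroʳ n))

  -- Once a root r is split off by `evalMonic-divide`, every root is r or a root of the quotient,
  -- because p is prime. Keeping the polynomials monic makes the recursion end at the constant 1,
  -- which has no root modulo p.
  count-roots : ∀ {n} (cs : Vec ℤ n) → sum {p} (λ i → δ (evalMonic cs (+ toℕ i))) ≤ n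
  count-roots {zero}  []  = ℕₚ.≤-reflexive (count-none {p} (λ _ → + 1) (λ _ → p∤1))
  count-roots {suc n} cs with Finₚ.any? {p} (λ i → p∣? evalMonic cs (+ toℕ i))
  ... | no none = ℕₚ.≤-trans (ℕₚ.≤-reflexive (count-none {p} (λ i → evalMonic cs (+ toℕ i)) (λ i d → none (i , d)))) z≤n
  ... | yes (i₀ , d₀) = begin
    sum {p} (λ i → δ (evalMonic cs (+ toℕ i)))
      ≤⟨ sum-mono {p} split ⟩
    sum {p} (λ i → δ (+ toℕ i ℤ.- r) + δ (evalMonic (divide r cs) (+ toℕ i)))
      ≡⟨ ∑-distrib-+ {p} (λ i → δ (+ toℕ i ℤ.- r)) (λ i → δ (evalMonic (divide r cs) (+ toℕ i))) ⟩
    sum {p} (λ i → δ (+ toℕ i ℤ.- r)) + sum {p} (λ i → δ (evalMonic (divide r cs) (+ toℕ i)))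
      ≤⟨ ℕₚ.+-mono-≤ (ℕₚ.≤-reflexive (count-shift (ℤ.- r))) (count-roots (divide r cs)) ⟩
    suc n ∎
    where
    open ℕₚ.≤-Reasoning
    r = + toℕ i₀
    cases : ∀ {x} → p∣ evalMonic cs x → p∣ x ℤ.- r ⊎ p∣ evalMonic (divide r cs) x
    cases {x} d = p∣*⇒ (x ℤ.- r) _ (subst p∣_ (evalMonic-divide r x cs) (ℤd.∣m∣n⇒∣m-n d d₀))
    split : ∀ i → δ (evalMonic cs (+ toℕ i)) ≤ δ (+ toℕ i ℤ.- r) + δ (evalMonic (divide r cs) (+ toℕ i))
    split i with p∣? evalMonic cs (+ toℕ i)
    ... | no p∤  = ℕₚ.≤-trans (ℕₚ.≤-reflexive (δ-∤ p∤)) z≤n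
    ... | yes d with cases d
    ...   | inj₁ e = ℕₚ.≤-trans (δ-mono (λ _ → e)) (ℕₚ.m≤m+n _ _)
    ...   | inj₂ e = ℕₚ.≤-trans (δ-mono (λ _ → e)) (ℕₚ.m≤n+m _ (δ (+ toℕ i ℤ.- r)))

module PowerCount (n : ℕ) (p-prime : Prime (suc n)) (K : ℕ) where
  private
    p = suc n
    k = suc K
  open ModPrime p p-prime
  open RootCount p p-prime

  -- The prime is written `suc n`, so that `Fin n` indexes the nonzero residues, i standing for i +
  -- 1.
  unit : Fin n → ℤ
  unit i = + suc (toℕ i)

  p∤unit : ∀ i → ¬ p∣ unit i
  p∤unit i d = ℕₚ.<⇒≱ (s≤s (Finₚ.toℕ<n i)) (ℕd.∣⇒≤ (ℤd.∣⇒∣ᵤ d))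

  unit-residue : ∀ {x} → ¬ p∣ x → ∃[ i ] p∣ unit i ℤ.- x
  unit-residue {x} p∤x with residue x
  ... | Fin.zero  , d = contradiction (subst p∣_ (solve 1 (λ x → :- (con (+ 0) :- x) := x) refl x) (ℤd.∣m⇒∣-m d)) p∤x
    where open ℤ-Solver
  ... | Fin.suc i , d = i , d

  power : Fin n → ℤ
  power i = unit i ^ℤ k

  count-power : ∀ b c → ¬ p∣ b → sum {n} (λ t → δ (c ℤ.- b ℤ.* power t)) ≤ k
  count-power b c p∤b with Finₚ.any? {n} (λ t → p∣? (c ℤ.- b ℤ.* power t))
  ... | no none = ℕₚ.≤-trans (ℕₚ.≤-reflexive (count-none {n} (λ t → c ℤ.- b ℤ.* power t) (λ i d → none (i , d)))) z≤n
  ... | yes (t₀ , d₀) = begin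
    sum {n} (λ t → δ (c ℤ.- b ℤ.* power t))             ≤⟨ sum-mono {n} (λ t → δ-mono (root t)) ⟩
    sum {n} (λ t → δ (evalMonic cs (unit t)))           ≤⟨ ℕₚ.m≤n+m _ (δ (evalMonic cs (+ 0))) ⟩
    sum {p} (λ i → δ (evalMonic cs (+ toℕ i)))          ≤⟨ count-roots cs ⟩
    k                                                   ∎
    where
    open ℕₚ.≤-Reasoning
    open ℤ-Solver
    cs : Vec ℤ k
    -- Comparison with one solution t₀ eliminates c, and b cancels; what remains is the monic
    -- polynomial xᵏ - t₀ᵏ.
    cs = ℤ.- power t₀ ∷ replicate K (+ 0)
    root : ∀ t → p∣ c ℤ.- b ℤ.* power t → p∣ evalMonic cs (unit t)
    root t d = subst (λ z → p∣ ℤ.- power t₀ ℤ.+ unit t ℤ.* z) (sym (evalMonic-^ K (unit t)))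
      (cancel (p∣*⇒ b _ (subst p∣_ (solve 4 (λ b c x y → (c :- b :* y) :- (c :- b :* x) := b :* (:- y :+ x)) refl b c (power t) (power t₀))
        (ℤd.∣m∣n⇒∣m-n d₀ d))))
      where
      cancel : p∣ b ⊎ p∣ ℤ.- power t₀ ℤ.+ power t → p∣ ℤ.- power t₀ ℤ.+ power t
      cancel (inj₁ e) = contradiction e p∤b
      cancel (inj₂ e) = e

-- Ternary diagonal forms modulo a prime

∣-^ : ∀ {d} x y k → d ℤd.∣ x ℤ.- y → d ℤd.∣ x ^ℤ k ℤ.- y ^ℤ k
∣-^ x y zero    _ = ℤd.divides (+ 0) refl
∣-^ {d} x y (suc k) d∣x-y = subst (d ℤd.∣_)
  (solve 4 (λ x y X Y → x :* (X :- Y) :+ (x :- y) :* Y := x :* X :- y :* Y) refl x y (x ^ℤ k) (y ^ℤ k))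
  (ℤd.∣m∣n⇒∣m+n (ℤd.∣n⇒∣m*n x (∣-^ x y k d∣x-y)) (ℤd.∣m⇒∣m*n (y ^ℤ k) d∣x-y))
  where open ℤ-Solver

module TernaryForm (n : ℕ) (p-prime : Prime (suc n)) (K : ℕ) where
  private
    p = suc n
    k = suc K
    Q = n * n
    κ = k * k
  open ModPrime p p-prime
  open RootCount p p-prime
  open PowerCount n p-prime K

  open ℤ-Solver using (solve; _:=_; _:*_; _:+_; _:-_; :-_; con)

  -- A form m₀xᵏ + ayᵏ + b₀wᵏ without zeros in units is shown to force p ≤ 16k⁴. Put Q = (p - 1)²
  -- and κ = k². The sum of (pS - Q)² over all p² lines (m, b) is at most κp³Q, whereas the lines on
  -- which S vanishes contribute at least Q² · Q/κ.
  module Variance (m₀ a b₀ : ℤ) (p∤m₀ : ¬ p∣ m₀) (p∤a : ¬ p∣ a) (p∤b₀ : ¬ p∣ b₀)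
    (insoluble : ∀ x y w → ¬ p∣ x → ¬ p∣ y → ¬ p∣ w → ¬ p∣ (m₀ ℤ.* x ^ℤ k ℤ.+ a ℤ.* y ^ℤ k) ℤ.+ b₀ ℤ.* w ^ℤ k)
    where

    ⟦_⟧ : Fin p → ℤ
    ⟦ i ⟧ = + toℕ i

    form : Fin p → Fin p → Fin n → Fin n → ℤ
    form m b x y = power x ℤ.* ⟦ m ⟧ ℤ.+ (⟦ b ⟧ ℤ.+ a ℤ.* power y)

    -- W is positive exactly on the lines (m₀tᵏ, b₀wᵏ) and counts the pairs of units (t, w) that
    -- represent them. As a weight it is easier to sum than its support: each (t, w) lies over
    -- exactly one line, so the total is Q.
    S W : Fin p → Fin p → ℕ
    S m b = ∑₂ (λ x y → δ (form m b x y))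
    W m b = ∑₂ (λ t w → δ (⟦ m ⟧ ℤ.- m₀ ℤ.* power t) * δ (⟦ b ⟧ ℤ.- b₀ ℤ.* power w))

    private
      shift-form : ∀ m b x y → ⟦ b ⟧ ℤ.+ (power x ℤ.* ⟦ m ⟧ ℤ.+ a ℤ.* power y) ≡ form m b x y
      shift-form m b x y = solve 4 (λ b u m v → b :+ (u :* m :+ v) := u :* m :+ (b :+ v)) refl
        ⟦ b ⟧ (power x) ⟦ m ⟧ (a ℤ.* power y)

    sum-over-b : ∀ m x y → sum (λ b → δ (form m b x y)) ≡ 1
    sum-over-b m x y = trans
      (sum-cong-≗ (λ b → cong δ (sym (shift-form m b x y))))
      (count-shift (power x ℤ.* ⟦ m ⟧ ℤ.+ a ℤ.* power y))

    first-moment : ∑₂ S ≡ Q * p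
    first-moment = begin
      ∑₂ S
        ≡⟨ ∑₂-comm (λ m b x y → δ (form m b x y)) ⟩
      ∑₂ (λ x y → ∑₂ (λ m b → δ (form m b x y)))
        ≡⟨ ∑₂-cong (λ x y → trans (sum-cong-≗ (λ m → sum-over-b m x y)) (trans (sum-const p 1) (ℕₚ.*-identityʳ p))) ⟩
      ∑₂ {n} {n} (λ _ _ → p)
        ≡⟨ ∑₂-const n n p ⟩
      Q * p ∎
      where open ≡-Reasoning

    -- Two pairs with distinct x-powers lie on exactly one line (m, b).
    pair-correlation : ∀ x y x′ y′ → ∑₂ (λ m b → δ (form m b x y) * δ (form m b x′ y′)) ≤
                       1 + p * (δ (power x ℤ.- + 1 ℤ.* power x′) * δ (power y ℤ.- + 1 ℤ.* power y′))
    pair-correlation x y x′ y′ = begin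
      ∑₂ (λ m b → δ (form m b x y) * δ (form m b x′ y′))
        ≤⟨ ∑₂-mono eliminate-b ⟩
      ∑₂ (λ m b → δ (form m b x y) * δ (slope m))
        ≡⟨ sum-cong-≗ (λ m → sym (*-distribʳ-sum (δ (slope m)) (λ b → δ (form m b x y)))) ⟩
      sum (λ m → sum (λ b → δ (form m b x y)) * δ (slope m))
        ≡⟨ sum-cong-≗ (λ m → trans (cong (_* δ (slope m)) (sum-over-b m x y)) (ℕₚ.*-identityˡ (δ (slope m)))) ⟩
      sum (λ m → δ (slope m))
        ≤⟨ count-slopes (p∣? ΔX) ⟩
      1 + p * (δ ΔX * δ ΔY) ∎
      where
      open ℕₚ.≤-Reasoning
      ΔX = power x ℤ.- + 1 ℤ.* power x′
      ΔY = power y ℤ.- + 1 ℤ.* power y′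
      slope : Fin p → ℤ
      slope m = ΔX ℤ.* ⟦ m ⟧ ℤ.+ a ℤ.* ΔY
      difference : ∀ m b → form m b x y ℤ.- form m b x′ y′ ≡ slope m
      difference m b = solve 7 (λ X X′ Y Y′ m b a →
          (X :* m :+ (b :+ a :* Y)) :- (X′ :* m :+ (b :+ a :* Y′)) :=
          (X :- con (+ 1) :* X′) :* m :+ a :* (Y :- con (+ 1) :* Y′)) refl
        (power x) (power x′) (power y) (power y′) ⟦ m ⟧ ⟦ b ⟧ a
      eliminate-b : ∀ m b → δ (form m b x y) * δ (form m b x′ y′) ≤ δ (form m b x y) * δ (slope m)
      eliminate-b m b with p∣? form m b x y
      ... | yes d = ℕₚ.*-monoʳ-≤ (δ (form m b x y)) (δ-mono (λ d′ → subst p∣_ (difference m b) (ℤd.∣m∣n⇒∣m-n d d′)))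
      ... | no ¬d = ℕₚ.≤-trans (ℕₚ.≤-reflexive (cong (_* δ (form m b x′ y′)) (δ-∤ ¬d))) z≤n
      count-slopes : Dec (p∣ ΔX) → sum (λ m → δ (slope m)) ≤ 1 + p * (δ ΔX * δ ΔY)
      count-slopes (no ¬d) = ℕₚ.≤-trans (ℕₚ.≤-reflexive (count-linear (a ℤ.* ΔY) ¬d)) (ℕₚ.m≤m+n 1 _)
      -- For equal x-powers a common line exists only if the y-powers agree too, and then every m
      -- occurs.
      count-slopes (yes d) = begin
        sum (λ m → δ (slope m))             ≤⟨ sum-mono (λ m → δ-mono (vertical m)) ⟩
        sum {p} (λ _ → δ ΔY)                ≡⟨ sum-const p (δ ΔY) ⟩
        p * δ ΔY                            ≡⟨ cong (p *_) (sym (trans (cong (_* δ ΔY) (δ-∣ d)) (ℕₚ.*-identityˡ (δ ΔY)))) ⟩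
        p * (δ ΔX * δ ΔY)                   ≤⟨ ℕₚ.m≤n+m _ 1 ⟩
        1 + p * (δ ΔX * δ ΔY)               ∎
        where
        vertical : ∀ m → p∣ slope m → p∣ ΔY
        vertical m e = cancel (p∣*⇒ a ΔY (ℤd.∣m+n∣m⇒∣n e (ℤd.∣m⇒∣m*n ⟦ m ⟧ d)))
          where
          cancel : p∣ a ⊎ p∣ ΔY → p∣ ΔY
          cancel (inj₁ f) = contradiction f p∤a
          cancel (inj₂ f) = f

    -- Each of the Q² pairs of points contributes 1. A further p arises only if both xᵏ ≡ x′ᵏ and yᵏ
    -- ≡ y′ᵏ, which for given (x, y) happens for at most k · k points.
    second-moment : ∑₂ (λ m b → S m b * S m b) ≤ Q * (Q + p * κ)
    second-moment = begin
      ∑₂ (λ m b → S m b * S m b)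
        ≡⟨ ∑₂-cong (λ m b → product-of-∑₂ (λ x y → δ (form m b x y)) (λ x y → δ (form m b x y))) ⟩
      ∑₂ (λ m b → ∑₂ (λ x y → ∑₂ (λ x′ y′ → δ (form m b x y) * δ (form m b x′ y′))))
        ≡⟨ ∑₂-comm (λ m b x y → ∑₂ (λ x′ y′ → δ (form m b x y) * δ (form m b x′ y′))) ⟩
      ∑₂ (λ x y → ∑₂ (λ m b → ∑₂ (λ x′ y′ → δ (form m b x y) * δ (form m b x′ y′))))
        ≡⟨ ∑₂-cong (λ x y → ∑₂-comm (λ m b x′ y′ → δ (form m b x y) * δ (form m b x′ y′))) ⟩
      ∑₂ (λ x y → ∑₂ (λ x′ y′ → ∑₂ (λ m b → δ (form m b x y) * δ (form m b x′ y′))))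
        ≤⟨ ∑₂-mono (λ x y → ∑₂-mono (λ x′ y′ → pair-correlation x y x′ y′)) ⟩
      ∑₂ (λ x y → ∑₂ (λ x′ y′ → 1 + p * (D x x′ * D y y′)))
        ≤⟨ ∑₂-mono inner ⟩
      ∑₂ {n} {n} (λ _ _ → Q + p * κ)
        ≡⟨ ∑₂-const n n (Q + p * κ) ⟩
      Q * (Q + p * κ) ∎
      where
      open ℕₚ.≤-Reasoning
      D : Fin n → Fin n → ℕ
      D x x′ = δ (power x ℤ.- + 1 ℤ.* power x′)
      inner : ∀ x y → ∑₂ (λ x′ y′ → 1 + p * (D x x′ * D y y′)) ≤ Q + p * κ
      inner x y = begin
        ∑₂ (λ x′ y′ → 1 + p * (D x x′ * D y y′))
          ≡⟨ ∑₂-distrib-+ (λ _ _ → 1) (λ x′ y′ → p * (D x x′ * D y y′)) ⟩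
        ∑₂ {n} {n} (λ _ _ → 1) + ∑₂ (λ x′ y′ → p * (D x x′ * D y y′))
          ≡⟨ cong₂ _+_ (trans (∑₂-const n n 1) (ℕₚ.*-identityʳ Q)) (sym (*-distribˡ-∑₂ p (λ x′ y′ → D x x′ * D y y′))) ⟩
        Q + p * ∑₂ (λ x′ y′ → D x x′ * D y y′)
          ≡⟨ cong (λ z → Q + p * z) (sym (product-of-sums (D x) (D y))) ⟩
        Q + p * (sum (D x) * sum (D y))
          ≤⟨ ℕₚ.+-monoʳ-≤ Q (ℕₚ.*-monoʳ-≤ p (ℕₚ.*-mono-≤ (count-power (+ 1) (power x) p∤1) (count-power (+ 1) (power y) p∤1))) ⟩
        Q + p * κ ∎

    -- Together with `total-W` this yields at least Q/κ lines on which S vanishes.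
    W≤κ : ∀ m b → W m b ≤ κ
    W≤κ m b = begin
      W m b               ≡⟨ sym (product-of-sums f g) ⟩
      sum f * sum g       ≤⟨ ℕₚ.*-mono-≤ (count-power m₀ ⟦ m ⟧ p∤m₀) (count-power b₀ ⟦ b ⟧ p∤b₀) ⟩
      κ                   ∎
      where
      open ℕₚ.≤-Reasoning
      f g : Fin n → ℕ
      f t = δ (⟦ m ⟧ ℤ.- m₀ ℤ.* power t)
      g w = δ (⟦ b ⟧ ℤ.- b₀ ℤ.* power w)

    total-W : ∑₂ W ≡ Q
    total-W = begin
      ∑₂ W
        ≡⟨ ∑₂-comm (λ m b t w → F m t * G b w) ⟩
      ∑₂ (λ t w → ∑₂ (λ m b → F m t * G b w))
        ≡⟨ ∑₂-cong (λ t w → trans (sym (product-of-sums (λ m → F m t) (λ b → G b w)))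
             (cong₂ _*_ (count-shift (ℤ.- (m₀ ℤ.* power t))) (count-shift (ℤ.- (b₀ ℤ.* power w))))) ⟩
      ∑₂ {n} {n} (λ _ _ → 1)
        ≡⟨ trans (∑₂-const n n 1) (ℕₚ.*-identityʳ Q) ⟩
      Q ∎
      where
      open ≡-Reasoning
      F G : Fin p → Fin n → ℕ
      F m t = δ (⟦ m ⟧ ℤ.- m₀ ℤ.* power t)
      G b w = δ (⟦ b ⟧ ℤ.- b₀ ℤ.* power w)

    -- If m ≡ m₀tᵏ and b ≡ b₀wᵏ, a point (x, y) on the line (m, b) gives the zero (xt, y, w) of the
    -- original form.
    W>0⇒S≡0 : ∀ m b → 0 < W m b → S m b ≡ 0
    W>0⇒S≡0 m b W>0
      with t , W₁ ← sum>0 (λ t → sum (λ w → δ (⟦ m ⟧ ℤ.- m₀ ℤ.* power t) * δ (⟦ b ⟧ ℤ.- b₀ ℤ.* power w))) W>0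
      with w , W₂ ← sum>0 (λ w → δ (⟦ m ⟧ ℤ.- m₀ ℤ.* power t) * δ (⟦ b ⟧ ℤ.- b₀ ℤ.* power w)) W₁ =
      trans (∑₂-cong (λ x y → δ-∤ (λ d → insoluble (unit x ℤ.* unit t) (unit y) (unit w)
          (p∤* (p∤unit x) (p∤unit t)) (p∤unit y) (p∤unit w) (translate x y d))))
        (trans (∑₂-const n n 0) (ℕₚ.*-zeroʳ Q))
      where
      factors>0 : ∀ u v → 0 < u * v → 0 < u × 0 < v
      factors>0 (suc u) (suc v) _ = s≤s z≤n , s≤s z≤n
      factors>0 (suc u) zero    q = contradiction (ℕₚ.*-zeroʳ (suc u)) (ℕₚ.>⇒≢ q)
      d₁ : p∣ ⟦ m ⟧ ℤ.- m₀ ℤ.* power t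
      d₁ = δ>0⇒∣ _ (proj₁ (factors>0 _ _ W₂))
      d₂ : p∣ ⟦ b ⟧ ℤ.- b₀ ℤ.* power w
      d₂ = δ>0⇒∣ _ (proj₂ (factors>0 (δ (⟦ m ⟧ ℤ.- m₀ ℤ.* power t)) _ W₂))
      translate : ∀ x y → p∣ form m b x y →
        p∣ (m₀ ℤ.* (unit x ℤ.* unit t) ^ℤ k ℤ.+ a ℤ.* unit y ^ℤ k) ℤ.+ b₀ ℤ.* unit w ^ℤ k
      translate x y d = subst (λ z → p∣ (m₀ ℤ.* z ℤ.+ a ℤ.* power y) ℤ.+ b₀ ℤ.* power w)
        (sym (^ℤ-distrib-* (unit x) (unit t) k))
        (subst p∣_ (solve 8 (λ X m b a Y M T B → (X :* m :+ (b :+ a :* Y)) :- (X :* (m :- M :* T) :+ (b :- B)) :=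
                                                (M :* (X :* T) :+ a :* Y) :+ B) refl
            (power x) ⟦ m ⟧ ⟦ b ⟧ a (power y) m₀ (power t) (b₀ ℤ.* power w))
          (ℤd.∣m∣n⇒∣m-n d (ℤd.∣m∣n⇒∣m+n (ℤd.∣n⇒∣m*n (power x) d₁) d₂)))

    -- This is Q²W ≤ κ(pS - Q)² with the negative term moved to the left. For W = 0 the right side
    -- is a multiple of a square; for W > 0 it is κQ², and W ≤ κ.
    pointwise : ∀ m b → κ * (2 * (p * Q) * S m b) + Q * Q * W m b ≤ κ * (p * p * (S m b * S m b) + Q * Q)
    pointwise m b = go (W m b) (S m b) (W≤κ m b) (W>0⇒S≡0 m b)
      where
      open ℕₚ.≤-Reasoning
      go : ∀ W S → W ≤ κ → (0 < W → S ≡ 0) → κ * (2 * (p * Q) * S) + Q * Q * W ≤ κ * (p * p * (S * S) + Q * Q)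
      go zero S _ _ = begin
        κ * (2 * (p * Q) * S) + Q * Q * 0     ≡⟨ N.solve 4 (λ κ p Q S → κ N.:* (N.con 2 N.:* (p N.:* Q) N.:* S) N.:+ Q N.:* Q N.:* N.con 0 N.:= κ N.:* (N.con 2 N.:* ((p N.:* S) N.:* Q))) refl κ p Q S ⟩
        κ * (2 * ((p * S) * Q))               ≤⟨ ℕₚ.*-monoʳ-≤ κ (2uv≤u²+v² (p * S) Q) ⟩
        κ * ((p * S) * (p * S) + Q * Q)       ≡⟨ N.solve 4 (λ κ p Q S → κ N.:* ((p N.:* S) N.:* (p N.:* S) N.:+ Q N.:* Q) N.:= κ N.:* (p N.:* p N.:* (S N.:* S) N.:+ Q N.:* Q)) refl κ p Q S ⟩
        κ * (p * p * (S * S) + Q * Q)         ∎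
        where module N = ℕ-Solver
      go (suc W) S W≤κ S≡0 rewrite S≡0 (s≤s z≤n) = begin
        κ * (2 * (p * Q) * 0) + Q * Q * suc W   ≡⟨ cong (_+ Q * Q * suc W) (trans (cong (κ *_) (ℕₚ.*-zeroʳ (2 * (p * Q)))) (ℕₚ.*-zeroʳ κ)) ⟩
        Q * Q * suc W                           ≤⟨ ℕₚ.*-monoʳ-≤ (Q * Q) W≤κ ⟩
        Q * Q * κ                               ≡⟨ ℕₚ.*-comm (Q * Q) κ ⟩
        κ * (Q * Q)                             ≤⟨ ℕₚ.*-monoʳ-≤ κ (ℕₚ.m≤n+m (Q * Q) (p * p * (0 * 0))) ⟩
        κ * (p * p * (0 * 0) + Q * Q)           ∎

    summed : κ * (2 * (p * Q) * (Q * p)) + Q * Q * Q ≤ κ * (p * p * (Q * (Q + p * κ)) + p * p * (Q * Q))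
    summed = begin
      κ * (2 * (p * Q) * (Q * p)) + Q * Q * Q
        ≡⟨ cong₂ (λ u v → κ * (2 * (p * Q) * u) + Q * Q * v) (sym first-moment) (sym total-W) ⟩
      κ * (2 * (p * Q) * ∑₂ S) + Q * Q * ∑₂ W
        ≡⟨ cong₂ _+_ (trans (cong (κ *_) (*-distribˡ-∑₂ (2 * (p * Q)) S)) (*-distribˡ-∑₂ κ (λ m b → 2 * (p * Q) * S m b))) (*-distribˡ-∑₂ (Q * Q) W) ⟩
      ∑₂ (λ m b → κ * (2 * (p * Q) * S m b)) + ∑₂ (λ m b → Q * Q * W m b)
        ≡⟨ sym (∑₂-distrib-+ (λ m b → κ * (2 * (p * Q) * S m b)) (λ m b → Q * Q * W m b)) ⟩
      ∑₂ (λ m b → κ * (2 * (p * Q) * S m b) + Q * Q * W m b)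
        ≤⟨ ∑₂-mono pointwise ⟩
      ∑₂ (λ m b → κ * (p * p * (S m b * S m b) + Q * Q))
        ≡⟨ sym (*-distribˡ-∑₂ κ (λ m b → p * p * (S m b * S m b) + Q * Q)) ⟩
      κ * ∑₂ (λ m b → p * p * (S m b * S m b) + Q * Q)
        ≡⟨ cong (κ *_) (∑₂-distrib-+ (λ m b → p * p * (S m b * S m b)) (λ _ _ → Q * Q)) ⟩
      κ * (∑₂ (λ m b → p * p * (S m b * S m b)) + ∑₂ {p} {p} (λ _ _ → Q * Q))
        ≡⟨ cong₂ (λ u v → κ * (u + v)) (sym (*-distribˡ-∑₂ (p * p) (λ m b → S m b * S m b))) (∑₂-const p p (Q * Q)) ⟩
      κ * (p * p * ∑₂ (λ m b → S m b * S m b) + p * p * (Q * Q))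
        ≤⟨ ℕₚ.*-monoʳ-≤ κ (ℕₚ.+-monoˡ-≤ (p * p * (Q * Q)) (ℕₚ.*-monoʳ-≤ (p * p) second-moment)) ⟩
      κ * (p * p * (Q * (Q + p * κ)) + p * p * (Q * Q)) ∎
      where open ℕₚ.≤-Reasoning

    -- The term 2κp²Q² occurs on both sides of `summed` and cancels. What is left compares the
    -- contribution of the lines with S = 0 to the variance.
    Q³≤κ²p³Q : Q * Q * Q ≤ κ * κ * (p * p * p) * Q
    Q³≤κ²p³Q = ℕₚ.+-cancelˡ-≤ (κ * (2 * (p * Q) * (Q * p))) _ _ (ℕₚ.≤-trans summed (ℕₚ.≤-reflexive
      (N.solve 3 (λ κ p Q → κ N.:* (p N.:* p N.:* (Q N.:* (Q N.:+ p N.:* κ)) N.:+ p N.:* p N.:* (Q N.:* Q)) N.:=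
                            κ N.:* (N.con 2 N.:* (p N.:* Q) N.:* (Q N.:* p)) N.:+ κ N.:* κ N.:* (p N.:* p N.:* p) N.:* Q) refl κ p Q)))
      where module N = ℕ-Solver

    -- Essentially Q² ≤ κ²p³, combined with p² ≤ 4Q, the square of p ≤ 2(p - 1), gives p⁴ ≤ 16κ²p³.
    -- This is the origin of 16k⁴.
    p≤16κ² : p ≤ 16 * (κ * κ)
    p≤16κ² with p ℕₚ.≤? 16 * (κ * κ)
    ... | yes le = le
    ... | no ¬le = contradiction (ℕₚ.*-monoʳ-≤ 16 Q³≤κ²p³Q) (ℕₚ.<⇒≱ (begin-strict
      16 * (κ * κ * (p * p * p) * Q)
        ≡⟨ N.solve 3 (λ c p Q → N.con 16 N.:* (c N.:* (p N.:* p N.:* p) N.:* Q) N.:= (N.con 16 N.:* c) N.:* (p N.:* p N.:* p N.:* Q)) refl (κ * κ) p Q ⟩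
      16 * (κ * κ) * (p * p * p * Q)
        <⟨ ℕₚ.*-monoˡ-< (p * p * p * Q) (ℕₚ.≰⇒> ¬le) ⟩
      p * (p * p * p * Q)
        ≡⟨ N.solve 2 (λ p Q → p N.:* (p N.:* p N.:* p N.:* Q) N.:= (p N.:* p) N.:* (p N.:* p) N.:* Q) refl p Q ⟩
      (p * p) * (p * p) * Q
        ≤⟨ ℕₚ.*-monoˡ-≤ Q (ℕₚ.*-mono-≤ p²≤4Q p²≤4Q) ⟩
      (4 * Q) * (4 * Q) * Q
        ≡⟨ N.solve 1 (λ Q → (N.con 4 N.:* Q) N.:* (N.con 4 N.:* Q) N.:* Q N.:= N.con 16 N.:* (Q N.:* Q N.:* Q)) refl Q ⟩
      16 * (Q * Q * Q) ∎))
      where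
      open ℕₚ.≤-Reasoning
      module N = ℕ-Solver
      1≤n : 1 ≤ n
      1≤n = ℕₚ.≤-pred (ℕ.nonTrivial⇒n>1 p {{prime⇒nonTrivial p-prime}})
      instance
        n≢0 : ℕ.NonZero n
        n≢0 = ℕ.>-nonZero 1≤n
        Q≢0 : ℕ.NonZero Q
        Q≢0 = ℕₚ.m*n≢0 n n
        p³Q≢0 : ℕ.NonZero (p * p * p * Q)
        p³Q≢0 = ℕₚ.m*n≢0 (p * p * p) Q {{ℕₚ.m*n≢0 (p * p) p}}
      p≤2n : p ≤ 2 * n
      p≤2n = ℕₚ.+-mono-≤ {x = 1} {y = n} 1≤n (ℕₚ.≤-reflexive (sym (ℕₚ.+-identityʳ n)))
      p²≤4Q : p * p ≤ 4 * Q
      p²≤4Q = ℕₚ.≤-trans (ℕₚ.*-mono-≤ p≤2n p≤2n)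
        (ℕₚ.≤-reflexive (N.solve 1 (λ n → (N.con 2 N.:* n) N.:* (N.con 2 N.:* n) N.:= N.con 4 N.:* (n N.:* n)) refl n))

  soluble : 16 * (κ * κ) < p → ∀ m a b → ¬ p∣ m → ¬ p∣ a → ¬ p∣ b →
            ∃[ x ] ∃[ y ] ∃[ w ] ¬ p∣ x × ¬ p∣ y × ¬ p∣ w × p∣ (m ℤ.* x ^ℤ k ℤ.+ a ℤ.* y ^ℤ k) ℤ.+ b ℤ.* w ^ℤ k
  soluble p-large m a b p∤m p∤a p∤b with Finₚ.any? {n} (λ x → Finₚ.any? {n} (λ y → Finₚ.any? {n} (λ w →
                                           p∣? ((m ℤ.* power x ℤ.+ a ℤ.* power y) ℤ.+ b ℤ.* power w))))
  ... | yes (x , y , w , d) = unit x , unit y , unit w , p∤unit x , p∤unit y , p∤unit w , d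
  ... | no none = contradiction (Variance.p≤16κ² m a b p∤m p∤a p∤b insoluble) (ℕₚ.<⇒≱ p-large)
    where
    insoluble : ∀ x y w → ¬ p∣ x → ¬ p∣ y → ¬ p∣ w → ¬ p∣ (m ℤ.* x ^ℤ k ℤ.+ a ℤ.* y ^ℤ k) ℤ.+ b ℤ.* w ^ℤ k
    insoluble x y w p∤x p∤y p∤w d
      with i , i≡x ← unit-residue p∤x | j , j≡y ← unit-residue p∤y | l , l≡w ← unit-residue p∤w =
      none (i , j , l , ∣-resp d (subst p∣_
        (solve 9 (λ m a b X Y W x y w → (m :* (X :- x) :+ a :* (Y :- y)) :+ b :* (W :- w) :=
            ((m :* X :+ a :* Y) :+ b :* W) :- ((m :* x :+ a :* y) :+ b :* w)) refl
          m a b (power i) (power j) (power l) (x ^ℤ k) (y ^ℤ k) (w ^ℤ k))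
        (ℤd.∣m∣n⇒∣m+n (ℤd.∣m∣n⇒∣m+n (ℤd.∣n⇒∣m*n m (∣-^ (unit i) x k i≡x)) (ℤd.∣n⇒∣m*n a (∣-^ (unit j) y k j≡y))) (ℤd.∣n⇒∣m*n b (∣-^ (unit l) w k l≡w)))))

-- Diagonal forms in many variables modulo powers of a prime

diagonal : ∀ {s} → ℕ → Vec ℤ s → Vector ℤ s → ℤ
diagonal k a x = sumℤ (λ j → lookup a j ℤ.* x j ^ℤ k)

-- At least m entries of the tuple are prime to p.
data NonMultiples (p : ℕ) : ∀ {s} → ℕ → Vec ℤ s → Set where
  none : ∀ {s} {a : Vec ℤ s} → NonMultiples p 0 a
  skip : ∀ {s m c} {a : Vec ℤ s} → NonMultiples p m a → NonMultiples p m (c ∷ a)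
  take : ∀ {s m c} {a : Vec ℤ s} → ¬ (+ p ℤd.∣ c) → NonMultiples p m a → NonMultiples p (suc m) (c ∷ a)

nonMultiples? : ∀ p {s} m (a : Vec ℤ s) → Dec (NonMultiples p m a)
nonMultiples? p zero    a       = yes none
nonMultiples? p (suc m) []      = no λ ()
nonMultiples? p (suc m) (c ∷ a) with nonMultiples? p (suc m) a | + p ℤd.∣? c
... | yes h | _      = yes (skip h)
... | no ¬h | yes d  = no λ { (skip h) → ¬h h ; (take ¬d _) → ¬d d }
... | no ¬h | no ¬d with nonMultiples? p m a
...   | yes h = yes (take ¬d h)
...   | no ¬g = no λ { (skip h) → ¬h h ; (take _ g) → ¬g g }

nonMultiples-pred : ∀ {p s m} {a : Vec ℤ s} → NonMultiples p (suc m) a → NonMultiples p m a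
nonMultiples-pred (skip h)   = skip (nonMultiples-pred h)
nonMultiples-pred (take _ h) = skip h

binomial : ∀ k y h → ∃[ r ] (y ℤ.+ h) ^ℤ suc k ≡ (y ^ℤ suc k ℤ.+ + suc k ℤ.* y ^ℤ k ℤ.* h) ℤ.+ h ℤ.* h ℤ.* r
binomial zero    y h = + 0 , solve 2 (λ y h → (y :+ h) :* con (+ 1) :=
    (y :* con (+ 1) :+ con (+ 1) :* con (+ 1) :* h) :+ h :* h :* con (+ 0)) refl y h
  where open ℤ-Solver
binomial (suc k) y h with r , eq ← binomial k y h =
  + suc k ℤ.* y ^ℤ k ℤ.+ (y ℤ.+ h) ℤ.* r , (begin
    (y ℤ.+ h) ℤ.* (y ℤ.+ h) ^ℤ suc k
      ≡⟨ cong (λ z → (y ℤ.+ h) ℤ.* z) eq ⟩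
    (y ℤ.+ h) ℤ.* ((y ℤ.* Y ℤ.+ + suc k ℤ.* Y ℤ.* h) ℤ.+ h ℤ.* h ℤ.* r)
      ≡⟨ solve 5 (λ y h Y κ r → (y :+ h) :* ((y :* Y :+ κ :* Y :* h) :+ h :* h :* r) :=
           (y :* (y :* Y) :+ (con (+ 1) :+ κ) :* (y :* Y) :* h) :+ h :* h :* (κ :* Y :+ (y :+ h) :* r)) refl y h Y (+ suc k) r ⟩
    (y ℤ.* (y ℤ.* Y) ℤ.+ + suc (suc k) ℤ.* (y ℤ.* Y) ℤ.* h) ℤ.+ h ℤ.* h ℤ.* (+ suc k ℤ.* Y ℤ.+ (y ℤ.+ h) ℤ.* r) ∎)
  where
  open ≡-Reasoning
  open ℤ-Solver
  Y = y ^ℤ k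

Units : ∀ p {s} → Vector ℤ s → Set
Units p x = ∀ j → ¬ (+ p ℤd.∣ x j)

-- One Hensel step, from the modulus q to pq. The target v is arbitrary because the recursion along
-- the tuple moves the leading term to the side of v.
Lift : ∀ p k {s} → ℤ → Vec ℤ s → ℤ → Vector ℤ s → Set
Lift p k q a v y = ∃[ y′ ] (∀ j → q ℤd.∣ y′ j ℤ.- y j) × + p ℤ.* q ℤd.∣ v ℤ.- diagonal k a y′

module Local (n : ℕ) (p-prime : Prime (suc n)) (K : ℕ) (p-large : 16 * (suc K * suc K * (suc K * suc K)) < suc n) where
  private
    p = suc n
    k = suc K
  open ModPrime p p-prime
  open RootCount p p-prime
  open PowerCount n p-prime K
  open TernaryForm n p-prime K using (soluble)
  open ℤ-Solver using (solve; _:=_; _:*_; _:+_; _:-_; :-_; con)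

  units-∷ : ∀ {s x} {xs : Vector ℤ s} → ¬ p∣ x → Units p xs → Units p (x F.∷ xs)
  units-∷ p∤x us Fin.zero    = p∤x
  units-∷ p∤x us (Fin.suc j) = us j

  k<n : k < n
  k<n = ℕₚ.≤-pred (ℕₚ.≤-<-trans (begin
      1 + k                    ≤⟨ ℕₚ.+-monoˡ-≤ k (s≤s z≤n) ⟩
      k + k                    ≡⟨ cong (k ℕ.+_) (sym (ℕₚ.+-identityʳ k)) ⟩
      2 * k                    ≤⟨ ℕₚ.*-mono-≤ (ℕₚ.m≤m+n 2 14) (ℕₚ.≤-trans (ℕₚ.m≤m*n k k) (ℕₚ.m≤m*n (k * k) (k * k))) ⟩
      16 * (k * k * (k * k))   ∎) p-large)
    where open ℕₚ.≤-Reasoning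

  k<p : k < p
  k<p = ℕₚ.m<n⇒m<1+n k<n

  p∤k : ¬ p∣ + k
  p∤k d = ℕₚ.<⇒≱ k<p (ℕd.∣⇒≤ (ℤd.∣⇒∣ᵤ d))

  -- All the variables that are not selected are set equal to w, so that no
  -- constant term arises.
  Specialisation : ∀ {s} → ℕ → Vec ℤ s → Set
  Specialisation m a = ∃[ b ] Units p {m} (lookup b) × ∃[ e ] ∀ (z : Vector ℤ m) w → Units p z → ¬ p∣ w →
    ∃[ y ] Units p y × diagonal k a y ≡ diagonal k b z ℤ.+ e ℤ.* w ^ℤ k

  specialise-skip : ∀ {s m} c {a : Vec ℤ s} → Specialisation m a → Specialisation m (c ∷ a)
  specialise-skip c {a} (b , ub , e , f) = b , ub , c ℤ.+ e , λ z w uz p∤w →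
    let y , uy , eq = f z w uz p∤w in w F.∷ y , units-∷ p∤w uy ,
      trans (cong (λ v → c ℤ.* w ^ℤ k ℤ.+ v) eq)
        (solve 4 (λ c W v e → c :* W :+ (v :+ e :* W) := v :+ (c :+ e) :* W) refl c (w ^ℤ k) (diagonal k b z) e)

  specialise : ∀ {s m} {a : Vec ℤ s} → NonMultiples p m a → Specialisation m a
  specialise {a = []}    none = [] , (λ ()) , + 0 , λ z w us p∤w → (λ ()) , (λ ()) , refl
  specialise {a = c ∷ a} none = specialise-skip c {a = a} (specialise {a = a} none)
  specialise (skip {c = c} {a = a} h) = specialise-skip c {a = a} (specialise h)
  specialise (take {c = c} p∤c h) with b , ub , e , f ← specialise h =
    c ∷ b , (λ { Fin.zero → p∤c ; (Fin.suc j) → ub j }) , e , λ z w uz p∤w →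
      let y , uy , eq = f (λ j → z (Fin.suc j)) w (λ j → uz (Fin.suc j)) p∤w in
      z Fin.zero F.∷ y , units-∷ (uz Fin.zero) uy ,
        trans (cong (λ v → c ℤ.* z Fin.zero ^ℤ k ℤ.+ v) eq)
          (sym (ℤₚ.+-assoc (c ℤ.* z Fin.zero ^ℤ k) (diagonal k b (λ j → z (Fin.suc j))) (e ℤ.* w ^ℤ k)))

  -- If all n units were zeros of bxᵏ + e, this would contradict k < n. The choice of t is what
  -- controls the coefficient of wᵏ, since the unselected coefficients add up to an arbitrary e.
  avoid-zero : ∀ b e → ¬ p∣ b → ∃[ t ] ¬ p∣ b ℤ.* power t ℤ.+ e
  avoid-zero b e p∤b with Finₚ.any? {n} (λ t → ¬? (p∣? (b ℤ.* power t ℤ.+ e)))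
  ... | yes h = h
  ... | no  h = contradiction (begin
      n                                                   ≡⟨ sym (trans (sum-const n 1) (ℕₚ.*-identityʳ n)) ⟩
      sum {n} (λ _ → 1)                                   ≡⟨ sum-cong-≗ {n} (λ t → sym (δ-∣ (all-zero t))) ⟩
      sum {n} (λ t → δ (ℤ.- e ℤ.- b ℤ.* power t))         ≤⟨ count-power b (ℤ.- e) p∤b ⟩
      k                                                   ∎) (ℕₚ.<⇒≱ k<n)
    where
    open ℕₚ.≤-Reasoning
    all-zero : ∀ t → p∣ ℤ.- e ℤ.- b ℤ.* power t
    all-zero t = subst p∣_ (solve 3 (λ e b x → :- (b :* x :+ e) := :- e :- b :* x) refl e b (power t))
      (ℤd.∣m⇒∣-m (decidable-stable (p∣? (b ℤ.* power t ℤ.+ e)) (λ ¬d → h (t , ¬d))))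

  -- Four coefficients b₁, b₂, b₃, e are left after specialisation. Setting the third variable to tw
  -- merges the last two into (b₃tᵏ + e)wᵏ, and t is chosen so that the resulting ternary form has
  -- all coefficients prime to p.
  soluble-mod-p : ∀ {s} {a : Vec ℤ s} → NonMultiples p 3 a → ∃[ y ] Units p y × p∣ diagonal k a y
  soluble-mod-p {a = a} h = go (specialise h)
    where
    go : Specialisation 3 a → ∃[ y ] Units p y × p∣ diagonal k a y
    go (b₁ ∷ b₂ ∷ b₃ ∷ [] , ub , e , f)
      with t , p∤c ← avoid-zero b₃ e (ub (Fin.suc (Fin.suc Fin.zero)))
      with x , y , w , p∤x , p∤y , p∤w , d ← soluble p-large b₁ b₂ (b₃ ℤ.* power t ℤ.+ e) (ub Fin.zero) (ub (Fin.suc Fin.zero)) p∤c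
      with Y , uY , eq ← f (x F.∷ y F.∷ (unit t ℤ.* w) F.∷ F.[]) w
        (units-∷ p∤x (units-∷ p∤y (units-∷ (p∤* (p∤unit t) p∤w) (λ ())))) p∤w =
      Y , uY , subst p∣_ (trans (solve 7 (λ A B C E T W V → (A :+ B) :+ (C :* T :+ E) :* W :=
          (A :+ (B :+ (C :* (T :* W) :+ con (+ 0)))) :+ E :* W) refl
            (b₁ ℤ.* x ^ℤ k) (b₂ ℤ.* y ^ℤ k) b₃ e (power t) (w ^ℤ k) (+ 0))
          (trans (cong (λ v → (b₁ ℤ.* x ^ℤ k ℤ.+ (b₂ ℤ.* y ^ℤ k ℤ.+ (b₃ ℤ.* v ℤ.+ + 0))) ℤ.+ e ℤ.* w ^ℤ k)
              (sym (^ℤ-distrib-* (unit t) w k)))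
            (sym eq))) d

  -- One step of Hensel's lemma, in the first variable whose coefficient is
  -- prime to p.
  lift : ∀ {s} {a : Vec ℤ s} q → p∣ q → NonMultiples p 1 a → ∀ v y → Units p y → q ℤd.∣ v ℤ.- diagonal k a y → Lift p k q a v y
  lift q p∣q (skip {c = c} {a = a} h) v y uy d
    with y′ , y′≡y , d′ ← lift {a = a} q p∣q h (v ℤ.- c ℤ.* y Fin.zero ^ℤ k) (λ j → y (Fin.suc j)) (λ j → uy (Fin.suc j))
      (subst (q ℤd.∣_) (solve 3 (λ v u w → v :- (u :+ w) := (v :- u) :- w) refl v (c ℤ.* y Fin.zero ^ℤ k) (diagonal k a (λ j → y (Fin.suc j)))) d) =
    y Fin.zero F.∷ y′ ,
    (λ { Fin.zero → subst (q ℤd.∣_) (sym (ℤₚ.+-inverseʳ (y Fin.zero))) (ℤd.divides (+ 0) refl) ; (Fin.suc j) → y′≡y j }) ,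
    subst (+ p ℤ.* q ℤd.∣_) (solve 3 (λ v u w → (v :- u) :- w := v :- (u :+ w)) refl v (c ℤ.* y Fin.zero ^ℤ k) (diagonal k a y′)) d′
  -- Only y₀ is changed, to y₀ + tq. If the old difference is wq, the new one is (slope · t + w)q up
  -- to a multiple of q², and p divides q; so t has to solve a linear congruence modulo p. It is
  -- solvable because p divides none of c, k and y₀.
  lift q p∣q (take {c = c} {a = a} p∤c h) v y uy (ℤd.divides w eq) = go (root-of-linear w p∤slope) (binomial K y₀)
    where
    y₀ = y Fin.zero
    rest = diagonal k a (λ j → y (Fin.suc j))
    slope = ℤ.- (c ℤ.* (+ k ℤ.* y₀ ^ℤ K))
    p∤slope : ¬ p∣ slope
    p∤slope e = p∤* p∤c (p∤* p∤k (p∤^ K (uy Fin.zero))) (subst p∣_ (ℤₚ.neg-involutive (c ℤ.* (+ k ℤ.* y₀ ^ℤ K))) (ℤd.∣m⇒∣-m e))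
    go : (∃[ i ] p∣ slope ℤ.* + toℕ {p} i ℤ.+ w) →
         (∀ h → ∃[ r ] (y₀ ℤ.+ h) ^ℤ k ≡ (y₀ ^ℤ k ℤ.+ + k ℤ.* y₀ ^ℤ K ℤ.* h) ℤ.+ h ℤ.* h ℤ.* r) →
         Lift p k q (c ∷ a) v y
    go (i , e) expand with expand (+ toℕ i ℤ.* q)
    ... | r , eq′ = (y₀ ℤ.+ t ℤ.* q) F.∷ (λ j → y (Fin.suc j)) ,
      (λ { Fin.zero → ℤd.divides t (solve 3 (λ y t q → (y :+ t :* q) :- y := t :* q) refl y₀ t q)
         ; (Fin.suc j) → subst (q ℤd.∣_) (sym (ℤₚ.+-inverseʳ (y (Fin.suc j)))) (ℤd.divides (+ 0) refl) }) ,
      subst (+ p ℤ.* q ℤd.∣_) (sym factorisation) (ℤd.*-monoˡ-∣ q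
        (ℤd.∣m∣n⇒∣m-n e (ℤd.∣n⇒∣m*n (c ℤ.* t ℤ.* t ℤ.* r) p∣q)))
      where
      t = + toℕ i
      open ≡-Reasoning
      factorisation : v ℤ.- (c ℤ.* (y₀ ℤ.+ t ℤ.* q) ^ℤ k ℤ.+ rest) ≡ ((slope ℤ.* t ℤ.+ w) ℤ.- c ℤ.* t ℤ.* t ℤ.* r ℤ.* q) ℤ.* q
      factorisation = begin
        v ℤ.- (c ℤ.* (y₀ ℤ.+ t ℤ.* q) ^ℤ k ℤ.+ rest)
          ≡⟨ cong (λ z → v ℤ.- (c ℤ.* z ℤ.+ rest)) eq′ ⟩
        v ℤ.- (c ℤ.* ((y₀ ^ℤ k ℤ.+ + k ℤ.* y₀ ^ℤ K ℤ.* (t ℤ.* q)) ℤ.+ (t ℤ.* q) ℤ.* (t ℤ.* q) ℤ.* r) ℤ.+ rest)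
          ≡⟨ solve 8 (λ v c Y κY t q r R → v :- (c :* ((Y :+ κY :* (t :* q)) :+ (t :* q) :* (t :* q) :* r) :+ R) :=
               (v :- (c :* Y :+ R)) :+ ((:- (c :* κY)) :* t :- c :* t :* t :* r :* q) :* q) refl v c (y₀ ^ℤ k) (+ k ℤ.* y₀ ^ℤ K) t q r rest ⟩
        (v ℤ.- (c ℤ.* y₀ ^ℤ k ℤ.+ rest)) ℤ.+ (slope ℤ.* t ℤ.- c ℤ.* t ℤ.* t ℤ.* r ℤ.* q) ℤ.* q
          ≡⟨ cong (λ z → z ℤ.+ (slope ℤ.* t ℤ.- c ℤ.* t ℤ.* t ℤ.* r ℤ.* q) ℤ.* q) eq ⟩
        w ℤ.* q ℤ.+ (slope ℤ.* t ℤ.- c ℤ.* t ℤ.* t ℤ.* r ℤ.* q) ℤ.* q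
          ≡⟨ solve 4 (λ w q st u → w :* q :+ (st :- u) :* q := ((st :+ w) :- u) :* q) refl w q (slope ℤ.* t) (c ℤ.* t ℤ.* t ℤ.* r ℤ.* q) ⟩
        ((slope ℤ.* t ℤ.+ w) ℤ.- c ℤ.* t ℤ.* t ℤ.* r ℤ.* q) ℤ.* q ∎

-- Integer points in the completions of ℚ

private
  toℚᵘ-/1 : ∀ i → ℚ.toℚᵘ (i / 1) ℚᵘ.≃ ℚᵘ.mkℚᵘ i 0
  toℚᵘ-/1 i = ℚₚ.toℚᵘ-fromℚᵘ (ℚᵘ.mkℚᵘ i 0)

/1-homo-+ : ∀ i j → (i ℤ.+ j) / 1 ≡ i / 1 ℚ.+ j / 1
/1-homo-+ i j = ℚₚ.toℚᵘ-injective (begin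
  ℚ.toℚᵘ ((i ℤ.+ j) / 1)                       ≈⟨ toℚᵘ-/1 (i ℤ.+ j) ⟩
  ℚᵘ.mkℚᵘ (i ℤ.+ j) 0                          ≈⟨ ℚᵘ.*≡* (cong (ℤ._* + 1) (sym (cong₂ ℤ._+_ (ℤₚ.*-identityʳ i) (ℤₚ.*-identityʳ j)))) ⟩
  ℚᵘ.mkℚᵘ i 0 ℚᵘ.+ ℚᵘ.mkℚᵘ j 0                 ≈⟨ ℚᵘₚ.≃-sym (ℚᵘₚ.+-cong (toℚᵘ-/1 i) (toℚᵘ-/1 j)) ⟩
  ℚ.toℚᵘ (i / 1) ℚᵘ.+ ℚ.toℚᵘ (j / 1)           ≈⟨ ℚᵘₚ.≃-sym (ℚₚ.toℚᵘ-homo-+ (i / 1) (j / 1)) ⟩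
  ℚ.toℚᵘ (i / 1 ℚ.+ j / 1)                     ∎)
  where open ℚᵘₚ.≃-Reasoning

/1-homo-* : ∀ i j → (i ℤ.* j) / 1 ≡ (i / 1) ℚ.* (j / 1)
/1-homo-* i j = ℚₚ.toℚᵘ-injective (begin
  ℚ.toℚᵘ ((i ℤ.* j) / 1)                       ≈⟨ toℚᵘ-/1 (i ℤ.* j) ⟩
  ℚᵘ.mkℚᵘ i 0 ℚᵘ.* ℚᵘ.mkℚᵘ j 0                 ≈⟨ ℚᵘₚ.≃-sym (ℚᵘₚ.*-cong (toℚᵘ-/1 i) (toℚᵘ-/1 j)) ⟩
  ℚ.toℚᵘ (i / 1) ℚᵘ.* ℚ.toℚᵘ (j / 1)           ≈⟨ ℚᵘₚ.≃-sym (ℚₚ.toℚᵘ-homo-* (i / 1) (j / 1)) ⟩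
  ℚ.toℚᵘ ((i / 1) ℚ.* (j / 1))                     ∎)
  where open ℚᵘₚ.≃-Reasoning

/1-homo-neg : ∀ i → (ℤ.- i) / 1 ≡ ℚ.- (i / 1)
/1-homo-neg i = ℚₚ.toℚᵘ-injective (begin
  ℚ.toℚᵘ ((ℤ.- i) / 1)      ≈⟨ toℚᵘ-/1 (ℤ.- i) ⟩
  ℚᵘ.- ℚᵘ.mkℚᵘ i 0          ≈⟨ ℚᵘₚ.≃-sym (ℚᵘₚ.-‿cong (toℚᵘ-/1 i)) ⟩
  ℚᵘ.- ℚ.toℚᵘ (i / 1)       ≈⟨ ℚᵘₚ.≃-sym (ℚₚ.toℚᵘ-homo‿- (i / 1)) ⟩
  ℚ.toℚᵘ (ℚ.- (i / 1))      ∎)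
  where open ℚᵘₚ.≃-Reasoning

/1-homo-- : ∀ i j → (i ℤ.- j) / 1 ≡ i / 1 ℚ.- j / 1
/1-homo-- i j = trans (/1-homo-+ i (ℤ.- j)) (cong (λ z → i / 1 ℚ.+ z) (/1-homo-neg j))

/1-mono-< : ∀ {i j} → i ℤ.< j → i / 1 ℚ.< j / 1
/1-mono-< {i} {j} i<j = ℚₚ.toℚᵘ-cancel-< (ℚᵘₚ.<-respˡ-≃ (ℚᵘₚ.≃-sym (toℚᵘ-/1 i)) (ℚᵘₚ.<-respʳ-≃ (ℚᵘₚ.≃-sym (toℚᵘ-/1 j))
  (ℚᵘ.*<* (subst₂ ℤ._<_ (sym (ℤₚ.*-identityʳ i)) (sym (ℤₚ.*-identityʳ j)) i<j))))

/1-mono-≤ : ∀ {i j} → i ℤ.≤ j → i / 1 ℚ.≤ j / 1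
/1-mono-≤ {i} {j} i≤j = ℚₚ.toℚᵘ-cancel-≤ (ℚᵘₚ.≤-respˡ-≃ (ℚᵘₚ.≃-sym (toℚᵘ-/1 i)) (ℚᵘₚ.≤-respʳ-≃ (ℚᵘₚ.≃-sym (toℚᵘ-/1 j))
  (ℚᵘ.*≤* (subst₂ ℤ._≤_ (sym (ℤₚ.*-identityʳ i)) (sym (ℤₚ.*-identityʳ j)) i≤j))))

*-↧ : ∀ q → q ℚ.* (+ ↧ₙ q / 1) ≡ ↥ q / 1
*-↧ q = go q (toℚᵘ-/1 (+ ↧ₙ q)) (toℚᵘ-/1 (↥ q))
  where
  open ℚᵘₚ.≃-Reasoning
  go : ∀ q {r t} → ℚ.toℚᵘ r ℚᵘ.≃ ℚᵘ.mkℚᵘ (+ ↧ₙ q) 0 → ℚ.toℚᵘ t ℚᵘ.≃ ℚᵘ.mkℚᵘ (↥ q) 0 → q ℚ.* r ≡ t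
  go q@(ℚ.mkℚ n d-1 _) {r} {t} r≃ t≃ = ℚₚ.toℚᵘ-injective (begin
    ℚ.toℚᵘ (q ℚ.* r)                             ≈⟨ ℚₚ.toℚᵘ-homo-* q r ⟩
    ℚ.toℚᵘ q ℚᵘ.* ℚ.toℚᵘ r                       ≈⟨ ℚᵘₚ.*-congˡ {ℚ.toℚᵘ q} r≃ ⟩
    ℚᵘ.mkℚᵘ n d-1 ℚᵘ.* ℚᵘ.mkℚᵘ (+ suc d-1) 0     ≈⟨ ℚᵘ.*≡* (trans (ℤₚ.*-identityʳ (n ℤ.* + suc d-1)) (cong (λ d → n ℤ.* + d) (sym (ℕₚ.*-identityʳ (suc d-1))))) ⟩
    ℚᵘ.mkℚᵘ n 0                                  ≈⟨ ℚᵘₚ.≃-sym t≃ ⟩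
    ℚ.toℚᵘ t                                     ∎)

1≤↥ : ∀ q → 0ℚ ℚ.< q → + 1 ℤ.≤ ↥ q
1≤↥ (ℚ.mkℚ (+ suc n) _ _) _           = ℤ.+≤+ (s≤s z≤n)
1≤↥ (ℚ.mkℚ (+ 0) _ _)    (ℚ.*<* 0<0)  = contradiction 0<0 (ℤₚ.<-irrefl refl)
1≤↥ (ℚ.mkℚ -[1+ n ] _ _) (ℚ.*<* ())

n<m^n : ∀ m n → 1 < m → n < m ^ n
n<m^n m zero    1<m = s≤s z≤n
n<m^n m@(suc _) (suc n) 1<m = ℕₚ.≤-<-trans (n<m^n m n 1<m) (subst (m ^ n <_) (ℕₚ.*-comm (m ^ n) m)
  (ℕₚ.m<m*n (m ^ n) m {{ℕₚ.m^n≢0 m n}} 1<m))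

pos-^ : ∀ m v → (+ m) ^ℤ v ≡ + (m ^ v)
pos-^ m zero    = refl
pos-^ m (suc v) = trans (cong (λ z → + m ℤ.* z) (pos-^ m v)) (sym (ℤₚ.pos-* m (m ^ v)))

/1-homo-^ : ∀ z k → (z ^ℤ k) / 1 ≡ (z / 1) ^ℚ k
/1-homo-^ z zero    = refl
/1-homo-^ z (suc k) = trans (/1-homo-* z (z ^ℤ k)) (cong (λ q → (z / 1) ℚ.* q) (/1-homo-^ z k))

-- One argument for ℝ and for every ℚₚ: the ring operations act termwise on sequences, so a form
-- evaluated at sequences of integers is, index by index, an integer value of the form. The integers
-- may vary with the index, as they do in the Hensel sequence.
module IntegerPoints (V : AbsoluteValue) (fromℤ : ℤ → Completion.Point V)
  (seq-fromℤ : ∀ i n → Completion.Point.seq (fromℤ i) n ≡ i / 1) where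
  open AbsoluteValue V using (∣_∣; ∣0∣≡0)
  open Completion V using (Point; seq; rawRing; rawSemiring; 0#) renaming (_≈_ to _≈ᶜ_; _*_ to _*ᶜ_; _^_ to _^ᶜ_)
  open RawSemiringDefs rawSemiring using () renaming (sum to sumᶜ)

  seq-^ : ∀ x z n → seq x n ≡ z / 1 → ∀ k → seq (x ^ᶜ k) n ≡ (z ^ℤ k) / 1
  seq-^ x z n eq zero    = refl
  seq-^ x z n eq (suc k) = trans (cong₂ ℚ._*_ eq (seq-^ x z n eq k)) (sym (/1-homo-* z (z ^ℤ k)))

  seq-sum : ∀ {s} (x : Vector Point s) (y : Vector ℤ s) n → (∀ j → seq (x j) n ≡ y j / 1) → seq (sumᶜ x) n ≡ sumℤ y / 1
  seq-sum {zero}  x y n eq = refl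
  seq-sum {suc s} x y n eq = trans
    (cong₂ ℚ._+_ (eq Fin.zero) (seq-sum (λ j → x (Fin.suc j)) (λ j → y (Fin.suc j)) n (λ j → eq (Fin.suc j))))
    (sym (/1-homo-+ (y Fin.zero) (sumℤ (λ j → y (Fin.suc j)))))

  monomial : ∀ {s} k (a : Vec ℤ s) (x : Vector Point s) → Vector Point s
  monomial k a x j = fromℤ (lookup a j) *ᶜ x j ^ᶜ k

  seq-monomial : ∀ {s} k (a : Vec ℤ s) (x : Vector Point s) (y : Vector ℤ s) n → (∀ j → seq (x j) n ≡ y j / 1) →
    ∀ j → seq (monomial k a x j) n ≡ (lookup a j ℤ.* y j ^ℤ k) / 1
  seq-monomial k a x y n eq j = trans
    (cong₂ ℚ._*_ (seq-fromℤ (lookup a j) n) (seq-^ (x j) (y j) n (eq j) k))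
    (sym (/1-homo-* (lookup a j) (y j ^ℤ k)))

  seq-diagonal : ∀ {s} k (a : Vec ℤ s) (x : Vector Point s) (y : Vector ℤ s) n → (∀ j → seq (x j) n ≡ y j / 1) →
    seq (sumᶜ (monomial k a x)) n ≡ diagonal k a y / 1
  seq-diagonal k a x y n eq = seq-sum (monomial k a x) (λ j → lookup a j ℤ.* y j ^ℤ k) n (seq-monomial k a x y n eq)

  diagonal-solution : ∀ {s} k (a : Vec ℤ s) (x : Vector Point s) → sumᶜ (monomial k a x) ≈ᶜ 0# →
    Diagonal.Solution rawRing fromℤ k a x
  diagonal-solution k a x eq = eq

  seq≡0⇒≈0 : ∀ X → (∀ n → seq X n ≡ 0ℚ) → X ≈ᶜ 0#
  seq≡0⇒≈0 X X≡0 ε ε>0 = 0 , λ n _ → subst (ℚ._< ε)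
    (sym (trans (cong ∣_∣ (trans (ℚₚ.+-identityʳ (seq X n)) (X≡0 n))) ∣0∣≡0)) ε>0

  integer-solution : ∀ {s} k (a : Vec ℤ s) (x : Vector Point s) (y : Vector ℤ s) → (∀ j n → seq (x j) n ≡ y j / 1) →
    diagonal k a y ≡ + 0 → Diagonal.Solution rawRing fromℤ k a x
  integer-solution k a x y x≡y eq = diagonal-solution k a x (seq≡0⇒≈0 (sumᶜ (monomial k a x)) (λ n →
    trans (seq-diagonal k a x y n (λ j → x≡y j n)) (cong (_/ 1) eq)))

module PAdicIntegers (p : ℕ) (p-prime : Prime p) where
  open PAdicAbsoluteValue p p-prime
  private instance
    p-nonZero : ℕ.NonZero p
    p-nonZero = prime⇒nonZero p-prime

  ∣/1∣ₚ : ∀ z .{{_ : ℤ.NonZero z}} → ∣ z / 1 ∣ₚ ≡ π ^ℚ ν ℤ.∣ z ∣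
  ∣/1∣ₚ z = trans (∣∣ₚ-≃ (z / 1) z 1 (cross-mult (z / 1) (toℚᵘ-/1 z)))
    (trans (cong (λ v → π ^ℚ ν ℤ.∣ z ∣ ℚ.* P ^ℚ v) (ν-unique 1 {0} (1 , refl , λ d → ℕ.nonTrivial⇒≢1 {{prime⇒nonTrivial p-prime}} (ℕd.∣1⇒≡1 d))))
      (ℚₚ.*-identityʳ _))

  ∣unit∣ₚ : ∀ z → ¬ (+ p ℤd.∣ z) → ∣ z / 1 ∣ₚ ≡ 1ℚ
  ∣unit∣ₚ z p∤z = trans (∣/1∣ₚ z) (cong (π ^ℚ_) (ν-unique ℤ.∣ z ∣ {0}
      (ℤ.∣ z ∣ , sym (ℕₚ.*-identityˡ ℤ.∣ z ∣) , λ d → p∤z (ℤd.∣ᵤ⇒∣ {+ p} {z} d))))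
    where instance
      z≢0 : ℤ.NonZero z
      z≢0 = ℤ.≢-nonZero {z} λ { refl → p∤z (ℤd.divides (+ 0) refl) }

  ∣multiple∣ₚ : ∀ v z → (+ p) ^ℤ v ℤd.∣ z → ∣ z / 1 ∣ₚ ℚ.≤ π ^ℚ v
  ∣multiple∣ₚ v (+ 0)       d = ℚₚ.<⇒≤ (^-pos v π>0)
  ∣multiple∣ₚ v z@(+ suc m) d = subst (ℚ._≤ π ^ℚ v) (sym (∣/1∣ₚ z)) (π^-antimono {v}
    (pᵛ∣n⇒v≤νn (suc m) (ℤd.∣⇒∣ᵤ {+ (p ^ v)} {z} (subst (ℤd._∣ z) (pos-^ p v) d))))
  ∣multiple∣ₚ v z@(-[1+ m ]) d = subst (ℚ._≤ π ^ℚ v) (sym (∣/1∣ₚ z)) (π^-antimono {v}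
    (pᵛ∣n⇒v≤νn (suc m) (ℤd.∣⇒∣ᵤ {+ (p ^ v)} {z} (subst (ℤd._∣ z) (pos-^ p v) d))))

  -- If d is the denominator of ε, then ε ≥ 1/d > p⁻ᵈ. Hence the denominator of ε serves as a
  -- modulus of convergence.
  π^↧ε<ε : ∀ ε → 0ℚ ℚ.< ε → π ^ℚ ↧ₙ ε ℚ.< ε
  π^↧ε<ε ε ε>0 = begin-strict
    π ^ℚ d                                   ≡⟨ sym (ℚₚ.*-identityˡ (π ^ℚ d)) ⟩
    1ℚ ℚ.* π ^ℚ d                            ≤⟨ ℚₚ.*-monoʳ-≤-nonNeg (π ^ℚ d) {{ℚ.nonNegative (ℚₚ.<⇒≤ (^-pos d π>0))}} 1≤εd ⟩
    ε ℚ.* (+ d / 1) ℚ.* π ^ℚ d               <⟨ ℚₚ.*-monoˡ-<-pos (π ^ℚ d) {{ℚ.positive (^-pos d π>0)}} (ℚₚ.*-monoʳ-<-pos ε {{ℚ.positive ε>0}} d<P^d) ⟩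
    ε ℚ.* P ^ℚ d ℚ.* π ^ℚ d                  ≡⟨ trans (ℚₚ.*-assoc ε (P ^ℚ d) (π ^ℚ d)) (cong (ε ℚ.*_) (trans (ℚₚ.*-comm (P ^ℚ d) (π ^ℚ d)) (π^n*P^n≡1 d))) ⟩
    ε ℚ.* 1ℚ                                 ≡⟨ ℚₚ.*-identityʳ ε ⟩
    ε                                        ∎
    where
    open ℚₚ.≤-Reasoning
    d = ↧ₙ ε
    d<P^d : + d / 1 ℚ.< P ^ℚ d
    d<P^d = subst (+ d / 1 ℚ.<_) (/1-homo-^ (+ p) d) (/1-mono-< (subst (+ d ℤ.<_) (sym (pos-^ p d)) (ℤ.+<+ (n<m^n p d (ℕ.nonTrivial⇒n>1 p {{prime⇒nonTrivial p-prime}})))))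
    1≤εd : 1ℚ ℚ.≤ ε ℚ.* (+ d / 1)
    1≤εd = subst (1ℚ ℚ.≤_) (sym (*-↧ ε)) (/1-mono-≤ (1≤↥ ε ε>0))

-- Hensel lifting to solutions in p-adic units

module HenselSequence (p : ℕ) (p-prime : Prime p) (k : ℕ) {s : ℕ} (a : Vec ℤ s)
  (start : ∃[ y ] Units p y × + p ℤd.∣ diagonal k a y)
  (lift : ∀ q → + p ℤd.∣ q → ∀ y → Units p y → q ℤd.∣ + 0 ℤ.- diagonal k a y → Lift p k q a (+ 0) y) where
  open ModPrime p p-prime
  open PAdicAbsoluteValue p p-prime
  open PAdicIntegers p p-prime
  open PAdic p p-prime using (Point; mkPoint; seq; IsCauchy; ∥_∥; rawSemiring) renaming (_≈_ to _≈ₚ_; 0# to 0ₚ)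
  open RawSemiringDefs rawSemiring using () renaming (sum to sumₚ)
  open IntegerPoints padic (PAdic.fromℤ p p-prime) (λ _ _ → refl)

  -- The precision is one more than the index, so that the sequence starts from a solution modulo p.
  record Approximation (v : ℕ) : Set where
    constructor mkApproximation
    field
      root     : Vector ℤ s
      units    : Units p root
      residual : (+ p) ^ℤ suc v ℤd.∣ diagonal k a root
  open Approximation

  p∣p^suc : ∀ v → p∣ (+ p) ^ℤ suc v
  p∣p^suc v = ℤd.divides ((+ p) ^ℤ v) (ℤₚ.*-comm (+ p) ((+ p) ^ℤ v))

  refine : ∀ {v} → (r : Approximation v) → Lift p k ((+ p) ^ℤ suc v) a (+ 0) (root r)
  refine {v} r = lift ((+ p) ^ℤ suc v) (p∣p^suc v) (root r) (units r)
    (subst ((+ p) ^ℤ suc v ℤd.∣_) (sym (ℤₚ.+-identityˡ _)) (ℤd.∣m⇒∣-m (residual r)))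

  next : ∀ {v} → Approximation v → Approximation (suc v)
  next {v} r = let y′ , y′≡y , d = refine r in mkApproximation y′
    (λ j p∣y′ → units r j (subst p∣_ (ℤ-Solver.solve 2 (λ x y → y ℤ-Solver.:- (y ℤ-Solver.:- x) ℤ-Solver.:= x) refl (root r j) (y′ j))
        (ℤd.∣m∣n⇒∣m-n p∣y′ (ℤd.∣-trans (p∣p^suc v) (y′≡y j)))))
    (subst ((+ p) ^ℤ suc (suc v) ℤd.∣_) (trans (cong ℤ.-_ (ℤₚ.+-identityˡ _)) (ℤₚ.neg-involutive _)) (ℤd.∣m⇒∣-m d))

  approximation : ∀ v → Approximation v
  approximation zero    = let y , uy , d = start in mkApproximation y uy
    (subst (ℤd._∣ diagonal k a y) (sym (ℤₚ.*-identityʳ (+ p))) d)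
  approximation (suc v) = next (approximation v)

  y : ℕ → Vector ℤ s
  y v = root (approximation v)

  consecutive : ∀ v j → (+ p) ^ℤ suc v ℤd.∣ y (suc v) j ℤ.- y v j
  consecutive v j = proj₁ (proj₂ (refine (approximation v))) j

  p^-∣ : ∀ {u v} → u ≤ v → (+ p) ^ℤ u ℤd.∣ (+ p) ^ℤ v
  p^-∣ {u} {v} u≤v = ℤd.divides ((+ p) ^ℤ (v ∸ u)) (trans (cong ((+ p) ^ℤ_) (sym (ℕₚ.m∸n+n≡m u≤v))) (^ℤ-homo-* (+ p) (v ∸ u) u))

  eventually-congruent : ∀ v t j → (+ p) ^ℤ v ℤd.∣ y (t + v) j ℤ.- y v j
  eventually-congruent v zero    j = subst ((+ p) ^ℤ v ℤd.∣_) (sym (ℤₚ.+-inverseʳ (y v j))) (ℤd.divides (+ 0) refl)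
  eventually-congruent v (suc t) j = subst ((+ p) ^ℤ v ℤd.∣_)
    (solve 3 (λ x y z → (x :- y) :+ (y :- z) := x :- z) refl (y (suc t + v) j) (y (t + v) j) (y v j))
    (ℤd.∣m∣n⇒∣m+n (ℤd.∣-trans (p^-∣ (ℕₚ.m≤n⇒m≤1+n (ℕₚ.m≤n+m v t))) (consecutive (t + v) j)) (eventually-congruent v t j))
    where open ℤ-Solver

  congruent : ∀ v {m m′} → v ≤ m → v ≤ m′ → ∀ j → (+ p) ^ℤ v ℤd.∣ y m j ℤ.- y m′ j
  congruent v {m} {m′} v≤m v≤m′ j = subst ((+ p) ^ℤ v ℤd.∣_)
    (solve 3 (λ x y z → (x :- z) :- (y :- z) := x :- y) refl (y m j) (y m′ j) (y v j))
    (ℤd.∣m∣n⇒∣m-n (to-v v≤m) (to-v v≤m′))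
    where
    open ℤ-Solver
    to-v : ∀ {m} → v ≤ m → (+ p) ^ℤ v ℤd.∣ y m j ℤ.- y v j
    to-v {m} v≤m = subst (λ m → (+ p) ^ℤ v ℤd.∣ y m j ℤ.- y v j) (ℕₚ.m∸n+n≡m v≤m) (eventually-congruent v (m ∸ v) j)

  small : ∀ ε → 0ℚ ℚ.< ε → ∀ z → (+ p) ^ℤ ↧ₙ ε ℤd.∣ z → ∣ z / 1 ∣ₚ ℚ.< ε
  small ε ε>0 z d = ℚₚ.≤-<-trans (∣multiple∣ₚ (↧ₙ ε) z d) (π^↧ε<ε ε ε>0)

  x : Vector Point s
  x j = mkPoint (λ v → y v j / 1) λ ε ε>0 → ↧ₙ ε , λ m m′ le le′ →
    subst (λ q → ∣ q ∣ₚ ℚ.< ε) (/1-homo-- (y m j) (y m′ j)) (small ε ε>0 (y m j ℤ.- y m′ j) (congruent (↧ₙ ε) le le′ j))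

  x-unit : ∀ j → ∥ x j ∥ ℝ.≈ ℝ.1#
  x-unit j ε ε>0 = 0 , λ v _ → subst (λ q → ℚ.∣ q ℚ.- 1ℚ ∣ ℚ.< ε) (sym (∣unit∣ₚ (y v j) (units (approximation v) j))) ε>0

  vanishes : ∀ X (z : ℕ → ℤ) → (∀ v → seq X v ≡ z v / 1) → (∀ v → (+ p) ^ℤ suc v ℤd.∣ z v) → X ≈ₚ 0ₚ
  vanishes X z X≡z d ε ε>0 = ↧ₙ ε , λ v le → subst (λ q → ∣ q ∣ₚ ℚ.< ε)
    (sym (trans (ℚₚ.+-identityʳ (seq X v)) (X≡z v)))
    (small ε ε>0 (z v) (ℤd.∣-trans (p^-∣ (ℕₚ.m≤n⇒m≤1+n le)) (d v)))

  x-solution : sumₚ (monomial k a x) ≈ₚ 0ₚ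
  x-solution = vanishes (sumₚ (monomial k a x)) (λ v → diagonal k a (y v))
    (λ v → seq-diagonal k a x (y v) v (λ j → refl)) (λ v → residual (approximation v))

  soluble-in-units : UnitSoluble p p-prime k s a
  soluble-in-units = x , x-unit , diagonal-solution k a x x-solution

-- Local solubility from a solution in primes

module _ {s : ℕ} (k : ℕ) (a : Vec ℤ s) (x : Vector ℕ s) (x-prime : ∀ j → Prime (x j)) (solution : diagonal k a (λ j → + x j) ≡ + 0) where

  positiveRealSoluble : PositiveRealSoluble k s a
  positiveRealSoluble = soluble (λ j → ℝ.fromℕ (x j)) (λ _ _ → refl)
    where
    open IntegerPoints usual ℝ.fromℤ (λ _ _ → refl)
    soluble : (X : Vector ℝ s) → (∀ j n → ℝ.seq (X j) n ≡ + x j / 1) → PositiveRealSoluble k s a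
    soluble X X≡x = X ,
      -- A prime exceeds 1, so 1 itself witnesses positivity.
      (λ j → 1ℚ , ℚₚ.positive⁻¹ 1ℚ , 0 , λ n _ → subst₂ ℚ._<_ (sym (ℚₚ.+-identityˡ 1ℚ)) (sym (X≡x j n))
        (/1-mono-< {+ 1} (ℤ.+<+ (ℕ.nonTrivial⇒n>1 (x j) {{prime⇒nonTrivial (x-prime j)}})))) ,
      integer-solution k a X (λ j → + x j) X≡x solution

  unitSoluble-constant : ∀ p p-prime → (∀ j → ¬ (p ℕd.∣ x j)) → UnitSoluble p p-prime k s a
  unitSoluble-constant p p-prime p∤x = soluble (λ j → fromℤ (+ x j)) (λ _ _ → refl)
    where
    open PAdicIntegers p p-prime
    open PAdicAbsoluteValue p p-prime using (padic; ∣_∣ₚ)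
    open PAdic p p-prime using (Point; seq; fromℤ)
    open IntegerPoints padic fromℤ (λ _ _ → refl)
    soluble : (X : Vector Point s) → (∀ j n → seq (X j) n ≡ + x j / 1) → UnitSoluble p p-prime k s a
    soluble X X≡x = X ,
      (λ j ε ε>0 → 0 , λ n _ → subst (λ q → ℚ.∣ q ℚ.- 1ℚ ∣ ℚ.< ε)
        (sym (trans (cong ∣_∣ₚ (X≡x j n)) (∣unit∣ₚ (+ x j) (λ d → p∤x j (ℤd.∣⇒∣ᵤ d))))) ε>0) ,
      integer-solution k a X (λ j → + x j) X≡x solution

threshold : ℕ → ℕ
threshold k = 16 * (k * k * (k * k))

unitSoluble-large : ∀ {s} K (a : Vec ℤ s) p p-prime → threshold (suc K) < p → NonMultiples p 3 a → UnitSoluble p p-prime (suc K) s a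
unitSoluble-large K a zero    p-prime p-large h = contradiction p-prime ¬prime[0]
unitSoluble-large K a (suc n) p-prime p-large h = HenselSequence.soluble-in-units (suc n) p-prime (suc K) a (soluble-mod-p h)
  (λ q p∣q → lift q p∣q (nonMultiples-pred (nonMultiples-pred h)) (+ 0))
  where open Local n p-prime K p-large

prime-solution⇒𝒞′ : ∀ {s} K (a : Vec ℤ s) (x : Vector ℕ s) → (∀ j → Prime (x j)) → diagonal (suc K) a (λ j → + x j) ≡ + 0 →
  (∀ j → threshold (suc K) < x j × NonMultiples (x j) 3 a) → 𝒞′ (suc K) s a
prime-solution⇒𝒞′ {s} K a x x-prime solution good =
  positiveRealSoluble (suc K) a x x-prime solution , λ p p-prime → local p p-prime (Finₚ.any? (λ j → x j ℕₚ.≟ p))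
  where
  local : ∀ p p-prime → Dec (∃[ j ] x j ≡ p) → UnitSoluble p p-prime (suc K) s a
  local p p-prime (yes (j , eq)) = unitSoluble-large K a p p-prime
    (subst (threshold (suc K) <_) eq (proj₁ (good j))) (subst (λ p → NonMultiples p 3 a) eq (proj₂ (good j)))
  local p p-prime (no p≢x)       = unitSoluble-constant (suc K) a x x-prime solution p p-prime p∤x
    where
    p∤x : ∀ j → ¬ (p ℕd.∣ x j)
    p∤x j p∣xj with prime⇒irreducible (x-prime j) p∣xj
    ... | inj₁ refl  = ¬prime[1] p-prime
    ... | inj₂ refl  = p≢x (j , refl)

-- Tuples with few entries prime to p

-- All counting rests on this pigeonhole principle. The covering list `ys` may repeat elements, so
-- overlapping covers can simply be concatenated.
unique-⊆⇒length-≤ : ∀ {A : Set} {xs : List A} (ys : List A) → Unique xs → (∀ {x} → x ∈ xs → x ∈ ys) → length xs ≤ length ys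
unique-⊆⇒length-≤ {xs = []}     ys _         xs⊆ys = z≤n
unique-⊆⇒length-≤ {xs = x ∷ xs} ys (x∉ ∷ uq) xs⊆ys with us , vs , refl ← ∈-∃++ (xs⊆ys (here refl)) = begin
  suc (length xs)                    ≤⟨ s≤s (unique-⊆⇒length-≤ (us ++ vs) uq avoid) ⟩
  suc (length (us ++ vs))            ≡⟨ cong suc (Listₚ.length-++ us) ⟩
  suc (length us + length vs)        ≡⟨ sym (ℕₚ.+-suc (length us) (length vs)) ⟩
  length us + length (x ∷ vs)        ≡⟨ sym (Listₚ.length-++ us) ⟩
  length (us ++ x ∷ vs)              ∎
  where
  open ℕₚ.≤-Reasoning
  avoid : ∀ {z} → z ∈ xs → z ∈ us ++ vs
  avoid z∈xs with ∈-++⁻ us (xs⊆ys (there z∈xs))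
  ... | inj₁ z∈us          = ∈-++⁺ˡ z∈us
  ... | inj₂ (here refl)   = contradiction refl (ListAll.lookup x∉ z∈xs)
  ... | inj₂ (there z∈vs)  = ∈-++⁺ʳ us z∈vs

length-cartesianProductWith : ∀ {A B C : Set} (f : A → B → C) xs ys → length (cartesianProductWith f xs ys) ≡ length xs * length ys
length-cartesianProductWith f []       ys = refl
length-cartesianProductWith f (x ∷ xs) ys = trans (Listₚ.length-++ (map (f x) ys))
  (cong₂ _+_ (Listₚ.length-map (f x) ys) (length-cartesianProductWith f xs ys))

length-filter-split : ∀ {A : Set} {P : A → Set} (P? : ∀ x → Dec (P x)) xs →
                      length (filter P? xs) + length (filter (λ x → ¬? (P? x)) xs) ≡ length xs
length-filter-split P? []       = refl
length-filter-split P? (x ∷ xs) with P? x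
... | yes _ = cong suc (length-filter-split P? xs)
... | no  _ = trans (ℕₚ.+-suc _ _) (cong suc (length-filter-split P? xs))

interval : ℕ → List ℤ
interval B = map (λ n → + n) (upTo (suc B)) ++ map (λ n → -[1+ n ]) (upTo B)

∈-interval : ∀ {i B} → ℤ.∣ i ∣ ≤ B → i ∈ interval B
∈-interval {+ n}       n≤B = ∈-++⁺ˡ (∈-map⁺ (λ n → + n) (∈-upTo⁺ (s≤s n≤B)))
∈-interval { -[1+ n ]} {B} n<B = ∈-++⁺ʳ (map (λ n → + n) (upTo (suc B))) (∈-map⁺ (λ n → -[1+ n ]) (∈-upTo⁺ n<B))

length-interval : ∀ {B} → 1 ≤ B → length (interval B) ≤ 3 * B
length-interval {B} 1≤B = begin
  length (interval B)                    ≡⟨ Listₚ.length-++ (map (λ n → + n) (upTo (suc B))) ⟩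
  length (map (λ n → + n) (upTo (suc B))) + length (map (λ n → -[1+ n ]) (upTo B))
    ≡⟨ cong₂ _+_ (trans (Listₚ.length-map _ (upTo (suc B))) (Listₚ.length-upTo (suc B)))
                 (trans (Listₚ.length-map _ (upTo B)) (Listₚ.length-upTo B)) ⟩
  1 + B + B                              ≤⟨ ℕₚ.+-monoˡ-≤ B (ℕₚ.+-monoˡ-≤ B 1≤B) ⟩
  B + B + B                              ≡⟨ solve 1 (λ B → B :+ B :+ B := con 3 :* B) refl B ⟩
  3 * B                                  ∎
  where
  open ℕₚ.≤-Reasoning
  open ℕ-Solver

m*n≤o⇒m≤o/n : ∀ m n {o} .{{_ : ℕ.NonZero n}} → m * n ≤ o → m ≤ o ℕm./ n
m*n≤o⇒m≤o/n m n mn≤o = subst (_≤ _) (ℕm.m*n/n≡m m n) (ℕm./-monoˡ-≤ n mn≤o)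

multiples : ∀ p .{{_ : ℕ.NonZero p}} → ℕ → List ℤ
multiples p B = map (ℤ._* + p) (interval (B ℕm./ p))

∈-multiples : ∀ p B i .{{_ : ℕ.NonZero p}} → + p ℤd.∣ i → ℤ.∣ i ∣ ≤ B → i ∈ multiples p B
∈-multiples p B _ (ℤd.divides q refl) ∣qp∣≤B = ∈-map⁺ (ℤ._* + p) (∈-interval {q} (m*n≤o⇒m≤o/n ℤ.∣ q ∣ p (subst (_≤ B) (ℤₚ.abs-* q (+ p)) ∣qp∣≤B)))

-- All tuples in the box |aⱼ| ≤ B with at most c entries prime to p.
sparse : ∀ p .{{_ : ℕ.NonZero p}} → ℕ → ∀ s → ℕ → List (Vec ℤ s)
sparse p B zero    c       = [] ∷ []
sparse p B (suc s) zero    = cartesianProductWith _∷_ (multiples p B) (sparse p B s zero)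
sparse p B (suc s) (suc c) = cartesianProductWith _∷_ (multiples p B) (sparse p B s (suc c)) ++
                             cartesianProductWith _∷_ (interval B) (sparse p B s c)

∣head∣≤ : ∀ {s B} i (a : Vec ℤ s) → height (i ∷ a) ≤ B → ℤ.∣ i ∣ ≤ B
∣head∣≤ i a = ℕₚ.m⊔n≤o⇒m≤o ℤ.∣ i ∣ (height a)

height-tail≤ : ∀ {s B} i (a : Vec ℤ s) → height (i ∷ a) ≤ B → height a ≤ B
height-tail≤ i a = ℕₚ.m⊔n≤o⇒n≤o ℤ.∣ i ∣ (height a)

∈-sparse : ∀ {p B s} .{{_ : ℕ.NonZero p}} c (a : Vec ℤ s) → height a ≤ B → ¬ NonMultiples p (suc c) a → a ∈ sparse p B s c
∈-sparse c [] _ _ = here refl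
∈-sparse {p} {B} zero (i ∷ a) h≤B ¬h with + p ℤd.∣? i
... | yes d = ∈-cartesianProductWith⁺ _∷_ (∈-multiples p B i d (∣head∣≤ i a h≤B)) (∈-sparse zero a (height-tail≤ i a h≤B) (¬h ∘ skip))
... | no ¬d = contradiction (take ¬d none) ¬h
∈-sparse {p} {B} (suc c) (i ∷ a) h≤B ¬h with + p ℤd.∣? i
... | yes d = ∈-++⁺ˡ (∈-cartesianProductWith⁺ _∷_ (∈-multiples p B i d (∣head∣≤ i a h≤B)) (∈-sparse (suc c) a (height-tail≤ i a h≤B) (¬h ∘ skip)))
... | no ¬d = ∈-++⁺ʳ (cartesianProductWith _∷_ (multiples p B) (sparse p B _ (suc c)))
  (∈-cartesianProductWith⁺ _∷_ (∈-interval (∣head∣≤ i a h≤B)) (∈-sparse c a (height-tail≤ i a h≤B) (¬h ∘ take ¬d)))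

length-multiples : ∀ {p B} .{{_ : ℕ.NonZero p}} → p ≤ B → length (multiples p B) ≤ 3 * (B ℕm./ p)
length-multiples {p} {B} p≤B = ℕₚ.≤-trans (ℕₚ.≤-reflexive (Listₚ.length-map _ (interval (B ℕm./ p)))) (length-interval (ℕm.m≥n⇒m/n>0 p≤B))

-- With M = ⌊B/p⌋ this is the bound 6ˢM^(s-c)Bᶜ, without subtraction in the exponent. An entry has
-- at most 3M or 3B values, and the choice between the two kinds turns 3 into 6.
length-sparse : ∀ {p B} .{{_ : ℕ.NonZero p}} → p ≤ B → ∀ s c →
                length (sparse p B s c) * (B ℕm./ p) ^ c ≤ 6 ^ s * (B ℕm./ p) ^ s * B ^ c
length-sparse {p} {B} p≤B zero c = ℕₚ.+-monoˡ-≤ 0 (ℕₚ.^-monoˡ-≤ c (ℕm.m/n≤m B p))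
length-sparse {p} {B} p≤B (suc s) zero = begin
  length (sparse p B (suc s) 0) * 1     ≡⟨ cong (_* 1) (length-cartesianProductWith _∷_ (multiples p B) (sparse p B s 0)) ⟩
  length (multiples p B) * ℓ * 1        ≤⟨ ℕₚ.*-monoˡ-≤ 1 (ℕₚ.*-monoˡ-≤ ℓ (ℕₚ.≤-trans (length-multiples p≤B) (ℕₚ.*-monoˡ-≤ M (ℕₚ.m≤m+n 3 3)))) ⟩
  6 * M * ℓ * 1                         ≡⟨ solve 2 (λ M l → con 6 :* M :* l :* con 1 := con 6 :* M :* (l :* con 1)) refl M ℓ ⟩
  6 * M * (ℓ * 1)                       ≤⟨ ℕₚ.*-monoʳ-≤ (6 * M) (length-sparse p≤B s 0) ⟩
  6 * M * (6 ^ s * M ^ s * 1)           ≡⟨ solve 3 (λ M x y → con 6 :* M :* (x :* y :* con 1) := con 6 :* x :* (M :* y) :* con 1) refl M (6 ^ s) (M ^ s) ⟩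
  6 ^ suc s * M ^ suc s * 1             ∎
  where
  open ℕₚ.≤-Reasoning
  open ℕ-Solver
  M = B ℕm./ p
  ℓ = length (sparse p B s 0)
length-sparse {p} {B} p≤B (suc s) (suc c) = begin
  length (sparse p B (suc s) (suc c)) * (M * M ^ c)
    ≡⟨ cong (_* (M * M ^ c)) (trans (Listₚ.length-++ (cartesianProductWith _∷_ (multiples p B) (sparse p B s (suc c))))
         (cong₂ _+_ (length-cartesianProductWith _∷_ (multiples p B) (sparse p B s (suc c))) (length-cartesianProductWith _∷_ (interval B) (sparse p B s c)))) ⟩
  (length (multiples p B) * ℓ₁ + length (interval B) * ℓ₀) * (M * M ^ c)
    ≤⟨ ℕₚ.*-monoˡ-≤ (M * M ^ c) (ℕₚ.+-mono-≤ (ℕₚ.*-monoˡ-≤ ℓ₁ (length-multiples p≤B)) (ℕₚ.*-monoˡ-≤ ℓ₀ (length-interval 1≤B))) ⟩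
  (3 * M * ℓ₁ + 3 * B * ℓ₀) * (M * M ^ c)
    ≡⟨ solve 5 (λ M B l₁ l₀ Mc → (con 3 :* M :* l₁ :+ con 3 :* B :* l₀) :* (M :* Mc) :=
         con 3 :* M :* (l₁ :* (M :* Mc)) :+ con 3 :* B :* M :* (l₀ :* Mc)) refl M B ℓ₁ ℓ₀ (M ^ c) ⟩
  3 * M * (ℓ₁ * M ^ suc c) + 3 * B * M * (ℓ₀ * M ^ c)
    ≤⟨ ℕₚ.+-mono-≤ (ℕₚ.*-monoʳ-≤ (3 * M) (length-sparse p≤B s (suc c))) (ℕₚ.*-monoʳ-≤ (3 * B * M) (length-sparse p≤B s c)) ⟩
  3 * M * (6 ^ s * M ^ s * (B * B ^ c)) + 3 * B * M * (6 ^ s * M ^ s * B ^ c)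
    ≡⟨ solve 5 (λ M B x y Bc → con 3 :* M :* (x :* y :* (B :* Bc)) :+ con 3 :* B :* M :* (x :* y :* Bc) :=
         con 6 :* x :* (M :* y) :* (B :* Bc)) refl M B (6 ^ s) (M ^ s) (B ^ c) ⟩
  6 ^ suc s * M ^ suc s * B ^ suc c ∎
  where
  open ℕₚ.≤-Reasoning
  open ℕ-Solver
  M = B ℕm./ p
  ℓ₁ = length (sparse p B s (suc c))
  ℓ₀ = length (sparse p B s c)
  1≤B : 1 ≤ B
  1≤B = ℕₚ.≤-trans (ℕ.>-nonZero⁻¹ p) p≤B

-- Σ ⌊B/m⌋^t over q < m ≤ q + n.
quotientSum : ℕ → ℕ → ℕ → ℕ → ℕ
quotientSum B t q zero    = 0
quotientSum B t q (suc n) = (B ℕm./ suc q) ^ t + quotientSum B t (suc q) n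

quotientSum-+ : ∀ B t q m n → quotientSum B t q (m + n) ≡ quotientSum B t q m + quotientSum B t (q + m) n
quotientSum-+ B t q zero    n = cong (λ q → quotientSum B t q n) (sym (ℕₚ.+-identityʳ q))
quotientSum-+ B t q (suc m) n = begin
  x + quotientSum B t (suc q) (m + n)                                       ≡⟨ cong (x ℕ.+_) (quotientSum-+ B t (suc q) m n) ⟩
  x + (quotientSum B t (suc q) m + quotientSum B t (suc q + m) n)           ≡⟨ sym (ℕₚ.+-assoc x _ _) ⟩
  x + quotientSum B t (suc q) m + quotientSum B t (suc q + m) n             ≡⟨ cong (λ r → x + quotientSum B t (suc q) m + quotientSum B t r n) (sym (ℕₚ.+-suc q m)) ⟩
  x + quotientSum B t (suc q) m + quotientSum B t (q + suc m) n             ∎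
  where
  open ≡-Reasoning
  x = (B ℕm./ suc q) ^ t

quotientSum-≤ : ∀ B t q r n → q ≤ r → quotientSum B t r n ≤ n * (B ℕm./ suc q) ^ t
quotientSum-≤ B t q r zero    q≤r = z≤n
quotientSum-≤ B t q r (suc n) q≤r = ℕₚ.+-mono-≤ (ℕₚ.^-monoˡ-≤ t (ℕm./-monoʳ-≤ B (s≤s q≤r))) (quotientSum-≤ B t q (suc r) n (ℕₚ.m≤n⇒m≤1+n q≤r))

^-distribʳ-* : ∀ k m n → (m * n) ^ k ≡ m ^ k * n ^ k
^-distribʳ-* zero    m n = refl
^-distribʳ-* (suc k) m n = trans (cong (m * n *_) (^-distribʳ-* k m n)) (ℕₚ.[m*n]*[o*p]≡[m*o]*[n*p] m n (m ^ k) (n ^ k))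

0^n≡0 : ∀ n .{{_ : ℕ.NonZero n}} → 0 ^ n ≡ 0
0^n≡0 (suc n) = refl

-- Counts are estimated through d-th powers, because the exponent of B is a fraction with
-- denominator d. A count split into two parts is at most twice the larger one, which costs the
-- factor 2 ^ d.
[m+n]^d≤ : ∀ d m n {o} → 2 ^ d * m ^ d ≤ o → 2 ^ d * n ^ d ≤ o → (m + n) ^ d ≤ o
[m+n]^d≤ d m n {o} m≤ n≤ with ℕₚ.≤-total m n
... | inj₁ m≤n = begin
  (m + n) ^ d      ≤⟨ ℕₚ.^-monoˡ-≤ d (ℕₚ.+-mono-≤ m≤n (ℕₚ.≤-reflexive (sym (ℕₚ.+-identityʳ n)))) ⟩
  (2 * n) ^ d      ≡⟨ ^-distribʳ-* d 2 n ⟩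
  2 ^ d * n ^ d    ≤⟨ n≤ ⟩
  o                ∎
  where open ℕₚ.≤-Reasoning
... | inj₂ n≤m = begin
  (m + n) ^ d      ≤⟨ ℕₚ.^-monoˡ-≤ d (ℕₚ.+-monoʳ-≤ m (ℕₚ.≤-trans n≤m (ℕₚ.≤-reflexive (sym (ℕₚ.+-identityʳ m))))) ⟩
  (2 * m) ^ d      ≡⟨ ^-distribʳ-* d 2 m ⟩
  2 ^ d * m ^ d    ≤⟨ m≤ ⟩
  o                ∎
  where open ℕₚ.≤-Reasoning

private
  first-block : ∀ B u q n → n ≤ suc q → suc q ^ suc u * quotientSum B (2 + u) q n ≤ B ^ (2 + u)
  first-block B u q n n≤T = begin
    T ^ suc u * quotientSum B t q n            ≤⟨ ℕₚ.*-monoʳ-≤ (T ^ suc u) (quotientSum-≤ B t q q n ℕₚ.≤-refl) ⟩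
    T ^ suc u * (n * M ^ t)                    ≤⟨ ℕₚ.*-monoʳ-≤ (T ^ suc u) (ℕₚ.*-monoˡ-≤ (M ^ t) n≤T) ⟩
    T ^ suc u * (T * M ^ t)                    ≡⟨ trans (sym (ℕₚ.*-assoc (T ^ suc u) T (M ^ t))) (trans (cong (_* M ^ t) (ℕₚ.*-comm (T ^ suc u) T)) (ℕₚ.*-comm (T ^ t) (M ^ t))) ⟩
    M ^ t * T ^ t                              ≡⟨ sym (^-distribʳ-* t M T) ⟩
    (M * T) ^ t                                ≤⟨ ℕₚ.^-monoˡ-≤ t (ℕm.m/n*n≤m B T) ⟩
    B ^ t                                      ∎
    where
    open ℕₚ.≤-Reasoning
    T = suc q
    t = 2 + u
    M = B ℕm./ T

-- Dyadic decomposition of the range: by induction the tail beyond 2T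
-- contributes at most half of the bound.
quotientSum-bound : ∀ B u q n → suc q ^ suc u * quotientSum B (2 + u) q n ≤ 2 * B ^ (2 + u)
quotientSum-bound B u q n = go n q n ℕₚ.≤-refl
  where
  open ℕₚ.≤-Reasoning
  t = 2 + u
  go : ∀ fuel q n → n ≤ fuel → suc q ^ suc u * quotientSum B t q n ≤ 2 * B ^ t
  go fuel q n n≤fuel with n ℕₚ.≤? suc q
  ... | yes n≤T = ℕₚ.≤-trans (first-block B u q n n≤T) (ℕₚ.m≤n*m (B ^ t) 2)
  go zero       q n n≤0     | no n≰T = contradiction (ℕₚ.≤-trans n≤0 z≤n) n≰T
  go (suc fuel) q n n≤1+fuel | no n≰T = begin
    T ^ suc u * quotientSum B t q n
      ≡⟨ cong (λ n → T ^ suc u * quotientSum B t q n) (sym (ℕₚ.m+[n∸m]≡n T≤n)) ⟩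
    T ^ suc u * quotientSum B t q (T + n′)
      ≡⟨ trans (cong (T ^ suc u *_) (quotientSum-+ B t q T n′)) (ℕₚ.*-distribˡ-+ (T ^ suc u) (quotientSum B t q T) (quotientSum B t (q + T) n′)) ⟩
    T ^ suc u * quotientSum B t q T + T ^ suc u * R
      ≤⟨ ℕₚ.+-mono-≤ (first-block B u q T ℕₚ.≤-refl) (ℕₚ.*-cancelˡ-≤ 2 tail) ⟩
    B ^ t + B ^ t
      ≡⟨ cong (B ^ t ℕ.+_) (sym (ℕₚ.+-identityʳ (B ^ t))) ⟩
    2 * B ^ t ∎
    where
    T = suc q
    T≤n = ℕₚ.<⇒≤ (ℕₚ.≰⇒> n≰T)
    n′ = n ∸ T
    R = quotientSum B t (q + T) n′
    n′≤fuel : n′ ≤ fuel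
    n′≤fuel = ℕₚ.≤-trans (ℕₚ.∸-mono n≤1+fuel (s≤s (z≤n {q}))) ℕₚ.≤-refl
    -- The tail starts at 2T, so its bound carries the factor 2 ^ suc u, which is at least 2. For t
    -- = 1, that is s = 3, the sum would be harmonic and nothing would be gained.
    tail : 2 * (T ^ suc u * R) ≤ 2 * B ^ t
    tail = begin
      2 * (T ^ suc u * R)                ≡⟨ sym (ℕₚ.*-assoc 2 (T ^ suc u) R) ⟩
      2 * T ^ suc u * R                  ≤⟨ ℕₚ.*-monoˡ-≤ R (ℕₚ.*-monoˡ-≤ (T ^ suc u) (ℕₚ.m≤m*n 2 (2 ^ u) {{ℕₚ.m^n≢0 2 u}})) ⟩
      2 ^ suc u * T ^ suc u * R          ≡⟨ cong (_* R) (sym (^-distribʳ-* (suc u) 2 T)) ⟩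
      (2 * T) ^ suc u * R                ≡⟨ cong (λ v → v ^ suc u * R) (cong (T ℕ.+_) (ℕₚ.+-identityʳ T)) ⟩
      suc (q + T) ^ suc u * R            ≤⟨ go fuel (q + T) n′ n′≤fuel ⟩
      2 * B ^ t                          ∎

-- The tuples in the box that have at most two entries prime to some m with
-- q < m ≤ q + n.
cover : ℕ → ∀ s → ℕ → ℕ → List (Vec ℤ s)
cover B s q zero    = []
cover B s q (suc n) = sparse (suc q) B s 2 ++ cover B s (suc q) n

∈-cover : ∀ B {s} (a : Vec ℤ s) q n m → height a ≤ B → q < m → m ≤ q + n → ¬ NonMultiples m 3 a → a ∈ cover B s q n
∈-cover B a q zero    m h≤B q<m m≤ ¬h = contradiction (subst (m ≤_) (ℕₚ.+-identityʳ q) m≤) (ℕₚ.<⇒≱ q<m)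
∈-cover B a q (suc n) m h≤B q<m m≤ ¬h with m ℕₚ.≟ suc q
... | yes refl = ∈-++⁺ˡ (∈-sparse 2 a h≤B ¬h)
... | no  m≢q  = ∈-++⁺ʳ (sparse (suc q) B _ 2) (∈-cover B a (suc q) n m h≤B (ℕₚ.≤∧≢⇒< q<m (m≢q ∘ sym)) (subst (m ≤_) (ℕₚ.+-suc q n) m≤) ¬h)

length-cover : ∀ B t q n → q + n ≤ B → length (cover B (2 + t) q n) ≤ 6 ^ (2 + t) * B ^ 2 * quotientSum B t q n
length-cover B t q zero    _   = z≤n
length-cover B t q (suc n) le = begin
  length (sparse T B s 2 ++ cover B s T n)               ≡⟨ Listₚ.length-++ (sparse T B s 2) ⟩
  length (sparse T B s 2) + length (cover B s T n)       ≤⟨ ℕₚ.+-mono-≤ here-bound (length-cover B t T n (subst (_≤ B) (ℕₚ.+-suc q n) le)) ⟩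
  κ * M ^ t + κ * quotientSum B t T n                    ≡⟨ sym (ℕₚ.*-distribˡ-+ κ (M ^ t) (quotientSum B t T n)) ⟩
  κ * (M ^ t + quotientSum B t T n)                      ∎
  where
  open ℕₚ.≤-Reasoning
  open ℕ-Solver
  T = suc q
  s = 2 + t
  M = B ℕm./ T
  κ = 6 ^ s * B ^ 2
  T≤B : T ≤ B
  T≤B = ℕₚ.≤-trans (ℕₚ.≤-trans (s≤s (ℕₚ.m≤m+n q n)) (ℕₚ.≤-reflexive (sym (ℕₚ.+-suc q n)))) le
  here-bound : length (sparse T B s 2) ≤ κ * M ^ t
  here-bound = ℕₚ.*-cancelʳ-≤ _ _ (M ^ 2) {{ℕₚ.m^n≢0 M 2 {{ℕ.>-nonZero (ℕm.m≥n⇒m/n>0 T≤B)}}}} (begin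
    length (sparse T B s 2) * M ^ 2     ≤⟨ length-sparse T≤B s 2 ⟩
    6 ^ s * M ^ s * B ^ 2               ≡⟨ solve 4 (λ x M Mt B → x :* (M :* (M :* Mt)) :* B := x :* B :* Mt :* (M :* (M :* con 1))) refl (6 ^ s) M (M ^ t) (B ^ 2) ⟩
    κ * M ^ t * M ^ 2                   ∎)

-- Summed over m ≥ T, the quantity B²(B/m)^(s-2) has order BˢT^(3-s). This is the source of the
-- exponent s - 3, here `suc u`.
length-cover-bound : ∀ B u q n → q + n ≤ B → length (cover B (4 + u) q n) * suc q ^ suc u ≤ 2 * 6 ^ (4 + u) * B ^ (4 + u)
length-cover-bound B u q n le = begin
  length (cover B (4 + u) q n) * T ^ suc u
    ≤⟨ ℕₚ.*-monoˡ-≤ (T ^ suc u) (length-cover B (2 + u) q n le) ⟩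
  6 ^ (4 + u) * B ^ 2 * quotientSum B (2 + u) q n * T ^ suc u
    ≡⟨ solve 3 (λ x y z → x :* y :* z := x :* (z :* y)) refl (6 ^ (4 + u) * B ^ 2) (quotientSum B (2 + u) q n) (T ^ suc u) ⟩
  6 ^ (4 + u) * B ^ 2 * (T ^ suc u * quotientSum B (2 + u) q n)
    ≤⟨ ℕₚ.*-monoʳ-≤ (6 ^ (4 + u) * B ^ 2) (quotientSum-bound B u q n) ⟩
  6 ^ (4 + u) * B ^ 2 * (2 * B ^ (2 + u))
    ≡⟨ solve 3 (λ x B y → x :* (B :* (B :* con 1)) :* (con 2 :* y) := con 2 :* x :* (B :* (B :* y))) refl (6 ^ (4 + u)) B (B ^ (2 + u)) ⟩
  2 * 6 ^ (4 + u) * B ^ (4 + u) ∎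
  where
  open ℕₚ.≤-Reasoning
  open ℕ-Solver
  T = suc q

-- The tuples that are not controlled by local solubility at m, where m
-- exceeds |𝐚|^(n/d).
Bad : ℕ → ℕ → ∀ {s} → Vec ℤ s → Set
Bad n d a = AllNonZero a × ∃[ m ] height a ^ n < m ^ d × ¬ NonMultiples m 3 a

-- Fewer than s entries escape divisibility by m, so m divides some entry, which is nonzero. This
-- confines the moduli m to the range up to |𝐚|, where they can be covered.
¬nonMultiples⇒≤height : ∀ {m s} c (a : Vec ℤ s) → c < s → AllNonZero a → ¬ NonMultiples m (suc c) a → m ≤ height a
¬nonMultiples⇒≤height {m} c (i ∷ a) c<s (i≢0 ∷ nz) ¬h with + m ℤd.∣? i
... | yes d = ℕₚ.≤-trans (ℕd.∣⇒≤ {{ℤ.≢-nonZero i≢0}} (ℤd.∣⇒∣ᵤ d)) (ℕₚ.m≤m⊔n ℤ.∣ i ∣ (height a))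
¬nonMultiples⇒≤height zero    (i ∷ a) c<s       (i≢0 ∷ nz) ¬h | no ¬d = contradiction (take ¬d none) ¬h
¬nonMultiples⇒≤height (suc c) (i ∷ a) (s≤s c<s) (i≢0 ∷ nz) ¬h | no ¬d =
  ℕₚ.≤-trans (¬nonMultiples⇒≤height c a c<s nz (¬h ∘ take ¬d)) (ℕₚ.m≤n⊔m ℤ.∣ i ∣ (height a))

least : ∀ {P : ℕ → Set} → (∀ n → Dec (P n)) → ∀ n → P n → ∃[ m ] P m × (∀ k → P k → m ≤ k)
least P? zero    p0 = zero , p0 , λ _ _ → z≤n
least {P} P? (suc n) pn with P? zero
... | yes p0 = zero , p0 , λ _ _ → z≤n
... | no ¬p0 with m , pm , min ← least (P? ∘ suc) n pn = suc m , pm , λ where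
      zero    pk → contradiction pk ¬p0
      (suc k) pk → s≤s (min k pk)

-- Dyadic counting of bad tuples

module DyadicCount (u n d : ℕ) .{{_ : ℕ.NonZero d}} (n≤d : n ≤ d) where
  s v E : ℕ
  s = 4 + u
  v = suc u
  -- The factor 2 ^ v turns T ^ v into (2T) ^ v; the rest is the constant of `length-cover-bound`.
  E = 2 ^ v * (2 * 6 ^ s)

  -- Dyadic blocks are needed because m is bounded below in terms of |𝐚| and not of B. For B/2 < |𝐚|
  -- ≤ B one has Bⁿ < (2m)ᵈ, where n ≤ d absorbs the loss of 2ⁿ. The least T with Bⁿ < (2T)ᵈ then
  -- bounds all these m from below and replaces the real number B^(n/d)/2.
  block : ∀ B (as : List (Vec ℤ s)) → Unique as →
          ListAll.All (λ a → height a ≤ B × B < 2 * height a × Bad n d a) as →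
          length as ^ d * B ^ (n * v) ≤ E ^ d * B ^ (s * d)
  block B []         uq all = ℕₚ.≤-trans (ℕₚ.≤-reflexive (cong (_* B ^ (n * v)) (0^n≡0 d))) z≤n
  block B as@(a₀ ∷ _) uq all@((h₀≤B , B<2h₀ , nz₀ , m₀ , h₀<m₀ , ¬h₀) ∷ _) =
    bound (least (λ m → B ^ n ℕₚ.<? (2 * m) ^ d) m₀ (far a₀ m₀ B<2h₀ h₀<m₀))
    where
    open ℕₚ.≤-Reasoning
    far : ∀ a m → B < 2 * height a → height a ^ n < m ^ d → B ^ n < (2 * m) ^ d
    far a m B<2h h<m = begin-strict
      B ^ n                       ≤⟨ ℕₚ.^-monoˡ-≤ n (ℕₚ.<⇒≤ B<2h) ⟩
      (2 * height a) ^ n          ≡⟨ ^-distribʳ-* n 2 (height a) ⟩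
      2 ^ n * height a ^ n        ≤⟨ ℕₚ.*-monoˡ-≤ (height a ^ n) (ℕₚ.^-monoʳ-≤ 2 n≤d) ⟩
      2 ^ d * height a ^ n        <⟨ ℕₚ.*-monoʳ-< (2 ^ d) {{ℕₚ.m^n≢0 2 d}} h<m ⟩
      2 ^ d * m ^ d               ≡⟨ sym (^-distribʳ-* d 2 m) ⟩
      (2 * m) ^ d                 ∎
    bound : ∃[ T ] B ^ n < (2 * T) ^ d × (∀ m → B ^ n < (2 * m) ^ d → T ≤ m) → length as ^ d * B ^ (n * v) ≤ E ^ d * B ^ (s * d)
    bound (zero  , B^n<0 , _)        = contradiction (subst (B ^ n <_) (0^n≡0 d) B^n<0) ℕₚ.n≮0
    bound (suc q , B^n<T , minimal) = begin
      L ^ d * B ^ (n * v)                       ≡⟨ cong (L ^ d *_) (sym (ℕₚ.^-*-assoc B n v)) ⟩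
      L ^ d * (B ^ n) ^ v                       ≤⟨ ℕₚ.*-monoʳ-≤ (L ^ d) (ℕₚ.^-monoˡ-≤ v (ℕₚ.<⇒≤ B^n<T)) ⟩
      L ^ d * ((2 * T) ^ d) ^ v                 ≡⟨ cong (L ^ d *_) (trans (ℕₚ.^-*-assoc (2 * T) d v) (trans (cong ((2 * T) ^_) (ℕₚ.*-comm d v)) (sym (ℕₚ.^-*-assoc (2 * T) v d)))) ⟩
      L ^ d * ((2 * T) ^ v) ^ d                 ≡⟨ sym (^-distribʳ-* d L ((2 * T) ^ v)) ⟩
      (L * (2 * T) ^ v) ^ d                     ≡⟨ cong (λ x → (L * x) ^ d) (^-distribʳ-* v 2 T) ⟩
      (L * (2 ^ v * T ^ v)) ^ d                 ≡⟨ cong (_^ d) (solve 3 (λ L x y → L :* (x :* y) := x :* (L :* y)) refl L (2 ^ v) (T ^ v)) ⟩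
      (2 ^ v * (L * T ^ v)) ^ d                 ≤⟨ ℕₚ.^-monoˡ-≤ d (ℕₚ.*-monoʳ-≤ (2 ^ v) counted) ⟩
      (2 ^ v * (2 * 6 ^ s * B ^ s)) ^ d         ≡⟨ cong (_^ d) (sym (ℕₚ.*-assoc (2 ^ v) (2 * 6 ^ s) (B ^ s))) ⟩
      (E * B ^ s) ^ d                           ≡⟨ ^-distribʳ-* d E (B ^ s) ⟩
      E ^ d * (B ^ s) ^ d                       ≡⟨ cong (E ^ d *_) (ℕₚ.^-*-assoc B s d) ⟩
      E ^ d * B ^ (s * d)                       ∎
      where
      open ℕ-Solver
      L = length as
      T = suc q
      T≤B : T ≤ B
      T≤B = ℕₚ.≤-trans (minimal m₀ (far a₀ m₀ B<2h₀ h₀<m₀))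
        (ℕₚ.≤-trans (¬nonMultiples⇒≤height 2 a₀ (s≤s (s≤s (s≤s z≤n))) nz₀ ¬h₀) h₀≤B)
      covered : ∀ {a} → a ∈ as → a ∈ cover B s q (B ∸ q)
      covered {a} a∈as with h≤B , B<2h , nz , m , h<m , ¬h ← ListAll.lookup all a∈as =
        ∈-cover B a q (B ∸ q) m h≤B (minimal m (far a m B<2h h<m))
          (ℕₚ.≤-trans (ℕₚ.≤-trans (¬nonMultiples⇒≤height 2 a (s≤s (s≤s (s≤s z≤n))) nz ¬h) h≤B) (ℕₚ.m≤n+m∸n B q)) ¬h
      counted : L * T ^ v ≤ 2 * 6 ^ s * B ^ s
      counted = ℕₚ.≤-trans (ℕₚ.*-monoˡ-≤ (T ^ v) (unique-⊆⇒length-≤ (cover B s q (B ∸ q)) uq covered))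
        (length-cover-bound B u q (B ∸ q) (ℕₚ.≤-reflexive (ℕₚ.m+[n∸m]≡n (ℕₚ.<⇒≤ T≤B))))

  module _ (N : ℕ) (exponents : n * v + N ≡ s * d) where

    -- As n ≤ d, the exponent N/d is at least s - v = 3. That it is at least 1 means that halving B
    -- at least halves the bound, so the blocks sum geometrically.
    d≤N : d ≤ N
    d≤N = ℕₚ.+-cancelˡ-≤ (d * v) d N (begin
      d * v + d       ≡⟨ solve 2 (λ d v → d :* v :+ d := (con 1 :+ v) :* d) refl d v ⟩
      suc v * d       ≤⟨ ℕₚ.*-monoˡ-≤ d (ℕₚ.m≤n+m (suc v) 2) ⟩
      s * d           ≡⟨ sym exponents ⟩
      n * v + N       ≤⟨ ℕₚ.+-monoˡ-≤ N (ℕₚ.*-monoˡ-≤ v n≤d) ⟩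
      d * v + N       ∎)
      where
      open ℕₚ.≤-Reasoning
      open ℕ-Solver

    block′ : ∀ B .{{_ : ℕ.NonZero B}} (as : List (Vec ℤ s)) → Unique as →
             ListAll.All (λ a → height a ≤ B × B < 2 * height a × Bad n d a) as → length as ^ d ≤ E ^ d * B ^ N
    block′ B as uq all = ℕₚ.*-cancelʳ-≤ _ _ (B ^ (n * v)) {{ℕₚ.m^n≢0 B (n * v)}} (begin
      length as ^ d * B ^ (n * v)             ≤⟨ block B as uq all ⟩
      E ^ d * B ^ (s * d)                     ≡⟨ cong (λ e → E ^ d * B ^ e) (trans (sym exponents) (ℕₚ.+-comm (n * v) N)) ⟩
      E ^ d * B ^ (N + n * v)                 ≡⟨ cong (E ^ d *_) (ℕₚ.^-distribˡ-+-* B N (n * v)) ⟩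
      E ^ d * (B ^ N * B ^ (n * v))           ≡⟨ sym (ℕₚ.*-assoc (E ^ d) (B ^ N) (B ^ (n * v))) ⟩
      E ^ d * B ^ N * B ^ (n * v)             ∎)
      where open ℕₚ.≤-Reasoning

    DyadicBound : ℕ → Set
    DyadicBound B = ∀ (as : List (Vec ℤ s)) → Unique as → ListAll.All (λ a → height a ≤ B × Bad n d a) as →
                    length as ^ d ≤ (2 * E) ^ d * B ^ N

    -- Both parts of the split have to stay below half of 2E · B^(N/d): the top block does by the
    -- factor 2 in front of E, the rest by induction at ⌊B/2⌋, since N ≥ d.
    dyadic : ∀ B → DyadicBound B
    dyadic = <-rec DyadicBound step
      where
      step : ∀ B → (∀ {B′} → B′ < B → DyadicBound B′) → DyadicBound B
      step B          rec []       _  _ = ℕₚ.≤-trans (ℕₚ.≤-reflexive (0^n≡0 d)) z≤n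
      step zero       rec ((i ∷ a) ∷ as) _ ((h≤0 , (i≢0 ∷ _) , _) ∷ _) =
        contradiction (ℤₚ.∣i∣≡0⇒i≡0 (ℕₚ.n≤0⇒n≡0 (∣head∣≤ i a h≤0))) i≢0
      step B@(suc _)  rec as@(_ ∷ _) uq all = subst (λ l → l ^ d ≤ (2 * E) ^ d * B ^ N) (length-filter-split P? as)
        ([m+n]^d≤ d (length low) (length high) low-bound high-bound)
        where
        open ℕₚ.≤-Reasoning
        B′ = B ℕm./ 2
        P? : ∀ a → Dec (height a ≤ B′)
        P? a = height a ℕₚ.≤? B′
        low  = filter P? as
        high = filter (λ a → ¬? (P? a)) as
        high-bound : 2 ^ d * length high ^ d ≤ (2 * E) ^ d * B ^ N
        high-bound = begin
          2 ^ d * length high ^ d        ≤⟨ ℕₚ.*-monoʳ-≤ (2 ^ d) (block′ B high (Uniqueₚ.filter⁺ (λ a → ¬? (P? a)) uq) (ListAll.tabulate split)) ⟩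
          2 ^ d * (E ^ d * B ^ N)        ≡⟨ sym (ℕₚ.*-assoc (2 ^ d) (E ^ d) (B ^ N)) ⟩
          2 ^ d * E ^ d * B ^ N          ≡⟨ cong (_* B ^ N) (sym (^-distribʳ-* d 2 E)) ⟩
          (2 * E) ^ d * B ^ N            ∎
          where
          split : ∀ {a} → a ∈ high → height a ≤ B × B < 2 * height a × Bad n d a
          split {a} a∈high with a∈as , ¬p ← ∈-filter⁻ (λ a → ¬? (P? a)) a∈high with h≤B , bad ← ListAll.lookup all a∈as =
            h≤B , ℕₚ.≰⇒> (λ 2h≤B → ¬p (m*n≤o⇒m≤o/n (height a) 2 (subst (_≤ B) (ℕₚ.*-comm 2 (height a)) 2h≤B))) , bad
        low-bound : 2 ^ d * length low ^ d ≤ (2 * E) ^ d * B ^ N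
        low-bound = begin
          2 ^ d * length low ^ d                 ≤⟨ ℕₚ.*-monoʳ-≤ (2 ^ d) (rec (ℕm.m/n<m B 2 (s≤s (s≤s z≤n))) low (Uniqueₚ.filter⁺ P? uq) (ListAll.tabulate split)) ⟩
          2 ^ d * ((2 * E) ^ d * B′ ^ N)         ≡⟨ trans (sym (ℕₚ.*-assoc (2 ^ d) ((2 * E) ^ d) (B′ ^ N))) (trans (cong (_* B′ ^ N) (ℕₚ.*-comm (2 ^ d) ((2 * E) ^ d))) (ℕₚ.*-assoc ((2 * E) ^ d) (2 ^ d) (B′ ^ N))) ⟩
          (2 * E) ^ d * (2 ^ d * B′ ^ N)         ≤⟨ ℕₚ.*-monoʳ-≤ ((2 * E) ^ d) (ℕₚ.*-monoˡ-≤ (B′ ^ N) (ℕₚ.^-monoʳ-≤ 2 d≤N)) ⟩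
          (2 * E) ^ d * (2 ^ N * B′ ^ N)         ≡⟨ cong ((2 * E) ^ d *_) (sym (^-distribʳ-* N 2 B′)) ⟩
          (2 * E) ^ d * (2 * B′) ^ N             ≤⟨ ℕₚ.*-monoʳ-≤ ((2 * E) ^ d) (ℕₚ.^-monoˡ-≤ N (subst (_≤ B) (ℕₚ.*-comm B′ 2) (ℕm.m/n*n≤m B 2))) ⟩
          (2 * E) ^ d * B ^ N                    ∎
          where
          split : ∀ {a} → a ∈ low → height a ≤ B′ × Bad n d a
          split {a} a∈low with a∈as , p ← ∈-filter⁻ P? a∈low = p , proj₂ (ListAll.lookup all a∈as)

-- Everything is a multiple of 1, which makes `sparse 1 H s 0` a list of the whole box of height H.
nonMultiples-1 : ∀ {s m} {a : Vec ℤ s} → ¬ NonMultiples 1 (suc m) a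
nonMultiples-1 (skip h)           = nonMultiples-1 h
nonMultiples-1 (take {c = c} ¬d _) = ¬d (ℤd.divides c (sym (ℤₚ.*-identityʳ c)))

count-low : ∀ {s} H .{{_ : ℕ.NonZero H}} (as : List (Vec ℤ s)) → Unique as → ListAll.All (λ a → height a ≤ H) as →
            length as ≤ 6 ^ s * H ^ s
count-low {s} H as uq all = begin
  length as                         ≤⟨ unique-⊆⇒length-≤ (sparse 1 H s 0) uq (λ {a} a∈as → ∈-sparse 0 a (ListAll.lookup all a∈as) nonMultiples-1) ⟩
  length (sparse 1 H s 0)           ≡⟨ sym (ℕₚ.*-identityʳ _) ⟩
  length (sparse 1 H s 0) * 1       ≤⟨ length-sparse (ℕ.>-nonZero⁻¹ H) s 0 ⟩
  6 ^ s * (H ℕm./ 1) ^ s * 1        ≡⟨ trans (ℕₚ.*-identityʳ _) (cong (λ h → 6 ^ s * h ^ s) (ℕm.n/1≡n H)) ⟩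
  6 ^ s * H ^ s                     ∎
  where open ℕₚ.≤-Reasoning

-- The summands belong to the box |𝐚| ≤ H and to the constant `2 * E` of the dyadic count; the
-- leading factors 2 pay for separating the two kinds of tuples.
countConstant : ℕ → ℕ → ℕ
countConstant s H = 2 * (6 ^ s * H ^ s) + 2 * (2 * (2 ^ (s ∸ 3) * (2 * 6 ^ s)))

-- #P ≤ C B^(N/d), where N/d = s - (n/d)(s - 3).
count : ∀ s n d N H B .{{_ : ℕ.NonZero d}} .{{_ : ℕ.NonZero H}} .{{_ : ℕ.NonZero B}} → 4 ≤ s → n ≤ d → n * (s ∸ 3) + N ≡ s * d →
        (as : List (Vec ℤ s)) → Unique as → ListAll.All (λ a → height a ≤ B × (height a ≤ H ⊎ Bad n d a)) as →
        length as ^ d ≤ countConstant s H ^ d * B ^ N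
count s@(suc (suc (suc (suc u)))) n d N H B (s≤s (s≤s (s≤s (s≤s z≤n)))) n≤d exponents as uq all =
  subst (λ l → l ^ d ≤ C ^ d * B ^ N) (length-filter-split P? as) ([m+n]^d≤ d (length low) (length high) low-bound high-bound)
  where
  open ℕₚ.≤-Reasoning
  open DyadicCount u n d n≤d using (dyadic; E)
  C = countConstant s H
  C₁ = 6 ^ s * H ^ s
  P? : ∀ a → Dec (height a ≤ H)
  P? a = height a ℕₚ.≤? H
  low  = filter P? as
  high = filter (λ a → ¬? (P? a)) as
  low-bound : 2 ^ d * length low ^ d ≤ C ^ d * B ^ N
  low-bound = begin
    2 ^ d * length low ^ d       ≡⟨ sym (^-distribʳ-* d 2 (length low)) ⟩
    (2 * length low) ^ d         ≤⟨ ℕₚ.^-monoˡ-≤ d (ℕₚ.*-monoʳ-≤ 2 (count-low H low (Uniqueₚ.filter⁺ P? uq) (ListAll.tabulate (λ a∈ → proj₂ (∈-filter⁻ P? {xs = as} a∈))))) ⟩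
    (2 * C₁) ^ d                 ≤⟨ ℕₚ.^-monoˡ-≤ d (ℕₚ.m≤m+n (2 * C₁) _) ⟩
    C ^ d                        ≤⟨ ℕₚ.m≤m*n (C ^ d) (B ^ N) {{ℕₚ.m^n≢0 B N}} ⟩
    C ^ d * B ^ N                ∎
  high-bound : 2 ^ d * length high ^ d ≤ C ^ d * B ^ N
  high-bound = begin
    2 ^ d * length high ^ d              ≤⟨ ℕₚ.*-monoʳ-≤ (2 ^ d) (dyadic N exponents B high (Uniqueₚ.filter⁺ (λ a → ¬? (P? a)) uq) (ListAll.tabulate split)) ⟩
    2 ^ d * ((2 * E) ^ d * B ^ N)        ≡⟨ trans (sym (ℕₚ.*-assoc (2 ^ d) ((2 * E) ^ d) (B ^ N))) (cong (_* B ^ N) (sym (^-distribʳ-* d 2 (2 * E)))) ⟩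
    (2 * (2 * E)) ^ d * B ^ N            ≤⟨ ℕₚ.*-monoˡ-≤ (B ^ N) (ℕₚ.^-monoˡ-≤ d (ℕₚ.m≤n+m (2 * (2 * E)) (2 * C₁))) ⟩
    C ^ d * B ^ N                        ∎
    where
    split : ∀ {a} → a ∈ high → height a ≤ B × Bad n d a
    split {a} a∈high with a∈as , ¬p ← ∈-filter⁻ (λ a → ¬? (P? a)) {xs = as} a∈high with ListAll.lookup all a∈as
    ... | h≤B , inj₁ h≤H = contradiction h≤H ¬p
    ... | h≤B , inj₂ bad = h≤B , bad

-- The order on ℝ

open ℝ using (Point; seq; cauchy; ι; fromℕ)
  renaming (_<_ to _<ʳ_; _≤_ to _≤ʳ_; _*_ to _*ʳ_; _^_ to _^ʳ_; 0# to 0ʳ; 1# to 1ʳ)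

*-pos : ∀ {x y} → 0ℚ ℚ.< x → 0ℚ ℚ.< y → 0ℚ ℚ.< x ℚ.* y
*-pos {x} {y} x>0 y>0 = ℚₚ.positive⁻¹ (x ℚ.* y)
  {{ℚₚ.pos*pos⇒pos x {{ℚ.positive x>0}} y {{ℚ.positive y>0}}}}

ℚ-+-cancelʳ-< : ∀ r p q → p ℚ.+ r ℚ.< q ℚ.+ r → p ℚ.< q
ℚ-+-cancelʳ-< r p q lt = subst₂ ℚ._<_ (cancel p) (cancel q) (ℚₚ.+-monoˡ-< (ℚ.- r) lt)
  where
  open ℚ-Solver
  cancel : ∀ p → p ℚ.+ r ℚ.- r ≡ p
  cancel p = solve 2 (λ p r → p :+ r :- r := p) refl p r

∣p-q∣<ε⇒p<q+ε : ∀ p q {ε} → ℚ.∣ p ℚ.- q ∣ ℚ.< ε → p ℚ.< q ℚ.+ ε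
∣p-q∣<ε⇒p<q+ε p q {ε} lt = begin-strict
  p                    ≡⟨ solve 2 (λ p q → p := q :+ (p :- q)) refl p q ⟩
  q ℚ.+ (p ℚ.- q)      <⟨ ℚₚ.+-monoʳ-< q (ℚₚ.≤-<-trans (p≤∣p∣ (p ℚ.- q)) lt) ⟩
  q ℚ.+ ε              ∎
  where
  open ℚₚ.≤-Reasoning
  open ℚ-Solver
  p≤∣p∣ : ∀ p → p ℚ.≤ ℚ.∣ p ∣
  p≤∣p∣ p with ℚₚ.≤-total 0ℚ p
  ... | inj₁ 0≤p = ℚₚ.≤-reflexive (sym (ℚₚ.0≤p⇒∣p∣≡p 0≤p))
  ... | inj₂ p≤0 = ℚₚ.≤-trans p≤0 (ℚₚ.0≤∣p∣ p)

module ℝₚ where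

  -- Comparing the rational terms at one far index M decides the matter. If x exceeded y + 3θ there,
  -- then y < x would hold with gap θ, against x ≤ y. Otherwise x and y each move by less than θ
  -- after M, which adds up to 5θ = η.
  ≤⇒eventually : ∀ {x y} → x ≤ʳ y → ∀ η → 0ℚ ℚ.< η → ∃[ N ] ∀ n → N ℕ.≤ n → seq x n ℚ.< seq y n ℚ.+ η
  ≤⇒eventually {x} {y} x≤y η η>0 = go (cauchy x θ θ>0) (cauchy y θ θ>0)
    where
    open ℚₚ.≤-Reasoning
    open ℚ-Solver
    θ = (+ 1 / 5) ℚ.* η
    θ>0 : 0ℚ ℚ.< θ
    θ>0 = *-pos (ℚₚ.positive⁻¹ (+ 1 / 5)) η>0
    5θ≡η : ∀ q → q ℚ.+ θ ℚ.+ (θ ℚ.+ θ ℚ.+ θ) ℚ.+ θ ≡ q ℚ.+ η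
    5θ≡η q = solve 2 (λ q η → q :+ con (+ 1 / 5) :* η :+ (con (+ 1 / 5) :* η :+ con (+ 1 / 5) :* η :+ con (+ 1 / 5) :* η) :+ con (+ 1 / 5) :* η := q :+ η) refl q η
    go : (∃[ N ] ∀ m n → N ℕ.≤ m → N ℕ.≤ n → ℚ.∣ seq x m ℚ.- seq x n ∣ ℚ.< θ) →
         (∃[ N ] ∀ m n → N ℕ.≤ m → N ℕ.≤ n → ℚ.∣ seq y m ℚ.- seq y n ∣ ℚ.< θ) →
         ∃[ N ] ∀ n → N ℕ.≤ n → seq x n ℚ.< seq y n ℚ.+ η
    go (N₁ , cx) (N₂ , cy) = M , by-cases (seq x M ℚₚ.≤? seq y M ℚ.+ (θ ℚ.+ θ ℚ.+ θ))
      where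
      M = N₁ ℕ.⊔ N₂
      x-close : ∀ m n → M ℕ.≤ m → M ℕ.≤ n → seq x m ℚ.< seq x n ℚ.+ θ
      x-close m n M≤m M≤n = ∣p-q∣<ε⇒p<q+ε _ _ (cx m n (ℕₚ.m⊔n≤o⇒m≤o N₁ N₂ M≤m) (ℕₚ.m⊔n≤o⇒m≤o N₁ N₂ M≤n))
      y-close : ∀ m n → M ℕ.≤ m → M ℕ.≤ n → seq y m ℚ.< seq y n ℚ.+ θ
      y-close m n M≤m M≤n = ∣p-q∣<ε⇒p<q+ε _ _ (cy m n (ℕₚ.m⊔n≤o⇒n≤o N₁ N₂ M≤m) (ℕₚ.m⊔n≤o⇒n≤o N₁ N₂ M≤n))
      by-cases : Dec (seq x M ℚ.≤ seq y M ℚ.+ (θ ℚ.+ θ ℚ.+ θ)) → ∀ n → M ℕ.≤ n → seq x n ℚ.< seq y n ℚ.+ η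
      by-cases (yes le) n M≤n = begin-strict
        seq x n                                              <⟨ x-close n M M≤n ℕₚ.≤-refl ⟩
        seq x M ℚ.+ θ                                        ≤⟨ ℚₚ.+-monoˡ-≤ θ le ⟩
        seq y M ℚ.+ (θ ℚ.+ θ ℚ.+ θ) ℚ.+ θ                    <⟨ ℚₚ.+-monoˡ-< θ (ℚₚ.+-monoˡ-< (θ ℚ.+ θ ℚ.+ θ) (y-close M n ℕₚ.≤-refl M≤n)) ⟩
        seq y n ℚ.+ θ ℚ.+ (θ ℚ.+ θ ℚ.+ θ) ℚ.+ θ              ≡⟨ 5θ≡η (seq y n) ⟩
        seq y n ℚ.+ η                                        ∎
      by-cases (no ¬le) = contradiction (θ , θ>0 , M , λ n M≤n → ℚ-+-cancelʳ-< θ _ _ (begin-strict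
          seq y n ℚ.+ θ ℚ.+ θ                <⟨ ℚₚ.+-monoˡ-< θ (ℚₚ.+-monoˡ-< θ (y-close n M M≤n ℕₚ.≤-refl)) ⟩
          seq y M ℚ.+ θ ℚ.+ θ ℚ.+ θ          ≡⟨ solve 2 (λ y t → y :+ t :+ t :+ t := y :+ (t :+ t :+ t)) refl (seq y M) θ ⟩
          seq y M ℚ.+ (θ ℚ.+ θ ℚ.+ θ)        <⟨ ℚₚ.≰⇒> ¬le ⟩
          seq x M                            <⟨ x-close M n ℕₚ.≤-refl M≤n ⟩
          seq x n ℚ.+ θ                      ∎)) x≤y

  halve : ∀ ε → 0ℚ ℚ.< ε → ∃[ η ] 0ℚ ℚ.< η × (∀ q → q ℚ.+ η ℚ.+ η ≡ q ℚ.+ ε)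
  halve ε ε>0 = ℚ.½ ℚ.* ε , *-pos (ℚₚ.positive⁻¹ ℚ.½) ε>0 ,
    λ q → solve 2 (λ q ε → q :+ con ℚ.½ :* ε :+ con ℚ.½ :* ε := q :+ ε) refl q ε
    where open ℚ-Solver

  ≤-<-trans : ∀ {x y z} → x ≤ʳ y → y <ʳ z → x <ʳ z
  ≤-<-trans {x} {y} {z} x≤y (ε , ε>0 , N , y<z) = go (halve ε ε>0)
    where
    open ℚₚ.≤-Reasoning
    go : (∃[ η ] 0ℚ ℚ.< η × (∀ q → q ℚ.+ η ℚ.+ η ≡ q ℚ.+ ε)) → x <ʳ z
    go (η , η>0 , 2η≡ε) = η , η>0 , M ℕ.⊔ N , λ n le → begin-strict
        seq x n ℚ.+ η              <⟨ ℚₚ.+-monoˡ-< η (proj₂ x<y n (ℕₚ.m⊔n≤o⇒m≤o M N le)) ⟩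
        seq y n ℚ.+ η ℚ.+ η        ≡⟨ 2η≡ε (seq y n) ⟩
        seq y n ℚ.+ ε              <⟨ y<z n (ℕₚ.m⊔n≤o⇒n≤o M N le) ⟩
        seq z n                    ∎
      where
      x<y = ≤⇒eventually {x} {y} x≤y η η>0
      M = proj₁ x<y

  <-≤-trans : ∀ {x y z} → x <ʳ y → y ≤ʳ z → x <ʳ z
  <-≤-trans {x} {y} {z} (ε , ε>0 , N , x<y) y≤z = go (halve ε ε>0)
    where
    open ℚₚ.≤-Reasoning
    go : (∃[ η ] 0ℚ ℚ.< η × (∀ q → q ℚ.+ η ℚ.+ η ≡ q ℚ.+ ε)) → x <ʳ z
    go (η , η>0 , 2η≡ε) = η , η>0 , M ℕ.⊔ N , λ n le → ℚ-+-cancelʳ-< η _ _ (begin-strict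
        seq x n ℚ.+ η ℚ.+ η        ≡⟨ 2η≡ε (seq x n) ⟩
        seq x n ℚ.+ ε              <⟨ x<y n (ℕₚ.m⊔n≤o⇒n≤o M N le) ⟩
        seq y n                    <⟨ proj₂ y<z n (ℕₚ.m⊔n≤o⇒m≤o M N le) ⟩
        seq z n ℚ.+ η              ∎)
      where
      y<z = ≤⇒eventually {y} {z} y≤z η η>0
      M = proj₁ y<z

  <-asym : ∀ {x y} → x <ʳ y → ¬ (y <ʳ x)
  <-asym {x} {y} (ε , ε>0 , N , x<y) (η , η>0 , M , y<x) = ℚₚ.<-asym
    (ℚₚ.<-trans (q<q+ε _ ε>0) (x<y (M ℕ.⊔ N) (ℕₚ.m≤n⊔m M N))) (ℚₚ.<-trans (q<q+ε _ η>0) (y<x (M ℕ.⊔ N) (ℕₚ.m≤m⊔n M N)))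
    where
    q<q+ε : ∀ q {ε} → 0ℚ ℚ.< ε → q ℚ.< q ℚ.+ ε
    q<q+ε q {ε} ε>0 = subst (ℚ._< q ℚ.+ ε) (ℚₚ.+-identityʳ q) (ℚₚ.+-monoʳ-< q ε>0)

  <-trans : ∀ {x y z} → x <ʳ y → y <ʳ z → x <ʳ z
  <-trans {x} {y} {z} x<y y<z = ≤-<-trans {x} {y} {z} (<-asym {x} {y} x<y) y<z

  ≤-trans : ∀ {x y z} → x ≤ʳ y → y ≤ʳ z → x ≤ʳ z
  ≤-trans {x} {y} {z} x≤y y≤z z<x = y≤z (<-≤-trans {z} {x} {y} z<x x≤y)

  <-resp : ∀ {x x′ y y′} → (∀ n → seq x n ≡ seq x′ n) → (∀ n → seq y n ≡ seq y′ n) → x <ʳ y → x′ <ʳ y′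
  <-resp x≡ y≡ (ε , ε>0 , N , x<y) = ε , ε>0 , N , λ n le → subst₂ (λ p q → p ℚ.+ ε ℚ.< q) (x≡ n) (y≡ n) (x<y n le)

  *-cancelˡ-< : ∀ {x y z} → 0ʳ <ʳ z → (z *ʳ x) <ʳ (z *ʳ y) → x <ʳ y
  *-cancelˡ-< {x} {y} {z} (δ , δ>0 , N₁ , z>0) (ε , ε>0 , N₂ , zx<zy) with N₃ , close ← cauchy z 1ℚ (ℚₚ.positive⁻¹ 1ℚ) =
    go N₃ (λ n le → ∣p-q∣<ε⇒p<q+ε (seq z n) (seq z (N₁ ℕ.⊔ N₃)) (close n (N₁ ℕ.⊔ N₃) le (ℕₚ.m≤n⊔m N₁ N₃)))
    where
    open ℚₚ.≤-Reasoning
    open ℚ-Solver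
    z-pos : ∀ n → N₁ ℕ.≤ n → 0ℚ ℚ.< seq z n
    z-pos n le = ℚₚ.<-trans (subst (0ℚ ℚ.<_) (sym (ℚₚ.+-identityˡ δ)) δ>0) (z>0 n le)
    go : ∀ N₃ → (∀ n → N₃ ℕ.≤ n → seq z n ℚ.< seq z (N₁ ℕ.⊔ N₃) ℚ.+ 1ℚ) → x <ʳ y
    go N₃ bound = θ , *-pos ε>0 1/K>0 , N₁ ℕ.⊔ (N₂ ℕ.⊔ N₃) , λ n le → gap n
        (ℕₚ.m⊔n≤o⇒m≤o N₁ _ le) (ℕₚ.m⊔n≤o⇒m≤o N₂ N₃ (ℕₚ.m⊔n≤o⇒n≤o N₁ _ le)) (ℕₚ.m⊔n≤o⇒n≤o N₂ N₃ (ℕₚ.m⊔n≤o⇒n≤o N₁ _ le))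
      where
      -- An upper bound for the tail of z: the gap ε divided by K survives the cancellation of z.
      K = seq z (N₁ ℕ.⊔ N₃) ℚ.+ 1ℚ
      K>0 : 0ℚ ℚ.< K
      K>0 = ℚₚ.+-mono-< (z-pos (N₁ ℕ.⊔ N₃) (ℕₚ.m≤m⊔n N₁ N₃)) (ℚₚ.positive⁻¹ 1ℚ)
      instance
        K-positive : ℚ.Positive K
        K-positive = ℚ.positive K>0
        K-nonZero : ℚ.NonZero K
        K-nonZero = ℚₚ.pos⇒nonZero K
      1/K = ℚ.1/ K
      1/K>0 : 0ℚ ℚ.< 1/K
      1/K>0 = ℚₚ.positive⁻¹ 1/K {{ℚₚ.1/pos⇒pos K}}
      θ = ε ℚ.* 1/K
      Kθ≡ε : K ℚ.* θ ≡ ε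
      Kθ≡ε = trans (solve 3 (λ k e i → k :* (e :* i) := e :* (k :* i)) refl K ε 1/K)
        (trans (cong (ε ℚ.*_) (ℚₚ.*-inverseʳ K)) (ℚₚ.*-identityʳ ε))
      gap : ∀ n → N₁ ℕ.≤ n → N₂ ℕ.≤ n → N₃ ℕ.≤ n → seq x n ℚ.+ θ ℚ.< seq y n
      gap n n₁ n₂ n₃ = ℚₚ.*-cancelˡ-<-nonNeg (seq z n) {{ℚ.nonNegative (ℚₚ.<⇒≤ (z-pos n n₁))}} (begin-strict
        seq z n ℚ.* (seq x n ℚ.+ θ)                  ≡⟨ ℚₚ.*-distribˡ-+ (seq z n) (seq x n) θ ⟩
        seq z n ℚ.* seq x n ℚ.+ seq z n ℚ.* θ        <⟨ ℚₚ.+-monoʳ-< (seq z n ℚ.* seq x n) (ℚₚ.*-monoˡ-<-pos θ {{ℚ.positive (*-pos ε>0 1/K>0)}} (bound n n₃)) ⟩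
        seq z n ℚ.* seq x n ℚ.+ K ℚ.* θ              ≡⟨ cong (λ e → seq z n ℚ.* seq x n ℚ.+ e) Kθ≡ε ⟩
        seq z n ℚ.* seq x n ℚ.+ ε                    <⟨ zx<zy n n₂ ⟩
        seq z n ℚ.* seq y n                          ∎)

  *-monoʳ-< : ∀ {x y z} → 0ʳ <ʳ z → x <ʳ y → (z *ʳ x) <ʳ (z *ʳ y)
  *-monoʳ-< {x} {y} {z} (δ , δ>0 , M , z>0) (ε , ε>0 , N , x<y) = δ ℚ.* ε , *-pos δ>0 ε>0 , M ℕ.⊔ N , λ n le →
    let z>δ = subst (ℚ._< seq z n) (ℚₚ.+-identityˡ δ) (z>0 n (ℕₚ.m⊔n≤o⇒m≤o M N le)) in begin-strict
      seq z n ℚ.* seq x n ℚ.+ δ ℚ.* ε              <⟨ ℚₚ.+-monoʳ-< (seq z n ℚ.* seq x n) (ℚₚ.*-monoˡ-<-pos ε {{ℚ.positive ε>0}} z>δ) ⟩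
      seq z n ℚ.* seq x n ℚ.+ seq z n ℚ.* ε        ≡⟨ sym (ℚₚ.*-distribˡ-+ (seq z n) (seq x n) ε) ⟩
      seq z n ℚ.* (seq x n ℚ.+ ε)                  <⟨ ℚₚ.*-monoʳ-<-pos (seq z n) {{ℚ.positive (ℚₚ.<-trans δ>0 z>δ)}} (x<y n (ℕₚ.m⊔n≤o⇒n≤o M N le)) ⟩
      seq z n ℚ.* seq y n                          ∎
    where open ℚₚ.≤-Reasoning

  *-monoʳ-≤ : ∀ {x y z} → 0ʳ <ʳ z → x ≤ʳ y → (z *ʳ x) ≤ʳ (z *ʳ y)
  *-monoʳ-≤ {x} {y} {z} z>0 x≤y zy<zx = x≤y (*-cancelˡ-< {y} {x} {z} z>0 zy<zx)

  *-monoˡ-≤ : ∀ {x y z} → 0ʳ <ʳ z → x ≤ʳ y → (x *ʳ z) ≤ʳ (y *ʳ z)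
  *-monoˡ-≤ {x} {y} {z} z>0 x≤y yz<xz = *-monoʳ-≤ {x} {y} {z} z>0 x≤y
    (<-resp {y *ʳ z} {z *ʳ y} {x *ʳ z} {z *ʳ x} (λ n → ℚₚ.*-comm (seq y n) (seq z n)) (λ n → ℚₚ.*-comm (seq x n) (seq z n)) yz<xz)

  0<1 : 0ʳ <ʳ 1ʳ
  0<1 = ℚ.½ , ℚₚ.positive⁻¹ ℚ.½ , 0 , λ _ _ → subst (ℚ._< 1ℚ) (sym (ℚₚ.+-identityˡ ℚ.½)) (ℚ.*<* (ℤ.+<+ (ℕ.s≤s (ℕ.s≤s ℕ.z≤n))))

  *-positive : ∀ {x y} → 0ʳ <ʳ x → 0ʳ <ʳ y → 0ʳ <ʳ (x *ʳ y)
  *-positive {x} {y} x>0 y>0 = <-resp {x *ʳ 0ʳ} {0ʳ} {x *ʳ y} {x *ʳ y} (λ n → ℚₚ.*-zeroʳ (seq x n)) (λ _ → refl) (*-monoʳ-< {0ʳ} {y} {x} x>0 y>0)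

  ^-positive : ∀ {x} → 0ʳ <ʳ x → ∀ n → 0ʳ <ʳ (x ^ʳ n)
  ^-positive {x} x>0 zero    = 0<1
  ^-positive {x} x>0 (suc n) = *-positive {x} {x ^ʳ n} x>0 (^-positive {x} x>0 n)

  ≤-refl : ∀ {x} → x ≤ʳ x
  ≤-refl {x} x<x = <-asym {x} {x} x<x x<x

  ^-monoˡ-≤ : ∀ {x y} → 0ʳ <ʳ x → x ≤ʳ y → ∀ n → (x ^ʳ n) ≤ʳ (y ^ʳ n)
  ^-monoˡ-≤ {x} {y} x>0 x≤y zero    = ≤-refl {1ʳ}
  ^-monoˡ-≤ {x} {y} x>0 x≤y (suc n) = ≤-trans {x *ʳ (x ^ʳ n)} {y *ʳ (x ^ʳ n)} {y *ʳ (y ^ʳ n)}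
    (*-monoˡ-≤ {x} {y} {x ^ʳ n} (^-positive {x} x>0 n) x≤y)
    (*-monoʳ-≤ {x ^ʳ n} {y ^ʳ n} {y} (<-≤-trans {0ʳ} {x} {y} x>0 x≤y) (^-monoˡ-≤ {x} {y} x>0 x≤y n))

  ^-monoʳ-≤ : ∀ {x} → 1ʳ ≤ʳ x → ∀ {m n} → m ℕ.≤ n → (x ^ʳ m) ≤ʳ (x ^ʳ n)
  ^-monoʳ-≤ {x} 1≤x {n = n} ℕ.z≤n = 1≤x^ n
    where
    1≤x^ : ∀ n → 1ʳ ≤ʳ (x ^ʳ n)
    1≤x^ zero    = ≤-refl {1ʳ}
    1≤x^ (suc n) = ≤-trans {1ʳ} {x} {x *ʳ (x ^ʳ n)} 1≤x (λ lt → *-monoʳ-≤ {1ʳ} {x ^ʳ n} {x} (<-≤-trans {0ʳ} {1ʳ} {x} 0<1 1≤x) (1≤x^ n)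
      (<-resp {x *ʳ (x ^ʳ n)} {x *ʳ (x ^ʳ n)} {x} {x *ʳ 1ʳ} (λ _ → refl) (λ m → sym (ℚₚ.*-identityʳ (seq x m))) lt))
  ^-monoʳ-≤ {x} 1≤x {suc m} {suc n} (ℕ.s≤s m≤n) = *-monoʳ-≤ {x ^ʳ m} {x ^ʳ n} {x} (<-≤-trans {0ʳ} {1ʳ} {x} 0<1 1≤x) (^-monoʳ-≤ {x} 1≤x m≤n)

open ℝₚ

-- Exceptional tuples

/1-cancel-< : ∀ a b → + a / 1 ℚ.< + b / 1 → a < b
/1-cancel-< a b lt = ℕₚ.≰⇒> (λ b≤a → ℚₚ.<-irrefl refl (ℚₚ.<-≤-trans lt (/1-mono-≤ (ℤ.+≤+ b≤a))))

/1-cancel-≤ : ∀ a b → + a / 1 ℚ.≤ + b / 1 → a ≤ b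
/1-cancel-≤ a b le = ℕₚ.≮⇒≥ (λ b<a → ℚₚ.<-irrefl refl (ℚₚ.<-≤-trans (/1-mono-< (ℤ.+<+ b<a)) le))

fromℕ-^ : ∀ h m i → seq (fromℕ h ^ʳ m) i ≡ + (h ^ m) / 1
fromℕ-^ h m i = trans (IntegerPoints.seq-^ usual ℝ.fromℤ (λ _ _ → refl) (fromℕ h) (+ h) i refl m) (cong (_/ 1) (pos-^ h m))

constant-< : ∀ {x y} p q → (∀ i → seq x i ≡ p) → (∀ i → seq y i ≡ q) → x <ʳ y → p ℚ.< q
constant-< p q x≡p y≡q (ε , ε>0 , N , lt) = ℚₚ.≤-<-trans
  (subst (ℚ._≤ p ℚ.+ ε) (ℚₚ.+-identityʳ p) (ℚₚ.+-monoʳ-≤ p (ℚₚ.<⇒≤ ε>0)))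
  (subst₂ (λ u v → u ℚ.+ ε ℚ.< v) (x≡p N) (y≡q N) (lt N ℕₚ.≤-refl))

^≺⇒^< : ∀ h x i d m → i ≡ + m → fromℕ h ℝ.^ℤ i ≺ (fromℕ x ^ʳ d) → h ^ m < x ^ d
^≺⇒^< h x _ d m refl lt = /1-cancel-< (h ^ m) (x ^ d) (constant-< {fromℕ h ^ʳ m} {fromℕ x ^ʳ d} _ _ (fromℕ-^ h m) (fromℕ-^ x d) lt)

fraction-< : ∀ r q n → ↥ r ≡ + n → r ℚ.< q → ∃[ m ] ↥ q ≡ + m × n * ↧ₙ q < m * ↧ₙ r
fraction-< (mkℚ _ d-1 _) (mkℚ (+ m) e-1 _) n refl (ℚ.*<* lt) = m , refl ,
  ℤₚ.drop‿+<+ (subst₂ ℤ._<_ (sym (ℤₚ.pos-* n (suc e-1))) (sym (ℤₚ.pos-* m (suc d-1))) lt)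
fraction-< (mkℚ _ d-1 _) (mkℚ -[1+ m ] e-1 _) n refl (ℚ.*<* lt) =
  contradiction (ℤₚ.≤-<-trans (subst (+ 0 ℤ.≤_) (ℤₚ.pos-* n (suc e-1)) (ℤ.+≤+ z≤n)) lt) λ ()

fraction-≤ : ∀ r q m n → ↥ r ≡ + m → ↥ q ≡ + n → r ℚ.≤ q → m * ↧ₙ q ≤ n * ↧ₙ r
fraction-≤ (mkℚ _ d-1 _) (mkℚ _ e-1 _) m n refl refl (ℚ.*≤* le) =
  ℤₚ.drop‿+≤+ (subst₂ ℤ._≤_ (sym (ℤₚ.pos-* m (suc e-1))) (sym (ℤₚ.pos-* n (suc d-1))) le)

-- The fractional powers satisfy h^(n/d) ≤ h^(m/e) < x; the comparison is made after raising
-- everything to the power de.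
power-< : ∀ h x n d m e .{{_ : ℕ.NonZero h}} .{{_ : ℕ.NonZero d}} → n * e ≤ m * d → h ^ m < x ^ e → h ^ n < x ^ d
power-< h x n d m e ne≤md h^m<x^e = ℕₚ.≰⇒> λ x^d≤h^n → ℕₚ.<⇒≱ (ℕₚ.^-monoˡ-< d h^m<x^e) (begin
  (x ^ e) ^ d      ≡⟨ trans (ℕₚ.^-*-assoc x e d) (trans (cong (x ^_) (ℕₚ.*-comm e d)) (sym (ℕₚ.^-*-assoc x d e))) ⟩
  (x ^ d) ^ e      ≤⟨ ℕₚ.^-monoˡ-≤ e x^d≤h^n ⟩
  (h ^ n) ^ e      ≡⟨ ℕₚ.^-*-assoc h n e ⟩
  h ^ (n * e)      ≤⟨ ℕₚ.^-monoʳ-≤ h ne≤md ⟩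
  h ^ (m * d)      ≡⟨ sym (ℕₚ.^-*-assoc h m d) ⟩
  (h ^ m) ^ d      ∎)
  where open ℕₚ.≤-Reasoning

-- r ≤ ν, in the form in which it is applied to the exponents q > ν of _^ℝ_≺_.
_≼_ : ℚ → ℝ → Set
r ≼ ν = ∀ q → ν <ʳ ι q → r ℚ.< q

<⇒≼ : ∀ {r ν} → ι r <ʳ ν → r ≼ ν
<⇒≼ {r} {ν} r<ν q ν<q = constant-< {ι r} {ι q} r q (λ _ → refl) (λ _ → refl) (<-trans {ι r} {ν} {ι q} r<ν ν<q)

≤⇒≼ : ∀ {r ν} → ι r ≤ʳ ν → r ≼ ν
≤⇒≼ {r} {ν} r≤ν q ν<q = constant-< {ι r} {ι q} r q (λ _ → refl) (λ _ → refl) (≤-<-trans {ι r} {ν} {ι q} r≤ν ν<q)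

height≢0 : ∀ {s} (a : Vec ℤ s) → 1 ≤ s → AllNonZero a → ℕ.NonZero (height a)
height≢0 (i ∷ a) _ (i≢0 ∷ _) = ℕ.>-nonZero (ℕₚ.<-≤-trans (ℕₚ.n≢0⇒n>0 (λ eq → i≢0 (ℤₚ.∣i∣≡0⇒i≡0 eq))) (ℕₚ.m≤m⊔n ℤ.∣ i ∣ (height a)))

-- The real exponent is traded for the rational r here: the witness q > ν inside `_^ℝ_≺_` exceeds r,
-- and only integer powers remain.
above-power : ∀ ν r n h x .{{_ : ℕ.NonZero h}} → ↥ r ≡ + n → r ≼ ν → fromℕ h ℝ.^ℝ ν ≺ fromℕ x → h ^ n < x ^ ↧ₙ r
above-power ν r n h x r≡n r≼ν (_ , q , ν<q , h^q<x) = go (fraction-< r q n r≡n (r≼ν q ν<q))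
  where
  go : ∃[ m ] ↥ q ≡ + m × n * ↧ₙ q < m * ↧ₙ r → h ^ n < x ^ ↧ₙ r
  go (m , q≡m , lt) = power-< h x n (↧ₙ r) m (↧ₙ q) (ℕₚ.<⇒≤ lt) (^≺⇒^< h x (↥ q) (↧ₙ q) m q≡m h^q<x)

allNonMultiples : ∀ {p s} m (a : Vec ℤ s) → m ≤ s → AllNonZero a → height a < p → NonMultiples p m a
allNonMultiples zero    a       _         _          _   = none
allNonMultiples {p} (suc m) (i ∷ a) (s≤s m≤s) (i≢0 ∷ nz) h<p = take p∤i (allNonMultiples m a m≤s nz (ℕₚ.≤-<-trans (ℕₚ.m≤n⊔m ℤ.∣ i ∣ (height a)) h<p))
  where
  p∤i : ¬ (+ p ℤd.∣ i)
  p∤i d = ℕₚ.<⇒≱ (ℕₚ.≤-<-trans (ℕₚ.m≤m⊔n ℤ.∣ i ∣ (height a)) h<p) (ℕd.∣⇒≤ {{ℤ.≢-nonZero i≢0}} (ℤd.∣⇒∣ᵤ d))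

-- Used twice: for λ ≥ 1 with r = 1, and for a negative rational q above s - λ(s - 3), which forces
-- an r ≥ 1 below λ.
star-large : ∀ K {s} ν r n (a : Vec ℤ s) → 3 ≤ s → AllNonZero a → suc (threshold (suc K)) ≤ height a →
             ↥ r ≡ + n → r ≼ ν → ↧ₙ r ≤ n → Star (suc K) s ν a
star-large K {s} ν r n a 3≤s nz H≤h r≡n r≼ν d≤n (x , x-prime , x-above , solution) =
  prime-solution⇒𝒞′ K a x x-prime solution λ j → ℕₚ.<-trans H≤h (h<x j) , allNonMultiples 3 a 3≤s nz (h<x j)
  where
  instance
    h≢0 : ℕ.NonZero (height a)
    h≢0 = height≢0 a (ℕₚ.≤-trans (s≤s z≤n) 3≤s) nz
  h<x : ∀ j → height a < x j
  h<x j = subst₂ _<_ (ℕₚ.*-identityʳ (height a)) (ℕₚ.*-identityʳ (x j))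
    (power-< (height a) (x j) 1 1 n (↧ₙ r) (ℕₚ.≤-trans (ℕₚ.≤-reflexive (ℕₚ.*-identityˡ (↧ₙ r))) (ℕₚ.≤-trans d≤n (ℕₚ.≤-reflexive (sym (ℕₚ.*-identityʳ n)))))
      (above-power ν r n (height a) (x j) r≡n r≼ν (x-above j)))

-- The negation of `Star` provides no prime solution, so the dichotomy can only be doubly negated. D
-- is an upper bound for 1/r: a prime xⱼ ≤ T forces |𝐚|ⁿ < T^d ≤ T^(nD), hence |𝐚| < T^D.
¬star⇒bad : ∀ K {s} ν r n D (a : Vec ℤ s) → 1 ≤ s → AllNonZero a → ↥ r ≡ + n → r ≼ ν → ↧ₙ r ≤ n * D →
            ¬ Star (suc K) s ν a → ¬ ¬ (height a ≤ threshold (suc K) ^ D ⊎ Bad n (↧ₙ r) a)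
¬star⇒bad K {s} ν r n D a 1≤s nz r≡n r≼ν d≤nD ¬star neither = ¬star star
  where
  T d : ℕ
  T = threshold (suc K)
  d = ↧ₙ r
  instance
    h≢0 : ℕ.NonZero (height a)
    h≢0 = height≢0 a 1≤s nz
  star : Star (suc K) s ν a
  star (x , x-prime , x-above , solution) = prime-solution⇒𝒞′ K a x x-prime solution λ j →
    ℕₚ.≰⇒> (small j) , decidable-stable (nonMultiples? (x j) 3 a) (λ ¬h → neither (inj₂ (nz , x j , h^n<x^d j , ¬h)))
    where
    open ℕₚ.≤-Reasoning
    h^n<x^d : ∀ j → height a ^ n < x j ^ d
    h^n<x^d j = above-power ν r n (height a) (x j) r≡n r≼ν (x-above j)
    small : ∀ j → ¬ (x j ≤ T)
    small j x≤T = neither (inj₁ (ℕₚ.≮⇒≥ λ T^D<h → ℕₚ.<⇒≱ (h^n<x^d j) (begin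
      x j ^ d            ≤⟨ ℕₚ.^-monoˡ-≤ d x≤T ⟩
      T ^ d              ≤⟨ ℕₚ.^-monoʳ-≤ T d≤nD ⟩
      T ^ (n * D)        ≡⟨ trans (cong (T ^_) (ℕₚ.*-comm n D)) (sym (ℕₚ.^-*-assoc T D n)) ⟩
      (T ^ D) ^ n        ≤⟨ ℕₚ.^-monoˡ-≤ n (ℕₚ.<⇒≤ T^D<h) ⟩
      height a ^ n       ∎)))

part₁ : ∀ K s → 3 ≤ s → ∀ ν → 1ʳ ≤ʳ ν → ∀ (a : Vec ℤ s) → AllNonZero a → suc (threshold (suc K)) ≤ height a → Star (suc K) s ν a
part₁ K s 3≤s ν 1≤ν a nz H≤h = star-large K ν 1ℚ 1 a 3≤s nz H≤h refl (≤⇒≼ {1ℚ} {ν} 1≤ν) (s≤s z≤n)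

-- Powers of rationals and the passage to real bounds

^ℚ-pos : ∀ {p} n → 0ℚ ℚ.< p → 0ℚ ℚ.< p ^ℚ n
^ℚ-pos zero    p>0 = ℚₚ.positive⁻¹ 1ℚ
^ℚ-pos (suc n) p>0 = *-pos p>0 (^ℚ-pos n p>0)

^ℚ-nonNeg : ∀ {p} n → 0ℚ ℚ.≤ p → 0ℚ ℚ.≤ p ^ℚ n
^ℚ-nonNeg {p} zero    p≥0 = ℚₚ.<⇒≤ (ℚₚ.positive⁻¹ 1ℚ)
^ℚ-nonNeg {p} (suc n) p≥0 = subst (ℚ._≤ p ℚ.* p ^ℚ n) (ℚₚ.*-zeroʳ p)
  (ℚₚ.*-monoˡ-≤-nonNeg p {{ℚ.nonNegative p≥0}} (^ℚ-nonNeg n p≥0))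

^ℚ-monoˡ-≤ : ∀ {p q} n → 0ℚ ℚ.≤ p → p ℚ.≤ q → p ^ℚ n ℚ.≤ q ^ℚ n
^ℚ-monoˡ-≤ zero    p≥0 p≤q = ℚₚ.≤-refl
^ℚ-monoˡ-≤ {p} {q} (suc n) p≥0 p≤q = ℚₚ.≤-trans
  (ℚₚ.*-monoʳ-≤-nonNeg (p ^ℚ n) {{ℚ.nonNegative (^ℚ-nonNeg n p≥0)}} p≤q)
  (ℚₚ.*-monoˡ-≤-nonNeg q {{ℚ.nonNegative (ℚₚ.≤-trans p≥0 p≤q)}} (^ℚ-monoˡ-≤ n p≥0 p≤q))

^ℚ-monoˡ-< : ∀ {p q} n .{{_ : ℕ.NonZero n}} → 0ℚ ℚ.≤ p → p ℚ.< q → p ^ℚ n ℚ.< q ^ℚ n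
^ℚ-monoˡ-< {p} {q} (suc n) p≥0 p<q = ℚₚ.≤-<-trans
  (ℚₚ.*-monoˡ-≤-nonNeg p {{ℚ.nonNegative p≥0}} (^ℚ-monoˡ-≤ n p≥0 (ℚₚ.<⇒≤ p<q)))
  (ℚₚ.*-monoˡ-<-pos (q ^ℚ n) {{ℚ.positive (^ℚ-pos n (ℚₚ.≤-<-trans p≥0 p<q))}} p<q)

fromNat : ℕ → ℚ
fromNat n = + n / 1

fromNat-* : ∀ m n → fromNat (m * n) ≡ fromNat m ℚ.* fromNat n
fromNat-* m n = trans (cong (_/ 1) (ℤₚ.pos-* m n)) (/1-homo-* (+ m) (+ n))

fromNat-+ : ∀ m n → fromNat (m + n) ≡ fromNat m ℚ.+ fromNat n
fromNat-+ m n = /1-homo-+ (+ m) (+ n)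

fromNat-^ : ∀ m n → fromNat (m ^ n) ≡ fromNat m ^ℚ n
fromNat-^ m n = trans (cong (_/ 1) (sym (pos-^ m n))) (/1-homo-^ (+ m) n)

fromNat-mono-≤ : ∀ {m n} → m ≤ n → fromNat m ℚ.≤ fromNat n
fromNat-mono-≤ m≤n = /1-mono-≤ (ℤ.+≤+ m≤n)

fromNat≥0 : ∀ n → 0ℚ ℚ.≤ fromNat n
fromNat≥0 n = fromNat-mono-≤ {0} {n} z≤n

seq-^ℚ : ∀ x n i → seq (x ^ʳ n) i ≡ seq x i ^ℚ n
seq-^ℚ x zero    i = refl
seq-^ℚ x (suc n) i = cong (λ q → seq x i ℚ.* q) (seq-^ℚ x n i)

<⇒eventually : ∀ {x y} → x <ʳ y → ∃[ N ] ∀ n → N ≤ n → seq x n ℚ.< seq y n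
<⇒eventually {x} {y} (ε , ε>0 , N , lt) = N , λ n le → ℚₚ.≤-<-trans
  (subst (ℚ._≤ seq x n ℚ.+ ε) (ℚₚ.+-identityʳ (seq x n)) (ℚₚ.+-monoʳ-≤ (seq x n) (ℚₚ.<⇒≤ ε>0))) (lt n le)

-- To be read as L ≤ C B^(m/n) and B^(m/n) < Y. The common exponent dn arises because n is the
-- denominator of q and d that of the rational substitute for λ.
power-comparison : ∀ (Y : ℚ) C B L m n d .{{_ : ℕ.NonZero n}} .{{_ : ℕ.NonZero d}} → 0ℚ ℚ.< Y → fromNat (B ^ m) ℚ.< Y ^ℚ n →
  L ^ (d * n) ≤ C ^ (d * n) * B ^ (m * d) → ¬ (fromNat C ℚ.* Y ℚ.< fromNat L)
power-comparison Y C B L m n d Y>0 B^m<Y^n L≤ CY<L = ℚₚ.<-irrefl refl (begin-strict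
  fromNat L ^ℚ k                              ≡⟨ sym (fromNat-^ L k) ⟩
  fromNat (L ^ k)                             ≤⟨ fromNat-mono-≤ L≤ ⟩
  fromNat (C ^ k * B ^ (m * d))               ≡⟨ trans (fromNat-* (C ^ k) (B ^ (m * d))) (cong (ℚ._* fromNat (B ^ (m * d))) (fromNat-^ C k)) ⟩
  fromNat C ^ℚ k ℚ.* fromNat (B ^ (m * d))    ≤⟨ ℚₚ.*-monoˡ-≤-nonNeg (fromNat C ^ℚ k) {{ℚ.nonNegative (^ℚ-nonNeg k (fromNat≥0 C))}} B≤ ⟩
  fromNat C ^ℚ k ℚ.* Y ^ℚ k                   ≡⟨ sym (^ℚ-distrib-* (fromNat C) Y k) ⟩
  (fromNat C ℚ.* Y) ^ℚ k                      <⟨ ^ℚ-monoˡ-< k {{ℕₚ.m*n≢0 d n}} CY≥0 CY<L ⟩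
  fromNat L ^ℚ k                              ∎)
  where
  open ℚₚ.≤-Reasoning
  k = d * n
  CY≥0 : 0ℚ ℚ.≤ fromNat C ℚ.* Y
  CY≥0 = subst (ℚ._≤ fromNat C ℚ.* Y) (ℚₚ.*-zeroʳ (fromNat C)) (ℚₚ.*-monoˡ-≤-nonNeg (fromNat C) {{ℚ.nonNegative (fromNat≥0 C)}} (ℚₚ.<⇒≤ Y>0))
  B≤ : fromNat (B ^ (m * d)) ℚ.≤ Y ^ℚ k
  B≤ = begin
    fromNat (B ^ (m * d))       ≡⟨ trans (cong fromNat (sym (ℕₚ.^-*-assoc B m d))) (fromNat-^ (B ^ m) d) ⟩
    fromNat (B ^ m) ^ℚ d        ≤⟨ ^ℚ-monoˡ-≤ d (fromNat≥0 (B ^ m)) (ℚₚ.<⇒≤ B^m<Y^n) ⟩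
    (Y ^ℚ n) ^ℚ d               ≡⟨ trans (^ℚ-assocʳ Y n d) (cong (Y ^ℚ_) (ℕₚ.*-comm n d)) ⟩
    Y ^ℚ k                      ∎

fromℕ-positive : ∀ n .{{_ : ℕ.NonZero n}} → 0ʳ <ʳ fromℕ n
fromℕ-positive (suc n) = <-≤-trans {0ʳ} {1ʳ} {fromℕ (suc n)} 0<1
  (λ lt → ℚₚ.<-irrefl refl (ℚₚ.<-≤-trans (constant-< {fromℕ (suc n)} {1ʳ} (fromNat (suc n)) 1ℚ (λ _ → refl) (λ _ → refl) lt) (fromNat-mono-≤ {1} {suc n} (s≤s z≤n))))

¬C*y<L : ∀ A y C B L m n d .{{_ : ℕ.NonZero B}} .{{_ : ℕ.NonZero n}} .{{_ : ℕ.NonZero d}} → 0ʳ <ʳ y → fromℕ B ≤ʳ A →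
  (A ^ʳ m) <ʳ (y ^ʳ n) → L ^ (d * n) ≤ C ^ (d * n) * B ^ (m * d) → ¬ ((fromℕ C *ʳ y) <ʳ fromℕ L)
¬C*y<L A y C B L m n d y>0 B≤A A^m<y^n L≤ Cy<L =
  power-comparison (seq y i) C B L m n d
    (proj₂ ev₁ i (ℕₚ.≤-trans (ℕₚ.m≤m⊔n N₁ N₂) (ℕₚ.m≤m⊔n (N₁ ℕ.⊔ N₂) N₃)))
    (subst₂ ℚ._<_ (fromℕ-^ B m i) (seq-^ℚ y n i) (proj₂ ev₂ i (ℕₚ.≤-trans (ℕₚ.m≤n⊔m N₁ N₂) (ℕₚ.m≤m⊔n (N₁ ℕ.⊔ N₂) N₃))))
    L≤ (proj₂ ev₃ i (ℕₚ.m≤n⊔m (N₁ ℕ.⊔ N₂) N₃))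
  where
  B^m<y^n : (fromℕ B ^ʳ m) <ʳ (y ^ʳ n)
  B^m<y^n = ≤-<-trans {fromℕ B ^ʳ m} {A ^ʳ m} {y ^ʳ n} (^-monoˡ-≤ {fromℕ B} {A} (fromℕ-positive B) B≤A m) A^m<y^n
  ev₁ = <⇒eventually {0ʳ} {y} y>0
  ev₂ = <⇒eventually {fromℕ B ^ʳ m} {y ^ʳ n} B^m<y^n
  ev₃ = <⇒eventually {fromℕ C *ʳ y} {fromℕ L} Cy<L
  N₁ N₂ N₃ i : ℕ
  N₁ = proj₁ ev₁
  N₂ = proj₁ ev₂
  N₃ = proj₁ ev₃
  i = N₁ ℕ.⊔ N₂ ℕ.⊔ N₃

-- r is the larger of δ and (S - q)/w.
choose-r : ∀ ν e S w q δ → (∀ i → seq e i ≡ S ℚ.+ ℚ.- (seq ν i ℚ.* w)) → 0ℚ ℚ.< w → ι δ <ʳ ν → e <ʳ ι q →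
           ∃[ r ] ι r <ʳ ν × δ ℚ.≤ r × S ℚ.≤ q ℚ.+ r ℚ.* w
choose-r ν e S w q δ e≡ w>0 δ<ν (ε , ε>0 , N , e<q) = by-cases (ℚₚ.≤-total δ r₁)
  where
  open ℚₚ.≤-Reasoning
  open ℚ-Solver
  instance
    w-positive : ℚ.Positive w
    w-positive = ℚ.positive w>0
    w-nonZero : ℚ.NonZero w
    w-nonZero = ℚₚ.pos⇒nonZero w
  v = ℚ.1/ w
  v>0 : 0ℚ ℚ.< v
  v>0 = ℚₚ.positive⁻¹ v {{ℚₚ.1/pos⇒pos w}}
  -- This solves S - r w = q for r, so e < q amounts to r₁ < ν. If r₁ is too small, possibly
  -- negative, δ takes its place.
  r₁ = (S ℚ.- q) ℚ.* v
  *v*w : ∀ p → p ℚ.* v ℚ.* w ≡ p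
  *v*w p = trans (ℚₚ.*-assoc p v w) (trans (cong (p ℚ.*_) (ℚₚ.*-inverseˡ w)) (ℚₚ.*-identityʳ p))
  S≡q+r₁w : S ≡ q ℚ.+ r₁ ℚ.* w
  S≡q+r₁w = trans (solve 2 (λ S q → S := q :+ (S :- q)) refl S q) (cong (q ℚ.+_) (sym (*v*w (S ℚ.- q))))
  r₁<ν : ι r₁ <ʳ ν
  r₁<ν = ε ℚ.* v , *-pos ε>0 v>0 , N , λ i le → ℚₚ.*-cancelʳ-<-nonNeg w {{ℚ.nonNegative (ℚₚ.<⇒≤ w>0)}} (begin-strict
    (r₁ ℚ.+ ε ℚ.* v) ℚ.* w                          ≡⟨ trans (ℚₚ.*-distribʳ-+ w r₁ (ε ℚ.* v)) (cong₂ ℚ._+_ (*v*w (S ℚ.- q)) (*v*w ε)) ⟩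
    S ℚ.- q ℚ.+ ε                                   ≡⟨ solve 4 (λ S q ε z → S :- q :+ ε := ((S :+ :- z) :+ ε) :+ (z :- q)) refl S q ε (seq ν i ℚ.* w) ⟩
    ((S ℚ.+ ℚ.- (seq ν i ℚ.* w)) ℚ.+ ε) ℚ.+ (seq ν i ℚ.* w ℚ.- q)
      <⟨ ℚₚ.+-monoˡ-< (seq ν i ℚ.* w ℚ.- q) (subst (λ z → z ℚ.+ ε ℚ.< q) (e≡ i) (e<q i le)) ⟩
    q ℚ.+ (seq ν i ℚ.* w ℚ.- q)                     ≡⟨ solve 2 (λ q z → q :+ (z :- q) := z) refl q (seq ν i ℚ.* w) ⟩
    seq ν i ℚ.* w                                   ∎)
  by-cases : δ ℚ.≤ r₁ ⊎ r₁ ℚ.≤ δ → ∃[ r ] ι r <ʳ ν × δ ℚ.≤ r × S ℚ.≤ q ℚ.+ r ℚ.* w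
  by-cases (inj₁ δ≤r₁) = r₁ , r₁<ν , δ≤r₁ , ℚₚ.≤-reflexive S≡q+r₁w
  by-cases (inj₂ r₁≤δ) = δ , δ<ν , ℚₚ.≤-refl , ℚₚ.≤-trans (ℚₚ.≤-reflexive S≡q+r₁w)
    (ℚₚ.+-monoʳ-≤ q (ℚₚ.*-monoʳ-≤-nonNeg w {{ℚ.nonNegative (ℚₚ.<⇒≤ w>0)}} r₁≤δ))

clear-denominators : ∀ s u q r m n → ↥ q ≡ + m → ↥ r ≡ + n → fromNat s ℚ.≤ q ℚ.+ r ℚ.* fromNat u →
                     s * (↧ₙ q * ↧ₙ r) ≤ m * ↧ₙ r + n * u * ↧ₙ q
clear-denominators s u q r m n q≡m r≡n le = /1-cancel-≤ _ _ (begin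
  fromNat (s * (e * d))                                              ≡⟨ fromNat-* s (e * d) ⟩
  fromNat s ℚ.* fromNat (e * d)                                      ≤⟨ ℚₚ.*-monoʳ-≤-nonNeg (fromNat (e * d)) {{ℚ.nonNegative (fromNat≥0 (e * d))}} le ⟩
  (q ℚ.+ r ℚ.* fromNat u) ℚ.* fromNat (e * d)                        ≡⟨ cong (λ z → (q ℚ.+ r ℚ.* fromNat u) ℚ.* z) (fromNat-* e d) ⟩
  (q ℚ.+ r ℚ.* fromNat u) ℚ.* (fromNat e ℚ.* fromNat d)
    ≡⟨ solve 5 (λ q r u e d → (q :+ r :* u) :* (e :* d) := (q :* e) :* d :+ (r :* d) :* u :* e) refl q r (fromNat u) (fromNat e) (fromNat d) ⟩
  (q ℚ.* fromNat e) ℚ.* fromNat d ℚ.+ (r ℚ.* fromNat d) ℚ.* fromNat u ℚ.* fromNat e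
    ≡⟨ cong₂ (λ x y → x ℚ.* fromNat d ℚ.+ y ℚ.* fromNat u ℚ.* fromNat e) (trans (*-↧ q) (cong (_/ 1) q≡m)) (trans (*-↧ r) (cong (_/ 1) r≡n)) ⟩
  fromNat m ℚ.* fromNat d ℚ.+ fromNat n ℚ.* fromNat u ℚ.* fromNat e
    ≡⟨ sym (trans (fromNat-+ (m * d) (n * u * e)) (cong₂ ℚ._+_ (fromNat-* m d) (trans (fromNat-* (n * u) e) (cong (ℚ._* fromNat e) (fromNat-* n u))))) ⟩
  fromNat (m * d + n * u * e) ∎)
  where
  open ℚₚ.≤-Reasoning
  open ℚ-Solver
  e d : ℕ
  e = ↧ₙ q
  d = ↧ₙ r

numerator : ∀ r → 0ℚ ℚ.< r → ∃[ n ] ↥ r ≡ + n × 1 ≤ n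
numerator r r>0 = go (↥ r) (1≤↥ r r>0)
  where
  go : ∀ i → + 1 ℤ.≤ i → ∃[ n ] i ≡ + n × 1 ≤ n
  go (+ n) (ℤ.+≤+ 1≤n) = n , refl , 1≤n

-- Double negation passes through a finite conjunction. As ≤ on the reals is a negation, this is
-- enough to classify all the tuples of a list inside a count.
¬¬-all : ∀ {A : Set} {Q : A → Set} {xs} → ListAll.All (λ x → ¬ ¬ Q x) xs → ¬ ¬ ListAll.All Q xs
¬¬-all []         ¬all = ¬all []
¬¬-all (¬¬q ∷ qs) ¬all = ¬¬q (λ q → ¬¬-all qs (λ rest → ¬all (q ∷ rest)))

-- The largest height in the list takes the place of ⌊A⌋, which cannot be read off from a real A.
-- The initial value 1 keeps it nonzero and is harmless as A ≥ 1.
maxHeight : ∀ {s} → List (Vec ℤ s) → ℕ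
maxHeight = List.foldr (λ a h → height a ℕ.⊔ h) 1

1≤maxHeight : ∀ {s} (as : List (Vec ℤ s)) → 1 ≤ maxHeight as
1≤maxHeight []       = s≤s z≤n
1≤maxHeight (a ∷ as) = ℕₚ.≤-trans (1≤maxHeight as) (ℕₚ.m≤n⊔m (height a) (maxHeight as))

height≤maxHeight : ∀ {s} (as : List (Vec ℤ s)) → ListAll.All (λ a → height a ≤ maxHeight as) as
height≤maxHeight []       = []
height≤maxHeight (a ∷ as) = ℕₚ.m≤m⊔n (height a) (maxHeight as) ∷
  ListAll.map (λ h≤ → ℕₚ.≤-trans h≤ (ℕₚ.m≤n⊔m (height a) (maxHeight as))) (height≤maxHeight as)

fromℕ-⊔-≤ : ∀ A m n → fromℕ m ≤ʳ A → fromℕ n ≤ʳ A → fromℕ (m ℕ.⊔ n) ≤ʳ A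
fromℕ-⊔-≤ A m n m≤A n≤A = by-cases (m ℕ.⊔ n) (ℕₚ.⊔-sel m n)
  where
  by-cases : ∀ o → o ≡ m ⊎ o ≡ n → fromℕ o ≤ʳ A
  by-cases o (inj₁ refl) = m≤A
  by-cases o (inj₂ refl) = n≤A

maxHeight≤ : ∀ {s} A (as : List (Vec ℤ s)) → 1ʳ ≤ʳ A → ListAll.All (λ a → fromℕ (height a) ≤ʳ A) as → fromℕ (maxHeight as) ≤ʳ A
maxHeight≤ A []       1≤A []         = λ lt → 1≤A (<-resp {A} {A} {fromℕ 1} {1ʳ} (λ _ → refl) (λ _ → refl) lt)
maxHeight≤ A (a ∷ as) 1≤A (h≤A ∷ hs) = fromℕ-⊔-≤ A (height a) (maxHeight as) h≤A (maxHeight≤ A as 1≤A hs)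

bad⇒n<d : ∀ {n d s} {a : Vec ℤ s} → 3 ≤ s → Bad n d a → n < d
bad⇒n<d {n} {d} {s} {a} 3≤s (nz , m , h^n<m^d , ¬h) = ℕₚ.≰⇒> λ d≤n → ℕₚ.<⇒≱ h^n<m^d (begin
  m ^ d           ≤⟨ ℕₚ.^-monoˡ-≤ d (¬nonMultiples⇒≤height 2 a 3≤s nz ¬h) ⟩
  height a ^ d    ≤⟨ ℕₚ.^-monoʳ-≤ (height a) {{height≢0 a (ℕₚ.≤-trans (s≤s z≤n) 3≤s) nz}} d≤n ⟩
  height a ^ n    ∎)
  where open ℕₚ.≤-Reasoning

-- The cleared inequality says s - (n/d)(s - 3) ≤ m/e. If n > d there is no bad tuple, because a
-- modulus above |𝐚| divides no entry, and only the box |𝐚| ≤ H remains.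
count-bad : ∀ s n d m e H B .{{_ : ℕ.NonZero d}} .{{_ : ℕ.NonZero e}} .{{_ : ℕ.NonZero H}} .{{_ : ℕ.NonZero B}} → 4 ≤ s →
            s * (e * d) ≤ m * d + n * (s ∸ 3) * e → (as : List (Vec ℤ s)) → Unique as →
            ListAll.All (λ a → height a ≤ B × (height a ≤ H ⊎ Bad n d a)) as →
            length as ^ (d * e) ≤ countConstant s H ^ (d * e) * B ^ (m * d)
count-bad s n d m e H B 4≤s cleared as uq all with n ℕₚ.≤? d
... | no n≰d = begin
  length as ^ (d * e)                                ≤⟨ ℕₚ.^-monoˡ-≤ (d * e) (ℕₚ.≤-trans (count-low H as uq (ListAll.map low all)) C₁≤C) ⟩
  countConstant s H ^ (d * e)                        ≤⟨ ℕₚ.m≤m*n _ (B ^ (m * d)) {{ℕₚ.m^n≢0 B (m * d)}} ⟩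
  countConstant s H ^ (d * e) * B ^ (m * d)          ∎
  where
  open ℕₚ.≤-Reasoning
  C₁≤C : 6 ^ s * H ^ s ≤ countConstant s H
  C₁≤C = ℕₚ.≤-trans (ℕₚ.m≤n*m (6 ^ s * H ^ s) 2) (ℕₚ.m≤m+n (2 * (6 ^ s * H ^ s)) _)
  low : ∀ {a} → height a ≤ B × (height a ≤ H ⊎ Bad n d a) → height a ≤ H
  low (_ , inj₁ h≤H)      = h≤H
  low {a} (_ , inj₂ bad)  = contradiction (ℕₚ.<⇒≤ (bad⇒n<d {a = a} (ℕₚ.≤-trans (ℕₚ.n≤1+n 3) 4≤s) bad)) n≰d
... | yes n≤d = begin
  length as ^ (d * e)                                ≡⟨ sym (ℕₚ.^-*-assoc (length as) d e) ⟩
  (length as ^ d) ^ e                                ≤⟨ ℕₚ.^-monoˡ-≤ e (count s n d N H B 4≤s n≤d exponents as uq all) ⟩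
  (C ^ d * B ^ N) ^ e                                ≡⟨ trans (^-distribʳ-* e (C ^ d) (B ^ N)) (cong₂ _*_ (ℕₚ.^-*-assoc C d e) (ℕₚ.^-*-assoc B N e)) ⟩
  C ^ (d * e) * B ^ (N * e)                          ≤⟨ ℕₚ.*-monoʳ-≤ (C ^ (d * e)) (ℕₚ.^-monoʳ-≤ B Ne≤md) ⟩
  C ^ (d * e) * B ^ (m * d)                          ∎
  where
  open ℕₚ.≤-Reasoning
  open ℕ-Solver
  C = countConstant s H
  u = s ∸ 3
  N = s * d ∸ n * u
  exponents : n * u + N ≡ s * d
  exponents = ℕₚ.m+[n∸m]≡n (ℕₚ.≤-trans (ℕₚ.*-mono-≤ n≤d (ℕₚ.m∸n≤m s 3)) (ℕₚ.≤-reflexive (ℕₚ.*-comm d s)))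
  Ne≤md : N * e ≤ m * d
  Ne≤md = ℕₚ.+-cancelʳ-≤ (n * u * e) (N * e) (m * d) (begin
    N * e + n * u * e       ≡⟨ solve 3 (λ N x e → N :* e :+ x :* e := (x :+ N) :* e) refl N (n * u) e ⟩
    (n * u + N) * e         ≡⟨ cong (_* e) exponents ⟩
    s * d * e               ≡⟨ solve 3 (λ s d e → s :* d :* e := s :* (e :* d)) refl s d e ⟩
    s * (e * d)             ≤⟨ cleared ⟩
    m * d + n * u * e       ∎)

-- Bounds for the number of exceptional tuples

threshold≢0 : ∀ K → ℕ.NonZero (threshold (suc K))
threshold≢0 K = ℕₚ.m*n≢0 16 (k * k * (k * k)) {{_}} {{ℕₚ.m*n≢0 (k * k) (k * k) {{ℕₚ.m*n≢0 k k}} {{ℕₚ.m*n≢0 k k}}}}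
  where
  k = suc K

s-3 : ∀ {s} → 3 ≤ s → + s ℤ.- + 3 ≡ + (s ∸ 3)
s-3 {s} 3≤s = trans (ℤₚ.m-n≡m⊖n s 3) (ℤₚ.⊖-≥ 3≤s)

seq-exponent : ∀ {s} ν → 3 ≤ s → ∀ i → seq (exponent s ν) i ≡ fromNat s ℚ.+ ℚ.- (seq ν i ℚ.* fromNat (s ∸ 3))
seq-exponent {s} ν 3≤s i = cong (λ z → fromNat s ℚ.+ ℚ.- (seq ν i ℚ.* (z / 1))) (s-3 3≤s)

s-3>0 : ∀ {s} → 4 ≤ s → 0ℚ ℚ.< fromNat (s ∸ 3)
s-3>0 {s} 4≤s = /1-mono-< (ℤ.+<+ (ℕₚ.∸-monoˡ-≤ 3 4≤s))

-- For a rational q above the exponent, r < ν is chosen with s - r(s - 3) ≤ q, so that the count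
-- made with r is at most C B^q ≤ C A^q < C y. C depends on ν only through the lower bound δ of r,
-- and not on q or r; so it serves for every y at once. The goal is a contradiction, for which the
-- doubly negated classification of the tuples suffices.
count-exceptional : ∀ K s → 4 ≤ s → ∀ ν δ → 0ℚ ℚ.< δ → ι δ <ʳ ν →
  ∀ A → 1ʳ ≤ʳ A → ∀ y q m → 0ʳ <ʳ y → exponent s ν <ʳ ι q → ↥ q ≡ + m → (A ^ʳ m) <ʳ (y ^ʳ ↧ₙ q) →
  ∀ C → countConstant s (threshold (suc K) ^ ↧ₙ δ) ≡ C → # Exceptional (suc K) s ν A ≤ (fromℕ C *ʳ y)
count-exceptional K s 4≤s ν δ δ>0 δ<ν A 1≤A y q m y>0 e<q q≡m A^m<y^n C ≡C as uq all Cy<L =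
  go (choose-r ν (exponent s ν) (fromNat s) (fromNat (s ∸ 3)) q δ (seq-exponent ν 3≤s) (s-3>0 4≤s) δ<ν e<q) (numerator δ δ>0)
  where
  height-bound : ∀ a → Exceptional (suc K) s ν A a → fromℕ (height a) ≤ʳ A
  height-bound a (_ , h≤A , _) = h≤A
  3≤s : 3 ≤ s
  3≤s = ℕₚ.≤-trans (ℕₚ.n≤1+n 3) 4≤s
  D H B : ℕ
  D = ↧ₙ δ
  H = threshold (suc K) ^ D
  B = maxHeight as
  instance
    H≢0 : ℕ.NonZero H
    H≢0 = ℕₚ.m^n≢0 (threshold (suc K)) D {{threshold≢0 K}}
    B≢0 : ℕ.NonZero B
    B≢0 = ℕ.>-nonZero (1≤maxHeight as)
  go : ∃[ r ] ι r <ʳ ν × δ ℚ.≤ r × fromNat s ℚ.≤ q ℚ.+ r ℚ.* fromNat (s ∸ 3) → ∃[ j ] ↥ δ ≡ + j × 1 ≤ j → ⊥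
  go (r , r<ν , δ≤r , S≤) (j , δ≡j , 1≤j) = with-numerator (numerator r (ℚₚ.<-≤-trans δ>0 δ≤r))
    where
    with-numerator : ∃[ n ] ↥ r ≡ + n × 1 ≤ n → ⊥
    with-numerator (n , r≡n , _) = ¬¬-all
      (ListAll.tabulate λ {a} a∈ ¬Q → let nz , _ , ¬star = ListAll.lookup all a∈ in
        ¬star⇒bad K ν r n D a (ℕₚ.≤-trans (s≤s z≤n) 3≤s) nz r≡n (<⇒≼ {r} {ν} r<ν) d≤nD ¬star
          (λ c → ¬Q (ListAll.lookup (height≤maxHeight as) a∈ , c)))
      (λ Q → ¬C*y<L A y C B (length as) m (↧ₙ q) (↧ₙ r) y>0
        (maxHeight≤ A as 1≤A (ListAll.map (λ {a} → height-bound a) all)) A^m<y^n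
        (subst (λ C → length as ^ (↧ₙ r * ↧ₙ q) ≤ C ^ (↧ₙ r * ↧ₙ q) * B ^ (m * ↧ₙ r)) ≡C
          (count-bad s n (↧ₙ r) m (↧ₙ q) H B 4≤s (clear-denominators s (s ∸ 3) q r m n q≡m r≡n S≤) as uq Q)) Cy<L)
      where
      d≤nD : ↧ₙ r ≤ n * D
      d≤nD = ℕₚ.≤-trans (ℕₚ.m≤n*m (↧ₙ r) j {{ℕ.>-nonZero 1≤j}}) (fraction-≤ δ r j n δ≡j r≡n δ≤r)

-- The cap at 1 is for the auxiliary exponent s - δ, which has to be positive. Half of the gap in 0
-- < ν bounds δ, and the other half is the gap in δ < ν.
positive-bound : ∀ ν → 0ʳ <ʳ ν → ∃[ δ ] 0ℚ ℚ.< δ × δ ℚ.≤ 1ℚ × ι δ <ʳ ν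
positive-bound ν (ε , ε>0 , N , lt) = go (halve ε ε>0)
  where
  open ℚₚ.≤-Reasoning
  go : (∃[ η ] 0ℚ ℚ.< η × (∀ q → q ℚ.+ η ℚ.+ η ≡ q ℚ.+ ε)) → ∃[ δ ] 0ℚ ℚ.< δ × δ ℚ.≤ 1ℚ × ι δ <ʳ ν
  go (η , η>0 , 2η≡ε) = η ℚ.⊓ 1ℚ , min>0 (ℚₚ.⊓-sel η 1ℚ) , ℚₚ.p⊓q≤q η 1ℚ , η , η>0 , N , λ n le → begin-strict
    η ℚ.⊓ 1ℚ ℚ.+ η       ≤⟨ ℚₚ.+-monoˡ-≤ η (ℚₚ.p⊓q≤p η 1ℚ) ⟩
    η ℚ.+ η              ≡⟨ cong (ℚ._+ η) (sym (ℚₚ.+-identityˡ η)) ⟩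
    0ℚ ℚ.+ η ℚ.+ η       ≡⟨ 2η≡ε 0ℚ ⟩
    0ℚ ℚ.+ ε             <⟨ lt n le ⟩
    seq ν n              ∎
    where
    min>0 : η ℚ.⊓ 1ℚ ≡ η ⊎ η ℚ.⊓ 1ℚ ≡ 1ℚ → 0ℚ ℚ.< η ℚ.⊓ 1ℚ
    min>0 (inj₁ eq) = subst (0ℚ ℚ.<_) (sym eq) η>0
    min>0 (inj₂ eq) = subst (0ℚ ℚ.<_) (sym eq) (ℚₚ.positive⁻¹ 1ℚ)

negative-numerator : ∀ q {m} → ↥ q ≡ -[1+ m ] → q ℚ.≤ 0ℚ
negative-numerator (mkℚ _ _ _) refl = ℚ.*≤* ℤ.-≤+

¬C*y<0 : ∀ C y → 0ʳ <ʳ y → ¬ ((fromℕ C *ʳ y) <ʳ fromℕ 0)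
¬C*y<0 C y y>0 lt = contra (<⇒eventually {0ʳ} {y} y>0) (<⇒eventually {fromℕ C *ʳ y} {fromℕ 0} lt)
  where
  contra : (∃[ N ] ∀ n → N ≤ n → 0ℚ ℚ.< seq y n) → ¬ (∃[ N ] ∀ n → N ≤ n → fromNat C ℚ.* seq y n ℚ.< fromNat 0)
  contra (M , pos) (N , neg) = ℚₚ.<-irrefl refl (ℚₚ.≤-<-trans
    (subst (ℚ._≤ fromNat C ℚ.* Y) (ℚₚ.*-zeroʳ (fromNat C)) (ℚₚ.*-monoˡ-≤-nonNeg (fromNat C) {{ℚ.nonNegative (fromNat≥0 C)}} (ℚₚ.<⇒≤ (pos (M ℕ.⊔ N) (ℕₚ.m≤m⊔n M N)))))
    (neg (M ℕ.⊔ N) (ℕₚ.m≤n⊔m M N)))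
    where
    Y = seq y (M ℕ.⊔ N)

module Exceptions (K s : ℕ) (4≤s : 4 ≤ s) (ν : ℝ) (δ : ℚ) (δ>0 : 0ℚ ℚ.< δ) (δ≤1 : δ ℚ.≤ 1ℚ) (δ<ν : ι δ <ʳ ν)
  (C : ℕ) (≡C : countConstant s (threshold (suc K) ^ ↧ₙ δ) ≡ C) where

  3≤s : 3 ≤ s
  3≤s = ℕₚ.≤-trans (ℕₚ.n≤1+n 3) 4≤s

  -- A negative exponent q forces ν > 1.
  star-negative : ∀ q {m} → ↥ q ≡ -[1+ m ] → exponent s ν <ʳ ι q → ∀ (a : Vec ℤ s) → AllNonZero a → suc (threshold (suc K)) ≤ height a →
                  Star (suc K) s ν a
  star-negative q q≡m e<q a nz H≤h = go (choose-r ν (exponent s ν) (fromNat s) w q δ (seq-exponent ν 3≤s) (s-3>0 4≤s) δ<ν e<q)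
    where
    w = fromNat (s ∸ 3)
    go : ∃[ r ] ι r <ʳ ν × δ ℚ.≤ r × fromNat s ℚ.≤ q ℚ.+ r ℚ.* w → Star (suc K) s ν a
    go (r , r<ν , δ≤r , S≤) = with-numerator (numerator r (ℚₚ.<-≤-trans δ>0 δ≤r))
      where
      1≤r : 1ℚ ℚ.≤ r
      1≤r = ℚₚ.*-cancelʳ-≤-pos w {{ℚ.positive (s-3>0 4≤s)}} (begin
        1ℚ ℚ.* w           ≡⟨ ℚₚ.*-identityˡ w ⟩
        w                  ≤⟨ fromNat-mono-≤ (ℕₚ.m∸n≤m s 3) ⟩
        fromNat s          ≤⟨ S≤ ⟩
        q ℚ.+ r ℚ.* w      ≤⟨ ℚₚ.+-monoˡ-≤ (r ℚ.* w) (negative-numerator q q≡m) ⟩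
        0ℚ ℚ.+ r ℚ.* w     ≡⟨ ℚₚ.+-identityˡ (r ℚ.* w) ⟩
        r ℚ.* w            ∎)
        where open ℚₚ.≤-Reasoning
      with-numerator : ∃[ n ] ↥ r ≡ + n × 1 ≤ n → Star (suc K) s ν a
      with-numerator (n , r≡n , _) = star-large K ν r n a 3≤s nz H≤h r≡n (<⇒≼ {r} {ν} r<ν)
        (subst₂ _≤_ (ℕₚ.*-identityˡ (↧ₙ r)) (ℕₚ.*-identityʳ n) (fraction-≤ 1ℚ r 1 n refl r≡n 1≤r))

  -- An admissible y may come with a negative q. Then no tuple above the threshold is exceptional,
  -- and only the empty list has to be counted; a negative power of A could not absorb tuples of
  -- small height.
  large-exceptions : ∀ A → 1ʳ ≤ʳ A → # (λ a → suc (threshold (suc K)) ≤ height a × Exceptional (suc K) s ν A a) ≤ C · A ^ exponent s ν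
  large-exceptions A 1≤A y (y>0 , q , e<q , A^q<y) as uq all = by-sign (↥ q) refl A^q<y as uq all
    where
    by-sign : ∀ i → ↥ q ≡ i → A ℝ.^ℤ i ≺ (y ^ʳ ↧ₙ q) →
              # (λ a → suc (threshold (suc K)) ≤ height a × Exceptional (suc K) s ν A a) ≤ (fromℕ C *ʳ y)
    by-sign (+ m)     q≡m lt as uq all =
      count-exceptional K s 4≤s ν δ δ>0 δ<ν A 1≤A y q m y>0 e<q q≡m lt C ≡C as uq (ListAll.map proj₂ all)
    by-sign -[1+ m ]  q≡m lt [] uq all = ¬C*y<0 C y y>0
    by-sign -[1+ m ]  q≡m lt (a ∷ as) uq ((H≤h , nz , _ , ¬star) ∷ _) = contradiction (star-negative q q≡m e<q a nz H≤h) ¬star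

  -- A nonnegative exponent makes every q above it positive, and the tuples of small height are then
  -- absorbed in C.
  all-exceptions : 0ʳ ≤ʳ exponent s ν → ∀ A → 1ʳ ≤ʳ A → # Exceptional (suc K) s ν A ≤ C · A ^ exponent s ν
  all-exceptions 0≤e A 1≤A y (y>0 , q , e<q , A^q<y) = go (numerator q (≤⇒≼ {0ℚ} {exponent s ν} 0≤e q e<q))
    where
    to-^ : ∀ i m → i ≡ + m → A ℝ.^ℤ i ≺ (y ^ʳ ↧ₙ q) → (A ^ʳ m) <ʳ (y ^ʳ ↧ₙ q)
    to-^ _ m refl lt = lt
    go : ∃[ m ] ↥ q ≡ + m × 1 ≤ m → # Exceptional (suc K) s ν A ≤ (fromℕ C *ʳ y)
    go (m , q≡m , _) = count-exceptional K s 4≤s ν δ δ>0 δ<ν A 1≤A y q m y>0 e<q q≡m (to-^ (↥ q) m q≡m A^q<y) C ≡C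

  -- An exponent strictly between s - ν(s - 3) and s.
  q : ℚ
  q = fromNat s ℚ.- δ

  q>0 : 0ℚ ℚ.< q
  q>0 = subst (ℚ._< q) (ℚₚ.+-inverseʳ 1ℚ) (ℚₚ.+-mono-<-≤ (/1-mono-< {+ 1} {+ s} (ℤ.+<+ (ℕₚ.≤-trans (s≤s (s≤s z≤n)) 4≤s))) (ℚₚ.neg-antimono-≤ δ≤1))

  q<s : q ℚ.< fromNat s
  q<s = subst (q ℚ.<_) (ℚₚ.+-identityʳ (fromNat s)) (ℚₚ.+-monoʳ-< (fromNat s) (ℚₚ.neg-antimono-< δ>0))

  -- Since ν > δ and s - 3 ≥ 1, also ν(s - 3) > δ.
  e<q : exponent s ν <ʳ ι q
  e<q = go δ<ν
    where
    go : ι δ <ʳ ν → exponent s ν <ʳ ι q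
    go (ε , ε>0 , N , lt) = ε , ε>0 , N , λ i le → subst (λ z → z ℚ.+ ε ℚ.< q) (sym (seq-exponent ν 3≤s i)) (gap (seq ν i) (lt i le))
      where
      open ℚₚ.≤-Reasoning
      open ℚ-Solver
      w = fromNat (s ∸ 3)
      gap : ∀ v → δ ℚ.+ ε ℚ.< v → fromNat s ℚ.+ ℚ.- (v ℚ.* w) ℚ.+ ε ℚ.< q
      gap v δ+ε<v = begin-strict
        fromNat s ℚ.+ ℚ.- (v ℚ.* w) ℚ.+ ε                ≤⟨ ℚₚ.+-monoˡ-≤ ε (ℚₚ.+-monoʳ-≤ (fromNat s) (ℚₚ.neg-antimono-≤ v≤vw)) ⟩
        fromNat s ℚ.+ ℚ.- v ℚ.+ ε                        ≡⟨ solve 4 (λ S v ε δ → S :+ (:- v) :+ ε := (δ :+ ε) :+ (S :- v :- δ)) refl (fromNat s) v ε δ ⟩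
        (δ ℚ.+ ε) ℚ.+ (fromNat s ℚ.- v ℚ.- δ)            <⟨ ℚₚ.+-monoˡ-< (fromNat s ℚ.- v ℚ.- δ) δ+ε<v ⟩
        v ℚ.+ (fromNat s ℚ.- v ℚ.- δ)                    ≡⟨ solve 3 (λ S v δ → v :+ (S :- v :- δ) := S :- δ) refl (fromNat s) v δ ⟩
        q                                                ∎
        where
        v>0 : 0ℚ ℚ.< v
        v>0 = ℚₚ.<-trans (ℚₚ.+-mono-< δ>0 ε>0) δ+ε<v
        v≤vw : v ℚ.≤ v ℚ.* w
        v≤vw = begin
          v            ≡⟨ sym (ℚₚ.*-identityʳ v) ⟩
          v ℚ.* 1ℚ     ≤⟨ ℚₚ.*-monoˡ-≤-nonNeg v {{ℚ.nonNegative (ℚₚ.<⇒≤ v>0)}} (fromNat-mono-≤ {1} (ℕₚ.∸-monoˡ-≤ 3 4≤s)) ⟩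
          v ℚ.* w      ∎

  numerator-q : ∃[ m ] ↥ q ≡ + m × m < s * ↧ₙ q
  numerator-q = go (numerator q q>0)
    where
    open ℚₚ.≤-Reasoning
    go : ∃[ m ] ↥ q ≡ + m × 1 ≤ m → ∃[ m ] ↥ q ≡ + m × m < s * ↧ₙ q
    go (m , q≡m , _) = m , q≡m , /1-cancel-< m (s * ↧ₙ q) (begin-strict
      fromNat m                            ≡⟨ sym (trans (*-↧ q) (cong (_/ 1) q≡m)) ⟩
      q ℚ.* fromNat (↧ₙ q)                 <⟨ ℚₚ.*-monoˡ-<-pos (fromNat (↧ₙ q)) {{ℚ.positive (/1-mono-< {+ 0} {+ ↧ₙ q} (ℤ.+<+ (s≤s z≤n)))}} q<s ⟩
      fromNat s ℚ.* fromNat (↧ₙ q)         ≡⟨ sym (fromNat-* s (↧ₙ q)) ⟩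
      fromNat (s * ↧ₙ q)                   ∎)

-- Comparison with ε Aˢ

fromℕ-mono-≤ : ∀ {m n} → m ≤ n → fromℕ m ≤ʳ fromℕ n
fromℕ-mono-≤ {m} {n} m≤n lt = ℕₚ.<⇒≱ (/1-cancel-< n m (constant-< {fromℕ n} {fromℕ m} (fromNat n) (fromNat m) (λ _ → refl) (λ _ → refl) lt)) m≤n

fromℕ-mono-< : ∀ {m n} → m < n → fromℕ m <ʳ fromℕ n
fromℕ-mono-< {m} {n} m<n = ℚ.½ , ℚₚ.positive⁻¹ ℚ.½ , 0 , λ _ _ → ℚₚ.<-≤-trans
  (ℚₚ.+-monoʳ-< (fromNat m) (ℚ.*<* (ℤ.+<+ (s≤s (s≤s z≤n)))))
  (subst (ℚ._≤ fromNat n) (trans (fromNat-+ 1 m) (ℚₚ.+-comm 1ℚ (fromNat m))) (fromNat-mono-≤ m<n))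

1≤fromℕ : ∀ A m .{{_ : ℕ.NonZero m}} → fromℕ m ≤ʳ A → 1ʳ ≤ʳ A
1≤fromℕ A m m≤A = ≤-trans {1ʳ} {fromℕ m} {A}
  (λ lt → ℕₚ.<⇒≱ (/1-cancel-< m 1 (constant-< {fromℕ m} {1ʳ} (fromNat m) 1ℚ (λ _ → refl) (λ _ → refl) lt)) (ℕ.>-nonZero⁻¹ m)) m≤A

archimedean : ∀ ε → 0ʳ <ʳ ε → ∃[ T ] 1ʳ <ʳ (fromℕ T *ʳ ε)
archimedean ε ε>0 = go (positive-bound ε ε>0)
  where
  go : ∃[ η ] 0ℚ ℚ.< η × η ℚ.≤ 1ℚ × ι η <ʳ ε → ∃[ T ] 1ʳ <ʳ (fromℕ T *ʳ ε)
  go (η , η>0 , _ , η<ε) = T , ≤-<-trans {1ʳ} {fromℕ T *ʳ ι η} {fromℕ T *ʳ ε} 1≤Tη (*-monoʳ-< {ι η} {ε} {fromℕ T} (fromℕ-positive T) η<ε)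
    where
    T : ℕ
    T = ↧ₙ η
    1≤Tη : 1ʳ ≤ʳ (fromℕ T *ʳ ι η)
    1≤Tη lt = ℚₚ.<-irrefl refl (ℚₚ.<-≤-trans
      (constant-< {fromℕ T *ʳ ι η} {1ʳ} (fromNat T ℚ.* η) 1ℚ (λ _ → refl) (λ _ → refl) lt)
      (subst (1ℚ ℚ.≤_) (trans (sym (*-↧ η)) (ℚₚ.*-comm η (fromNat T))) (/1-mono-≤ (1≤↥ η η>0))))

seq-1^ : ∀ n i → seq (1ʳ ^ʳ n) i ≡ 1ℚ
seq-1^ zero    i = refl
seq-1^ (suc n) i = trans (ℚₚ.*-identityˡ (seq (1ʳ ^ʳ n) i)) (seq-1^ n i)

1<Aε^n : ∀ ε T n A → 0ʳ <ʳ ε → 1ʳ <ʳ (fromℕ T *ʳ ε) → fromℕ (T ^ n) <ʳ A → 1ʳ <ʳ (A *ʳ (ε ^ʳ n))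
1<Aε^n ε T n A ε>0 1<Tε T^n<A = <-resp {1ʳ ^ʳ n} {1ʳ} {(ε ^ʳ n) *ʳ A} {A *ʳ (ε ^ʳ n)} (seq-1^ n) (λ i → ℚₚ.*-comm (seq (ε ^ʳ n) i) (seq A i))
  (≤-<-trans {1ʳ ^ʳ n} {(fromℕ T *ʳ ε) ^ʳ n} {(ε ^ʳ n) *ʳ A}
    (^-monoˡ-≤ {1ʳ} {fromℕ T *ʳ ε} 0<1 (<-asym {1ʳ} {fromℕ T *ʳ ε} 1<Tε) n)
    (<-resp {(ε ^ʳ n) *ʳ fromℕ (T ^ n)} {(fromℕ T *ʳ ε) ^ʳ n} {(ε ^ʳ n) *ʳ A} {(ε ^ʳ n) *ʳ A} [Tε]^n (λ _ → refl)
      (*-monoʳ-< {fromℕ (T ^ n)} {A} {ε ^ʳ n} (^-positive {ε} ε>0 n) T^n<A)))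
  where
  [Tε]^n : ∀ i → seq ((ε ^ʳ n) *ʳ fromℕ (T ^ n)) i ≡ seq ((fromℕ T *ʳ ε) ^ʳ n) i
  [Tε]^n i = begin
    seq (ε ^ʳ n) i ℚ.* fromNat (T ^ n)            ≡⟨ cong₂ ℚ._*_ (seq-^ℚ ε n i) (fromNat-^ T n) ⟩
    seq ε i ^ℚ n ℚ.* fromNat T ^ℚ n               ≡⟨ ℚₚ.*-comm (seq ε i ^ℚ n) (fromNat T ^ℚ n) ⟩
    fromNat T ^ℚ n ℚ.* seq ε i ^ℚ n               ≡⟨ sym (^ℚ-distrib-* (fromNat T) (seq ε i) n) ⟩
    (fromNat T ℚ.* seq ε i) ^ℚ n                  ≡⟨ sym (seq-^ℚ (fromℕ T *ʳ ε) n i) ⟩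
    seq ((fromℕ T *ʳ ε) ^ʳ n) i                   ∎
    where open ≡-Reasoning

^ℚ-rearrange : ∀ s n (e a : ℚ) {E P R Z} → E ≡ e ^ℚ n → P ≡ a ^ℚ (s * n) → R ≡ e ℚ.* a ^ℚ s → Z ≡ R ^ℚ n → E ℚ.* P ≡ Z
^ℚ-rearrange s n e a refl refl refl refl =
  trans (cong (λ z → e ^ℚ n ℚ.* z) (sym (^ℚ-assocʳ a s n))) (sym (^ℚ-distrib-* e (a ^ℚ s) n))

-- As m < sn, a whole power of A is to spare: (εAˢ)ⁿ ≥ (εⁿA)Aᵐ, and εⁿA > 1.
A^m<X^n : ∀ ε A X s m n → 0ʳ <ʳ ε → 1ʳ ≤ʳ A → m < s * n → 1ʳ <ʳ (A *ʳ (ε ^ʳ n)) →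
          (∀ i → seq X i ≡ seq ε i ℚ.* seq A i ^ℚ s) → (A ^ʳ m) <ʳ (X ^ʳ n)
A^m<X^n ε A X s m n ε>0 1≤A m<sn 1<Aε^n X≡ = go (ε ^ʳ n) (A ^ʳ m) (A ^ʳ suc m) (A ^ʳ (s * n))
    (seq-^ℚ ε n) (λ i → refl) (seq-^ℚ A (s * n)) (^-positive {ε} ε>0 n)
    (^-positive {A} (<-≤-trans {0ʳ} {1ʳ} {A} 0<1 1≤A) m) (^-monoʳ-≤ {A} 1≤A m<sn) 1<Aε^n
  where
  go : ∀ E P P′ R → (∀ i → seq E i ≡ seq ε i ^ℚ n) → (∀ i → seq P′ i ≡ seq A i ℚ.* seq P i) → (∀ i → seq R i ≡ seq A i ^ℚ (s * n)) →
       0ʳ <ʳ E → 0ʳ <ʳ P → P′ ≤ʳ R → 1ʳ <ʳ (A *ʳ E) → P <ʳ (X ^ʳ n)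
  go E P P′ R E≡ P′≡ R≡ E>0 P>0 P′≤R 1<AE =
    <-resp {P} {P} {E *ʳ R} {X ^ʳ n} (λ _ → refl)
      (λ i → ^ℚ-rearrange s n (seq ε i) (seq A i) (E≡ i) (R≡ i) (X≡ i) (seq-^ℚ X n i))
      (<-≤-trans {P} {E *ʳ P′} {E *ʳ R} strict (*-monoʳ-≤ {P′} {R} {E} E>0 P′≤R))
    where
    rearrange : ∀ i → seq P i ℚ.* (seq A i ℚ.* seq E i) ≡ seq E i ℚ.* seq P′ i
    rearrange i = trans (swap (seq P i) (seq A i) (seq E i)) (cong (λ z → seq E i ℚ.* z) (sym (P′≡ i)))
      where
      open ℚ-Solver
      swap : ∀ p a e → p ℚ.* (a ℚ.* e) ≡ e ℚ.* (a ℚ.* p)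
      swap = solve 3 (λ p a e → p :* (a :* e) := e :* (a :* p)) refl
    strict : P <ʳ (E *ʳ P′)
    strict = <-resp {P *ʳ 1ʳ} {P} {P *ʳ (A *ʳ E)} {E *ʳ P′}
      (λ i → ℚₚ.*-identityʳ (seq P i)) rearrange (*-monoʳ-< {1ʳ} {A *ʳ E} {P} P>0 1<AE)

power-saving : ∀ ε → 0ʳ <ʳ ε → ∀ s m n → m < s * n → ∃[ M ] ∀ A → fromℕ M ≤ʳ A →
               1ʳ ≤ʳ A × (∀ X → (∀ i → seq X i ≡ seq ε i ℚ.* seq A i ^ℚ s) → (A ^ʳ m) <ʳ (X ^ʳ n))
power-saving ε ε>0 s m n m<sn = go (archimedean ε ε>0)
  where
  go : ∃[ T ] 1ʳ <ʳ (fromℕ T *ʳ ε) → ∃[ M ] ∀ A → fromℕ M ≤ʳ A →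
       1ʳ ≤ʳ A × (∀ X → (∀ i → seq X i ≡ seq ε i ℚ.* seq A i ^ℚ s) → (A ^ʳ m) <ʳ (X ^ʳ n))
  -- Since Tε > 1, any A > Tⁿ satisfies Aεⁿ > 1; the 1 added makes the inequality for A strict.
  go (T , 1<Tε) = suc (T ^ n) , λ A M≤A → 1≤fromℕ A (suc (T ^ n)) M≤A ,
    λ X → A^m<X^n ε A X s m n ε>0 (1≤fromℕ A (suc (T ^ n)) M≤A) m<sn
      (1<Aε^n ε T n A ε>0 1<Tε (<-≤-trans {fromℕ (T ^ n)} {fromℕ (suc (T ^ n))} {A} (fromℕ-mono-< (ℕₚ.n<1+n (T ^ n))) M≤A))

ι-mono-≤ : ∀ {p q} → p ℚ.≤ q → ι p ≤ʳ ι q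
ι-mono-≤ {p} {q} p≤q lt = ℚₚ.<-irrefl refl (ℚₚ.<-≤-trans (constant-< {ι q} {ι p} q p (λ _ → refl) (λ _ → refl) lt) p≤q)

ι-positive : ∀ {c} → 0ℚ ℚ.< c → 0ʳ <ʳ ι c
ι-positive {c} c>0 = go (halve c c>0)
  where
  go : (∃[ η ] 0ℚ ℚ.< η × (∀ p → p ℚ.+ η ℚ.+ η ≡ p ℚ.+ c)) → 0ʳ <ʳ ι c
  go (η , η>0 , 2η≡c) = η , η>0 , 0 , λ _ _ → subst (0ℚ ℚ.+ η ℚ.<_) (trans (2η≡c 0ℚ) (ℚₚ.+-identityˡ c))
    (subst (ℚ._< 0ℚ ℚ.+ η ℚ.+ η) (ℚₚ.+-identityʳ (0ℚ ℚ.+ η)) (ℚₚ.+-monoʳ-< (0ℚ ℚ.+ η) η>0))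

-- The count will give C · cAˢ, which has to stay below εAˢ. Dividing by C + 1 instead of C covers C
-- = 0.
rational-fraction : ∀ ε → 0ʳ <ʳ ε → ∀ C → ∃[ c ] 0ℚ ℚ.< c × ι (fromNat C ℚ.* c) <ʳ ε
rational-fraction ε ε>0 C = go (positive-bound ε ε>0)
  where
  go : ∃[ η ] 0ℚ ℚ.< η × η ℚ.≤ 1ℚ × ι η <ʳ ε → ∃[ c ] 0ℚ ℚ.< c × ι (fromNat C ℚ.* c) <ʳ ε
  go (η , η>0 , _ , η<ε) = c , c>0 , ≤-<-trans {ι (fromNat C ℚ.* c)} {ι η} {ε} (ι-mono-≤ {fromNat C ℚ.* c} {η} Cc≤η) η<ε
    where
    D = fromNat (suc C)
    instance
      D-positive : ℚ.Positive D
      D-positive = ℚ.positive (/1-mono-< {+ 0} {+ suc C} (ℤ.+<+ (s≤s z≤n)))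
      D-nonZero : ℚ.NonZero D
      D-nonZero = ℚₚ.pos⇒nonZero D
    c = ℚ.1/ D ℚ.* η
    c>0 : 0ℚ ℚ.< c
    c>0 = ℚₚ.positive⁻¹ c {{ℚₚ.pos*pos⇒pos (ℚ.1/ D) {{ℚₚ.1/pos⇒pos D}} η {{ℚ.positive η>0}}}}
    Cc≤η : fromNat C ℚ.* c ℚ.≤ η
    Cc≤η = begin
      fromNat C ℚ.* c           ≤⟨ ℚₚ.*-monoʳ-≤-nonNeg c {{ℚ.nonNegative (ℚₚ.<⇒≤ c>0)}} (fromNat-mono-≤ (ℕₚ.n≤1+n C)) ⟩
      D ℚ.* c                   ≡⟨ sym (ℚₚ.*-assoc D (ℚ.1/ D) η) ⟩
      D ℚ.* ℚ.1/ D ℚ.* η        ≡⟨ trans (cong (ℚ._* η) (ℚₚ.*-inverseʳ D)) (ℚₚ.*-identityˡ η) ⟩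
      η                         ∎
      where open ℚₚ.≤-Reasoning

scale-< : ∀ C c ε B Y X → (∀ i → seq Y i ≡ c ℚ.* seq B i) → (∀ i → seq X i ≡ seq ε i ℚ.* seq B i) → 0ʳ <ʳ B →
          ι (fromNat C ℚ.* c) <ʳ ε → (fromℕ C *ʳ Y) <ʳ X
scale-< C c ε B Y X Y≡ X≡ B>0 Cc<ε = <-resp {B *ʳ ι (fromNat C ℚ.* c)} {fromℕ C *ʳ Y} {B *ʳ ε} {X}
  (λ i → trans (swap (seq B i) (fromNat C) c) (cong (λ z → fromNat C ℚ.* z) (sym (Y≡ i))))
  (λ i → trans (ℚₚ.*-comm (seq B i) (seq ε i)) (sym (X≡ i)))
  (*-monoʳ-< {ι (fromNat C ℚ.* c)} {ε} {B} B>0 Cc<ε)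
  where
  open ℚ-Solver
  swap : ∀ b C c → b ℚ.* (C ℚ.* c) ≡ C ℚ.* (c ℚ.* b)
  swap = solve 3 (λ b C c → b :* (C :* c) := C :* (c :* b)) refl

positive-product : ∀ ε B X → (∀ i → seq X i ≡ seq ε i ℚ.* seq B i) → 0ʳ <ʳ ε → 0ʳ <ʳ B → 0ʳ <ʳ X
positive-product ε B X X≡ ε>0 B>0 = <-resp {0ʳ} {0ʳ} {ε *ʳ B} {X} (λ _ → refl) (λ i → sym (X≡ i)) (*-positive {ε} {B} ε>0 B>0)

scaled : Point → Point → Point
scaled ε B = ε *ʳ B

module NegligibleExceptions (K s : ℕ) (4≤s : 4 ≤ s) (ν : ℝ) (δ : ℚ) (δ>0 : 0ℚ ℚ.< δ) (δ≤1 : δ ℚ.≤ 1ℚ) (δ<ν : ι δ <ʳ ν)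
  (C : ℕ) (≡C : countConstant s (threshold (suc K) ^ ↧ₙ δ) ≡ C) where
  open Exceptions K s 4≤s ν δ δ>0 δ≤1 δ<ν C ≡C

  few : ∀ ε c A B X Y m → ↥ q ≡ + m → ι (fromNat C ℚ.* c) <ʳ ε → 1ʳ ≤ʳ A → 0ʳ <ʳ B → 0ʳ <ʳ Y →
        (∀ i → seq X i ≡ seq ε i ℚ.* seq B i) → (∀ i → seq Y i ≡ c ℚ.* seq B i) → (A ^ʳ m) <ʳ (Y ^ʳ ↧ₙ q) → # Exceptional (suc K) s ν A ≤ X
  few ε c A B X Y m q≡m Cc<ε 1≤A B>0 Y>0 X≡ Y≡ A^m<Y^n as uq all X<L =
    count-exceptional K s 4≤s ν δ δ>0 δ<ν A 1≤A Y q m Y>0 e<q q≡m A^m<Y^n C ≡C as uq all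
      (<-trans {fromℕ C *ʳ Y} {X} {fromℕ (length as)} (scale-< C c ε B Y X Y≡ X≡ B>0 Cc<ε) X<L)

  small : ∀ A X m → ↥ q ≡ + m → 0ʳ <ʳ X → (A ^ʳ m) <ʳ (X ^ʳ ↧ₙ q) → A ℝ.^ℝ exponent s ν ≺ X
  small A X m q≡m X>0 A^m<X^n = X>0 , q , e<q , from-^ (↥ q) q≡m A^m<X^n
    where
    from-^ : ∀ i → i ≡ + m → (A ^ʳ m) <ʳ (X ^ʳ ↧ₙ q) → A ℝ.^ℤ i ≺ (X ^ʳ ↧ₙ q)
    from-^ _ refl lt = lt

  -- X stands for ε Aˢ.
  Negligible : ℝ → ℝ → Set
  Negligible ε A = ∀ X → (∀ i → seq X i ≡ seq ε i ℚ.* seq A i ^ℚ s) → (A ℝ.^ℝ exponent s ν ≺ X) × (# Exceptional (suc K) s ν A ≤ X)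

  Saving : ℝ → ℕ → ℝ → Set
  Saving ε m A = 1ʳ ≤ʳ A × (∀ X → (∀ i → seq X i ≡ seq ε i ℚ.* seq A i ^ℚ s) → (A ^ʳ m) <ʳ (X ^ʳ ↧ₙ q))

  saving⇒negligible : ∀ ε c m → 0ʳ <ʳ ε → 0ℚ ℚ.< c → ι (fromNat C ℚ.* c) <ʳ ε → ↥ q ≡ + m → ∀ A → Saving ε m A → Saving (ι c) m A → Negligible ε A
  saving⇒negligible ε c m ε>0 c>0 Cc<ε q≡m A (1≤A , A^m<) (_ , A^m<′) X X≡ =
    go (A ^ʳ s) (seq-^ℚ A s) (^-positive {A} (<-≤-trans {0ʳ} {1ʳ} {A} 0<1 1≤A) s)
    where
    go : ∀ B → (∀ i → seq B i ≡ seq A i ^ℚ s) → 0ʳ <ʳ B → (A ℝ.^ℝ exponent s ν ≺ X) × (# Exceptional (suc K) s ν A ≤ X)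
    go B B≡ B>0 = small A X m q≡m (positive-product ε B X X≡εB ε>0 B>0) (A^m< X X≡) , with-Y (scaled (ι c) B) (λ _ → refl)
      where
      X≡εB : ∀ i → seq X i ≡ seq ε i ℚ.* seq B i
      X≡εB i = trans (X≡ i) (cong (λ z → seq ε i ℚ.* z) (sym (B≡ i)))
      with-Y : ∀ Y → (∀ i → seq Y i ≡ c ℚ.* seq B i) → # Exceptional (suc K) s ν A ≤ X
      with-Y Y Y≡ = few ε c A B X Y m q≡m Cc<ε 1≤A B>0 (positive-product (ι c) B Y Y≡ (ι-positive c>0) B>0) X≡εB Y≡
        (A^m<′ Y (λ i → trans (Y≡ i) (cong (λ z → c ℚ.* z) (B≡ i))))

  -- `power-saving` is needed for two constants. At ε it shows that A^e is below εAˢ; at c it gives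
  -- A^q < cAˢ, whence the count is at most C · cAˢ < εAˢ.
  negligible : ∀ ε → 0ʳ <ʳ ε → ∃[ M ] ∀ A → fromℕ M ≤ʳ A → Negligible ε A
  negligible ε ε>0 = go (rational-fraction ε ε>0 C) numerator-q
    where
    go : ∃[ c ] 0ℚ ℚ.< c × ι (fromNat C ℚ.* c) <ʳ ε → ∃[ m ] ↥ q ≡ + m × m < s * ↧ₙ q → ∃[ M ] ∀ A → fromℕ M ≤ʳ A → Negligible ε A
    go (c , c>0 , Cc<ε) (m , q≡m , m<sn) = combine (power-saving ε ε>0 s m (↧ₙ q) m<sn) (power-saving (ι c) (ι-positive c>0) s m (↧ₙ q) m<sn)
      where
      combine : (∃[ M ] ∀ A → fromℕ M ≤ʳ A → Saving ε m A) → (∃[ M ] ∀ A → fromℕ M ≤ʳ A → Saving (ι c) m A) →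
                ∃[ M ] ∀ A → fromℕ M ≤ʳ A → Negligible ε A
      combine (M₁ , saving₁) (M₂ , saving₂) = M₁ ℕ.⊔ M₂ , λ A M≤A → saving⇒negligible ε c m ε>0 c>0 Cc<ε q≡m A
        (saving₁ A (≤-trans {fromℕ M₁} {fromℕ (M₁ ℕ.⊔ M₂)} {A} (fromℕ-mono-≤ (ℕₚ.m≤m⊔n M₁ M₂)) M≤A))
        (saving₂ A (≤-trans {fromℕ M₂} {fromℕ (M₁ ℕ.⊔ M₂)} {A} (fromℕ-mono-≤ (ℕₚ.m≤n⊔m M₁ M₂)) M≤A))

seq-scaled-power : ∀ ε A s i → seq (ε *ʳ (A ^ʳ s)) i ≡ seq ε i ℚ.* seq A i ^ℚ s
seq-scaled-power ε A s i = cong (λ z → seq ε i ℚ.* z) (seq-^ℚ A s i)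

at-scaled-power : ∀ (P : Point → Set) ε A s → (∀ X → (∀ i → seq X i ≡ seq ε i ℚ.* seq A i ^ℚ s) → P X) → P (ε ℝ.* (A ℝ.^ s))
at-scaled-power P ε A s f = f _ (seq-scaled-power ε A s)

-- The count comes in two forms because a negative exponent makes C A^e tend to 0, while an
-- exceptional tuple of small height stays in the count for every larger A. The comparison with εAˢ
-- concerns both A^e and the count itself, so it holds for all tuples and all λ > 0.
theorem1p6 : ∀ k → 2 ≤ k →
    ∃[ H ]
    ((∀ s → 3 ≤ s → ∀ ν → ℝ.1# ℝ.≤ ν →
    ∀ (a : Vec ℤ s) → AllNonZero a → H ≤ height a → Star k s ν a)
    ×
    (∀ s → 4 ≤ s → ∀ ν → ℝ.0# ℝ.< ν →
    (∃[ C ] ∀ A → ℝ.1# ℝ.≤ A →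
    # (λ a → H ≤ height a × Exceptional k s ν A a) ≤ C · A ^ exponent s ν)
    ×
    (ℝ.0# ℝ.≤ exponent s ν →
    ∃[ C ] ∀ A → ℝ.1# ℝ.≤ A →
    # Exceptional k s ν A ≤ C · A ^ exponent s ν)
    ×
    (∀ ε → ℝ.0# ℝ.< ε → ∃[ M ] ∀ A → ℝ.fromℕ M ℝ.≤ A →
    A ℝ.^ℝ exponent s ν ≺ (ε ℝ.* (A ℝ.^ s)) ×
    (# Exceptional k s ν A ≤ (ε ℝ.* (A ℝ.^ s))))))
theorem1p6 (suc K) _ = suc (threshold (suc K)) , part₁ K , λ s 4≤s ν ν>0 →
  -- δ is fixed before A, y and q, which makes C uniform in them.
  let δ , δ>0 , δ≤1 , δ<ν = positive-bound ν ν>0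
      C = countConstant s (threshold (suc K) ^ ↧ₙ δ)
      open Exceptions K s 4≤s ν δ δ>0 δ≤1 δ<ν
      open NegligibleExceptions K s 4≤s ν δ δ>0 δ≤1 δ<ν
  in (C , large-exceptions C refl) , (λ 0≤e → C , all-exceptions C refl 0≤e) ,
     λ ε ε>0 → let M , few = negligible C refl ε ε>0 in M , λ A M≤A → 
       at-scaled-power (λ X → (A ℝ.^ℝ exponent s ν ≺ X) × (# Exceptional (suc K) s ν A ≤ X)) ε A s (few A M≤A)
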